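{- Let $\mathcal T$ be a triangulation of the punctured disc $S_\odot$. Then its matching numbers $m_{ij}$ ($i,j$ boundary vertices, $j\neq i+1$, $j=i$ allowed) and $m_{i0}$ form a frieze pattern of type $D_N$: they are positive integers and, with $m_{i,i+1}=1$ and indices modulo $N$, for all boundary vertices $i,j$: (R1) $m_{ij}\, m_{i+1,j+1}=m_{i+1,j}\, m_{i,j+1}+1$ whenever $j\notin\{i-1,i,i+1\}$; (R2) $m_{i,i-1}\, m_{i+1,i}=m_{i+1,i-1}\, m_{ii}\, m_{i0}+1$; (R3) $m_{ii}\, m_{i+1,0}=m_{i+1,i}+1$; (R4) $m_{i0}\, m_{i+1,i+1}=m_{i+1,i}+1$.
   Context: Let $N\ge 3$ and let $S_\odot$ be a closed disc with $N$ marked points on its boundary, labelled $1,\dots,N$ in clockwise order (labels are taken modulo $N$), and one marked point $0$ (the puncture) in its interior. For boundary vertices $k,l$ let $B_{kl}$ be the boundary path going clockwise from $k$ to $l$ ($B_{kk}$ is the whole boundary starting and ending at $k$), and let $V_{kl}$ be the set of marked points on $B_{kl}$, i.e. $\{k,k+1,\dots,l\}$ modulo $N$. Arcs are taken up to isotopy relative to the marked points; they do not self-intersect, their interiors avoid the boundary and the marked points, and they do not cut out an unpunctured monogon or digon. They are: for boundary vertices $i,j$ with $j\ne i+1$ (possibly $j=i$), the arc $D_{ij}$ from $i$ to $j$ which together with $B_{ij}$ bounds a disc not containing the puncture (for $i=j$, $D_{ii}$ is the loop based at $i$ enclosing the puncture; for $i\neq j$, $D_{ij}\ne D_{ji}$);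 and, for each boundary vertex $i$, the central arc $D_{i0}$ from $i$ to the puncture. A triangulation $\mathcal T$ is a maximal collection of pairwise non-crossing arcs; it cuts $S_\odot$ into $N$ triangles, one of which may be self-folded (sides $D_{i0}$ and $D_{ii}$; exactly when $D_{i0}$ is the only central arc of $\mathcal T$). A triangle (or a piece of a triangle) is incident with a marked point if that point is one of its corners (and lies on the closure of the piece). For a set $I$ of marked points and a finite set $R$ of such regions, a matching between $I$ and $R$ is an injective map $I\to R$ sending each $p\in I$ to a region incident with $p$; $\mathcal M(I,R)$ denotes the set of these. Truncation: for boundary vertices $i\ne j$, $j\ne i+1$, let $S_{ij}$ be the unpunctured disc bounded by $D_{ij}$ and $B_{ij}$ (marked points $V_{ij}$), and let $\mathcal T|_{S_{ij}}$ be the set of connected components of the intersections of the triangles of $\mathcal T$ with $S_{ij}$ (a triangle crossed by $D_{ij}$ may give two separate pieces, each its own region), a piece being incident with those corners of its triangle in $V_{ij}$ lying on its closure. The disc $P(i)$: if $\mathcal T$ has at least two central arcs, let $k$ be the first boundary vertex reached going anticlockwise from $i$, starting with $i$ itself, with $D_{k0}\in\mathcal T$, and $j$ the first boundary vertex strictly clockwise from $i$ with $D_{j0}\in\mathcal T$; $P(i)$ is the unpunctured disc bounded by $B_{kj}$, $D_{j0}$, $D_{k0}$, with marked points $V_{kj}\cup\{0\}$, triangulated by the triangles of $\mathcal T$ inside it. If $\mathcal T$ has exactly one central arc $D_{k0}$ ($k$ possibly equal to $i$), $P(i)$ is the unpunctured disc obtained by cutting $S_\odot$ open along $D_{k0}$,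 with marked points in clockwise order $k',k+1,\dots,k-1,k,0$ ($k',k$ the two copies of $k$), triangulated by the triangles of $\mathcal T$ (the self-folded triangle becoming a triangle with corners $k,0,k'$). Matching numbers: $m_{i,i+1}=1$; for $i\neq j$, $j\ne i+1$: $m_{ij}=|\mathcal M(V_{i+1,j-1},\mathcal T|_{S_{ij}})|$; $m_{ii}=|\mathcal M((\{1,\dots,N\}\setminus\{i\})\cup\{0\},\ \text{triangles of }\mathcal T)|$ (each triangle of $\mathcal T$ one region); $m_{i0}=|\mathcal M(V(P(i))\setminus\{i,0\},\ \text{triangles of }P(i))|$, $V(P(i))$ the marked points of $P(i)$. A frieze pattern of type $D_N$ is an assignment of positive integers $m_{ij}$ (to the arcs $D_{ij}$) and $m_{i0}$ (to the arcs $D_{i0}$) satisfying (R1)–(R4) with the convention $m_{i,i+1}=1$ (the paper displays these numbers in a certain array, which is immaterial here).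
   Formalization: In m_ii a matching also chooses a corner of the region at each point, so a triangle with two corners at one vertex (possible only if 𝒯 has a self-folded triangle) counts twice there; with plain incidence (R4) fails, e.g. N=3, 𝒯={D_10,D_11,D_13}, where m_22=2 instead of 3. -}

module Defs where

-- Combinatorial model of the once-punctured disc S_⊙ with N marked boundary
-- points.  Boundary vertices are Fin N; the paper's vertex
-- label k ∈ {1..N} corresponds to k - 1 ∈ Fin N ("clockwise" = increasing,
-- indices mod N).  Arcs are described through their lifts to the universal
-- cover of S_⊙ minus the puncture: the boundary lifts to the line ℕ (more
-- precisely ℤ, but we only need a window of nonnegative positions), the
-- boundary vertex v ∈ Fin N lifts to the positions ≡ v (mod N), and the
-- puncture lifts to a single ideal point ∞.
--   * D i j  (j ≠ i+1) lifts to the segments [x , x + len i j], x ≡ i,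
--     where len i j ∈ {2,…,N} is the number of boundary edges of B_ij;
--   * C i    (the central arc D_i0) lifts to the rays from x ≡ i to ∞.

open import Data.Nat using (ℕ; zero; suc; _+_; _*_; _∸_; _≤_; _<_; NonZero)
open import Data.Nat.DivMod using (_%_; m%n<n)
open import Data.Bool using (Bool; true; false; if_then_else_; _∧_; not)
open import Data.Fin using (Fin; toℕ; fromℕ<)
open import Data.List using (List; []; _∷_; _++_; map; concatMap; upTo; length; filterᵇ)
open import Data.Nat.ListAction using (sum)
open import Data.Product using (_×_; _,_; Σ; ∃)
open import Data.Sum using (_⊎_)
open import Data.Empty using (⊥)
open import Data.Unit using (⊤)
open import Relation.Nullary using (¬_)
open import Relation.Binary.PropositionalEquality using (_≡_; _≢_)

import Data.Nat as ℕ

-- Generic matching numbers.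
--
-- A region is given by the list of its corners lying in the relevant set of
-- marked points (a corner of a region occurring twice, as for a triangle of
-- S_⊙ with two corners at the same boundary vertex, is listed twice).
-- A matching of the points I into the regions R is an injective assignment
-- of a region (together with one of its corners at that point) to each point
-- of I.  `matchings I R` is the number of them, computed by choosing the
-- image of the first point of I among the remaining regions.
-- When no region lists a point twice (the case for the regions of the
-- truncations T|S_ij and of the discs P(i)), this is exactly |M(I,R)|.

data Pt : Set where
  fin : ℕ → Pt     -- a boundary marked point (a vertex label / a lifted position)
  ∞   : Pt         -- the puncture 0

_==ᴾ_ : Pt → Pt → Bool
fin m ==ᴾ fin n = m ℕ.≡ᵇ n
fin _ ==ᴾ ∞     = false
∞     ==ᴾ fin _ = false
∞     ==ᴾ ∞     = true

occ : Pt → List Pt → ℕ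
occ p r = length (filterᵇ (p ==ᴾ_) r)

picks : {A : Set} → List A → List (A × List A)
picks []       = []
picks (x ∷ xs) = (x , xs) ∷ map (λ { (y , ys) → y , x ∷ ys }) (picks xs)

matchings : List Pt → List (List Pt) → ℕ
matchings []      R = 1
matchings (p ∷ I) R = sum (map (λ { (r , R′) → occ p r * matchings I R′ }) (picks R))

module _ (N : ℕ) .{{_ : NonZero N}} where

  ⌊_⌋ : ℕ → Fin N
  ⌊ x ⌋ = fromℕ< (m%n<n x N)

  _⊕_ : Fin N → ℕ → Fin N
  i ⊕ k = ⌊ toℕ i + k ⌋

  dist : Fin N → Fin N → ℕ
  dist i j = (toℕ j + N ∸ toℕ i) % N

  -- number of boundary edges of B_ij, in {1,…,N}  (B_ii is the whole boundary)
  len : Fin N → Fin N → ℕ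
  len i j = if dist i j ℕ.≡ᵇ 0 then N else dist i j

  data Arc : Set where
    D : Fin N → Fin N → Arc   -- D_ij (only meaningful when j ≠ i+1)
    C : Fin N → Arc

  IsArc : Arc → Set
  IsArc (D i j) = j ≢ i ⊕ 1
  IsArc (C i)   = ⊤

  -- two arcs cross iff some of their lifts cross (interleave strictly)
  Cross : Arc → Arc → Set
  Cross (D i j) (D k l) =
      (0 < dist i k × dist i k < len i j × len i j < dist i k + len k l)
    ⊎ (0 < dist k i × dist k i < len k l × len k l < dist k i + len i j)
  Cross (D i j) (C k) = 0 < dist i k × dist i k < len i j
  Cross (C k) (D i j) = 0 < dist i k × dist i k < len i j
  Cross (C k) (C l)   = ⊥

  record Triangulation : Set where
    field
      inT      : Arc → Bool
      onlyArcs : ∀ a → inT a ≡ true → IsArc a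
      nonCross : ∀ a b → inT a ≡ true → inT b ≡ true → ¬ Cross a b
      maximal  : ∀ a → IsArc a → inT a ≡ false →
                 ∃ λ b → inT b ≡ true × Cross a b

  -- lifted triangles: three positions x < y < z of the cover, or two
  -- positions x < y together with the ideal point ∞ (the puncture)
  data Tri : Set where
    fT : ℕ → ℕ → ℕ → Tri
    iT : ℕ → ℕ → Tri

  finVerts : Tri → List ℕ
  finVerts (fT x y z) = x ∷ y ∷ z ∷ []
  finVerts (iT x y)   = x ∷ y ∷ []

  corners : Tri → List Pt
  corners (fT x y z) = fin x ∷ fin y ∷ fin z ∷ []
  corners (iT x y)   = fin x ∷ fin y ∷ ∞ ∷ []

  shiftT : ℕ → Tri → Tri
  shiftT k (fT x y z) = fT (x + k * N) (y + k * N) (z + k * N)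
  shiftT k (iT x y)   = iT (x + k * N) (y + k * N)

  cornersS : Tri → List Pt
  cornersS (fT x y z) = fin (x % N) ∷ fin (y % N) ∷ fin (z % N) ∷ []
  cornersS (iT x y)   = fin (x % N) ∷ fin (y % N) ∷ ∞ ∷ []

  allBelow : (ℕ → Bool) → List ℕ → Bool
  allBelow p []       = true
  allBelow p (x ∷ xs) = p x ∧ allBelow p xs

  module Numbers (inT : Arc → Bool) where

    -- the lifted segment [x , x + L] (1 ≤ L ≤ N) is a boundary edge or
    -- a lift of an arc of 𝒯
    edge : ℕ → ℕ → Bool
    edge x L = if L ℕ.≡ᵇ 1 then true else inT (D ⌊ x ⌋ ⌊ x + L ⌋)

    -- The triangles of 𝒯, one lift of each (the one whose least finite
    -- position lies in {0,…,N-1}):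
    --  * fT a (a+p) (a+q), 0 < p < q ≤ N, all three sides edges;
    --  * iT a (a+p), 0 < p ≤ N, with D_a0, D_(a+p)0 ∈ 𝒯 and [a,a+p] an edge
    --    (p = N: the self-folded triangle, sides D_a0 and D_aa).
    finTris : List Tri
    finTris =
      concatMap (λ a →
        concatMap (λ p →
          concatMap (λ q →
            if edge a (suc p) ∧ edge (a + suc p) (q ∸ suc p) ∧ edge a q
            then fT a (a + suc p) (a + q) ∷ [] else [])
          (map (λ e → suc p + suc e) (upTo (N ∸ suc p))))
        (upTo (N ∸ 1)))
      (upTo N)

    idTris : List Tri
    idTris =
      concatMap (λ a →
        concatMap (λ p →
          if inT (C ⌊ a ⌋) ∧ inT (C ⌊ a + p ⌋) ∧ edge a p
          then iT a (a + p) ∷ [] else [])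
        (map suc (upTo N)))
      (upTo N)

    triangles : List Tri
    triangles = finTris ++ idTris

    mLoop : Fin N → ℕ
    mLoop i =
      matchings (map fin (filterᵇ (λ v → not (v ℕ.≡ᵇ toℕ i)) (upTo N)) ++ ∞ ∷ [])
                (map cornersS triangles)

    -- m_ij (j ≠ i, i+1): S_ij lifts to the region cut off by the segment
    -- [i₀ , i₀ + d] with i₀ = i + N and d = dist i j ∈ {2,…,N-1}.  Its regions
    -- are the intersections with the lifts of the triangles; the translates
    -- by 0, N, 2N of the chosen lifts are all those that can meet it.  A region
    -- is incident with the positions of its corners strictly inside (i₀,i₀+d),
    -- i.e. with its corners in V_{i+1,j-1}.
    mTrunc : Fin N → Fin N → ℕ
    mTrunc i j =
      matchings (map (λ e → fin (i₀ + suc e)) (upTo (d ∸ 1)))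
                (concatMap (λ t → map (λ k →
                   map fin (filterᵇ (λ v → (i₀ ℕ.<ᵇ v) ∧ (v ℕ.<ᵇ i₀ + d))
                                    (finVerts (shiftT k t))))
                   (upTo 3)) triangles)
      where
        i₀ = toℕ i + N
        d  = dist i j

    firstWith : (ℕ → Bool) → List ℕ → ℕ
    firstWith f []       = 0
    firstWith f (x ∷ xs) = if f x then x else firstWith f xs

    -- m_i0 : P(i) lifts to the region bounded by the rays at positions
    -- kk ≤ i₀ < jj (i₀ = i + N), kk ≡ k, jj ≡ j, and the boundary between them
    -- (jj = kk + N if 𝒯 has a single central arc).  Its marked points are the
    -- positions kk,…,jj and ∞; its triangles are the lifts of triangles of 𝒯
    -- with all finite corners in [kk, jj].  The point i removed is the
    -- position i₀, except when 𝒯 has the single central arc D_i0, where i is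
    -- the last copy (position jj = i₀ + N) in the paper's labelling
    -- k', k+1, …, k-1, k of P(i).
    mCentral : Fin N → ℕ
    mCentral i =
      matchings (map fin (filterᵇ (λ v → not (v ℕ.≡ᵇ rem)) (map (kk +_) (upTo (suc (jj ∸ kk))))))
                (concatMap (λ t → concatMap (λ k →
                   if allBelow (λ v → (kk ℕ.≤ᵇ v) ∧ (v ℕ.≤ᵇ jj)) (finVerts (shiftT k t))
                   then corners (shiftT k t) ∷ [] else [])
                   (upTo 3)) triangles)
      where
        i₀  = toℕ i + N
        t₁  = firstWith (λ t → inT (C ⌊ i₀ ∸ t ⌋)) (upTo N)
        t₂  = firstWith (λ t → inT (C ⌊ i₀ + t ⌋)) (map suc (upTo N))
        kk  = i₀ ∸ t₁
        jj  = i₀ + t₂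
        rem = if (t₁ ℕ.≡ᵇ 0) ∧ (t₂ ℕ.≡ᵇ N) then jj else i₀

    mNum : Fin N → Fin N → ℕ
    mNum i j = if toℕ j ℕ.≡ᵇ toℕ (i ⊕ 1) then 1
            else if toℕ j ℕ.≡ᵇ toℕ i then mLoop i
            else mTrunc i j

  m : Triangulation → Fin N → Fin N → ℕ
  m 𝒯 = Numbers.mNum (Triangulation.inT 𝒯)

  m₀ : Triangulation → Fin N → ℕ
  m₀ 𝒯 = Numbers.mCentral (Triangulation.inT 𝒯)

  record IsFriezeD (μ : Fin N → Fin N → ℕ) (μ₀ : Fin N → ℕ) : Set where
    field
      pos   : ∀ i j → 0 < μ i j
      pos₀  : ∀ i → 0 < μ₀ i
      conv  : ∀ i → μ i (i ⊕ 1) ≡ 1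
      R1    : ∀ i j → j ≢ i ⊕ (N ∸ 1) → j ≢ i → j ≢ i ⊕ 1 →
              μ i j * μ (i ⊕ 1) (j ⊕ 1) ≡ μ (i ⊕ 1) j * μ i (j ⊕ 1) + 1
      R2    : ∀ i →
              μ i (i ⊕ (N ∸ 1)) * μ (i ⊕ 1) i
                ≡ μ (i ⊕ 1) (i ⊕ (N ∸ 1)) * μ i i * μ₀ i + 1
      R3    : ∀ i → μ i i * μ₀ (i ⊕ 1) ≡ μ (i ⊕ 1) i + 1
      R4    : ∀ i → μ₀ i * μ (i ⊕ 1) (i ⊕ 1) ≡ μ (i ⊕ 1) i + 1

{-# OPTIONS --safe #-}

-- Lift 𝒯 to the cover of the punctured disc and give every position x a vector
-- V x ∈ ℤ², so that the puncture gets (1 , 0) and V y = V x + V z for every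
-- lifted triangle x < y < z (z possibly the puncture).  Translation by N then
-- acts as the shear by the number ρ of central arcs, and det (V x , V y) = 1
-- along edges.  Splitting off the root triangle of a triangulated polygon
-- shows, by induction, that the matchings of all its vertices but x and y
-- (and likewise the matchings of the vertices strictly between x and y) are
-- counted by det (V x , V y).  Hence m_ij = det (V i , V j), m_i0 is the second
-- coordinate of V i and m_ii = ρ m_i0, and (R1)-(R4) are Plücker relations.

module Submission where

open import Defs
open import Data.Nat using (ℕ; zero; suc; pred; _+_; _*_; _∸_; _≤_; _<_; z≤n; s≤s; NonZero; _≡ᵇ_; _<ᵇ_; _≤ᵇ_; >-nonZero⁻¹)
open import Data.Nat.Properties
open import Data.Nat.DivMod
open import Data.Nat.Divisibility using (divides-refl)
open import Data.Nat.ListAction using (sum)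
open import Data.Nat.Tactic.RingSolver using (solve-∀)
open import Data.Integer as ℤ using (ℤ; +_; 0ℤ; 1ℤ)
open import Data.Integer.Properties as ℤ using ()
import Data.Integer.Tactic.RingSolver as ℤ-Solver
open import Data.Fin using (Fin; toℕ)
open import Data.Fin.Properties using (toℕ-fromℕ<; toℕ-injective; toℕ<n)
open import Data.Bool using (Bool; true; false; if_then_else_; T; _∧_; not)
open import Data.Bool.Properties using (T?; T-≡; ∧-conicalˡ; ∧-conicalʳ; ∧-zeroʳ) renaming (_≟_ to _≟ᵇ_)
open import Data.List using (List; []; _∷_; _++_; map; concatMap; upTo; filterᵇ; filter)
open import Data.List.Properties using (map-∘; map-cong; ++-assoc; map-++; map-concatMap; concatMap-++)
open import Data.List.Membership.Propositional using (_∈_; find; lose)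
open import Data.List.Membership.Propositional.Properties hiding (finite)
open import Data.List.Relation.Unary.Any as Any using (Any; here; there)
open import Data.List.Relation.Unary.All as All using (All; []; _∷_)
open import Data.List.Relation.Unary.All.Properties as All using ()
open import Data.List.Relation.Unary.AllPairs using (AllPairs; []; _∷_)
import Data.List.Relation.Unary.AllPairs.Properties as AllPairs
open import Data.List.Relation.Unary.Unique.Propositional using (Unique)
open import Data.List.Relation.Unary.Unique.Propositional.Properties as Unique using ()
open import Data.List.Relation.Binary.Subset.Propositional using (_⊆_)
open import Data.List.Relation.Binary.Pointwise using (Pointwise; []; _∷_)
open import Data.List.Relation.Binary.Permutation.Propositional as Perm using (_↭_; prep; swap; ↭-refl; ↭-sym; ↭-trans; ↭-reflexive; ↭⇒↭ₛ)
open import Data.List.Relation.Binary.Permutation.Propositional.Properties as Perm using (shift; shifts; ++⁺ˡ; ∈-resp-↭)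
import Data.List.Relation.Binary.Permutation.Setoid.Properties as PermSetoid
open import Data.Product using (_×_; _,_; proj₁; proj₂; Σ; ∃; ∃₂)
open import Data.Sum using (_⊎_; inj₁; inj₂)
open import Data.Empty using (⊥; ⊥-elim)
open import Function using (_∘_; id; Equivalence)
open import Relation.Nullary using (¬_; Dec; yes; no; ¬?)
open import Relation.Nullary.Decidable using (_⊎-dec_; _×-dec_; map′)
open import Relation.Unary using (Decidable)
open import Relation.Binary.Definitions using (tri<; tri≈; tri>)
open import Relation.Binary.PropositionalEquality

-- Rectangular permanents

-- The apex of the root triangle belongs to both halves of the polygon and may be served by the root
-- triangle or by either half. A recursion must therefore know which ends of a side are still to be
-- matched, hence four counts per tree. Two kinds of selection are stable under it: a block of
-- consecutive vertices, and all vertices but one or two. In both, only one case needs more than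
-- additivity, namely two exceptional vertices on opposite sides of the apex, and there the Plücker
-- relation enters. Incidences are kept as rows of a permanent because rows can be added: cutting
-- the disc open along the central arc at `k₀` doubles the vertex `k₀`, its row is the sum of the
-- rows of the two copies, and m_ii splits by linearity. Numbering the puncture as the last position
-- makes the triangles at the puncture ordinary. The translation fixes the puncture, so it fixes (1
-- , 0) and the second coordinate b of every V x; a full turn then gives det (V x , V (x + N)) = ρ
-- b², which is m_ii m_i0. This is why (R2), with its triple product, is an instance of the identity
-- behind (R1).

x+[y+z]≡y+[x+z] : ∀ x y z → x + (y + z) ≡ y + (x + z)
x+[y+z]≡y+[x+z] = solve-∀

x*[y*z]≡y*[x*z] : ∀ x y z → x * (y * z) ≡ y * (x * z)
x*[y*z]≡y*[x*z] = solve-∀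

x*[y*z]≡z*[x*y] : ∀ x y z → x * (y * z) ≡ z * (x * y)
x*[y*z]≡z*[x*y] = solve-∀

-- The shape shared by `matchings` and by the expansions of a permanent along a row or a column: `h`
-- receives the chosen element and the list that remains.
psum : {A : Set} → (A → List A → ℕ) → List A → ℕ
psum h []       = 0
psum h (x ∷ xs) = h x xs + psum (λ y ys → h y (x ∷ ys)) xs

-- The sum, over all injections of the rows fs into the columns bs, of the
-- products of the entries f b.
perm : {B : Set} → List (B → ℕ) → List B → ℕ
perm []       bs = 1
perm (f ∷ fs) bs = psum (λ b cs → f b * perm fs cs) bs

-- Membership is passed to the equation so that permanents are compared only at columns that occur;
-- `ys ⊆ xs` carries this through the recursion on rows.
psum-cong : {A : Set} {h k : A → List A → ℕ} (xs : List A) →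
            (∀ x ys → x ∈ xs → ys ⊆ xs → h x ys ≡ k x ys) → psum h xs ≡ psum k xs
psum-cong []       e = refl
psum-cong (x ∷ xs) e =
  cong₂ _+_ (e x xs (here refl) there)
            (psum-cong xs (λ y ys y∈ s → e y (x ∷ ys) (there y∈)
                                            (λ { (here q) → here q ; (there q) → there (s q) })))

psum-cong′ : {A : Set} {h k : A → List A → ℕ} (xs : List A) →
             (∀ x ys → h x ys ≡ k x ys) → psum h xs ≡ psum k xs
psum-cong′ xs e = psum-cong xs (λ x ys _ _ → e x ys)

psum-0 : {A : Set} {h : A → List A → ℕ} (xs : List A) →
         (∀ x ys → x ∈ xs → h x ys ≡ 0) → psum h xs ≡ 0
psum-0 []       e = refl
psum-0 (x ∷ xs) e = cong₂ _+_ (e x xs (here refl)) (psum-0 xs (λ y ys y∈ → e y (x ∷ ys) (there y∈)))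

psum-+ : {A : Set} (h k : A → List A → ℕ) (xs : List A) →
         psum (λ x ys → h x ys + k x ys) xs ≡ psum h xs + psum k xs
psum-+ h k []       = refl
psum-+ h k (x ∷ xs) =
  trans (cong (λ s → h x xs + k x xs + s) (psum-+ (λ y ys → h y (x ∷ ys)) (λ y ys → k y (x ∷ ys)) xs))
        (interchange (h x xs) (k x xs) _ _)
  where
  interchange : ∀ a b c d → a + b + (c + d) ≡ a + c + (b + d)
  interchange = solve-∀

psum-*ˡ : {A : Set} (c : ℕ) (h : A → List A → ℕ) (xs : List A) →
          psum (λ x ys → c * h x ys) xs ≡ c * psum h xs
psum-*ˡ c h []       = sym (*-zeroʳ c)
psum-*ˡ c h (x ∷ xs) =
  trans (cong (λ s → c * h x xs + s) (psum-*ˡ c (λ y ys → h y (x ∷ ys)) xs))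
        (sym (*-distribˡ-+ c (h x xs) _))

psum-++ : {A : Set} (h : A → List A → ℕ) (xs ys : List A) →
          psum h (xs ++ ys) ≡ psum (λ x zs → h x (zs ++ ys)) xs + psum (λ y zs → h y (xs ++ zs)) ys
psum-++ h []       ys = refl
psum-++ h (x ∷ xs) ys =
  trans (cong (λ s → h x (xs ++ ys) + s) (psum-++ (λ y zs → h y (x ∷ zs)) xs ys))
        (sym (+-assoc (h x (xs ++ ys)) _ _))

psum-map : {A B : Set} (g : A → B) (h : B → List B → ℕ) (xs : List A) →
           psum h (map g xs) ≡ psum (λ x ys → h (g x) (map g ys)) xs
psum-map g h []       = refl
psum-map g h (x ∷ xs) = cong (λ s → h (g x) (map g xs) + s) (psum-map g (λ y ys → h y (g x ∷ ys)) xs)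

psum-comm : {A B : Set} (h : A → List A → B → List B → ℕ) (xs : List A) (ys : List B) →
            psum (λ x xs′ → psum (h x xs′) ys) xs ≡ psum (λ y ys′ → psum (λ x xs′ → h x xs′ y ys′) xs) ys
psum-comm h []       ys = sym (psum-0 ys (λ _ _ _ → refl))
psum-comm h (x ∷ xs) ys =
  trans (cong (λ s → psum (h x xs) ys + s) (psum-comm (λ y zs → h y (x ∷ zs)) xs ys))
        (sym (psum-+ (h x xs) _ ys))

-- The two choices come one after the other from the same list, and each ordered choice is paired
-- with its reverse. In `psum-comm` the two lists are independent.
psum-swap : {A : Set} (h : A → A → List A → ℕ) (xs : List A) →
            psum (λ x ys → psum (h x) ys) xs ≡ psum (λ x ys → psum (λ y → h y x) ys) xs
psum-swap h []       = refl
psum-swap h (a ∷ as) = begin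
  psum (h a) as + psum (λ x ys → h x a ys + psum (λ y zs → h x y (a ∷ zs)) ys) as
    ≡⟨ cong (λ s → psum (h a) as + s) (psum-+ (λ x → h x a) _ as) ⟩
  psum (h a) as + (psum (λ x → h x a) as + psum (λ x → psum (λ y zs → h x y (a ∷ zs))) as)
    ≡⟨ cong (λ s → psum (h a) as + (psum (λ x → h x a) as + s)) (psum-swap (λ x y zs → h x y (a ∷ zs)) as) ⟩
  psum (h a) as + (psum (λ x → h x a) as + psum (λ x → psum (λ y zs → h y x (a ∷ zs))) as)
    ≡⟨ x+[y+z]≡y+[x+z] (psum (h a) as) (psum (λ x → h x a) as) _ ⟩
  psum (λ x → h x a) as + (psum (h a) as + psum (λ x → psum (λ y zs → h y x (a ∷ zs))) as)
    ≡⟨ cong (λ s → psum (λ x → h x a) as + s) (psum-+ (h a) _ as) ⟨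
  psum (λ x → h x a) as + psum (λ x ys → h a x ys + psum (λ y zs → h y x (a ∷ zs)) ys) as ∎
  where open ≡-Reasoning

psum-↭ : {A : Set} {h : A → List A → ℕ} → (∀ x {ys zs} → ys ↭ zs → h x ys ≡ h x zs) →
         ∀ {xs ys} → xs ↭ ys → psum h xs ≡ psum h ys
psum-↭ r Perm.refl = refl
psum-↭ r (prep x p) = cong₂ _+_ (r x p) (psum-↭ (λ y q → r y (prep x q)) p)
psum-↭ {h = h} r (swap {xs} {ys} x y p) =
  trans (x+[y+z]≡y+[x+z] (h x (y ∷ xs)) (h y (x ∷ xs)) _)
        (cong₂ _+_ (r y (prep x p))
          (cong₂ _+_ (r x (prep y p))
            (trans (psum-cong′ xs (λ z zs → r z (swap x y ↭-refl)))
                   (psum-↭ (λ z q → r z (prep y (prep x q))) p))))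
psum-↭ r (Perm.trans p q) = trans (psum-↭ r p) (psum-↭ r q)

-- A point becomes its row of incidences with the regions. Unlike points, rows can be added and
-- replaced by others that agree on the columns present.
matchings-perm : (I : List Pt) (R : List (List Pt)) → matchings I R ≡ perm (map occ I) R
matchings-perm []      R = refl
matchings-perm (p ∷ I) R =
  trans (sum-picks R _) (psum-cong′ R (λ r S → cong (occ p r *_) (matchings-perm I S)))
  where
  sum-picks : {A : Set} (xs : List A) (g : A × List A → ℕ) →
              sum (map g (picks xs)) ≡ psum (λ x ys → g (x , ys)) xs
  sum-picks []       g = refl
  sum-picks (x ∷ xs) g =
    cong (λ s → g (x , xs) + s) (trans (cong sum (sym (map-∘ (picks xs))))
                                (sum-picks xs (λ y → g (proj₁ y , x ∷ proj₂ y))))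

perm-cong : {B : Set} (bs : List B) {fs gs : List (B → ℕ)} →
            Pointwise (λ f g → ∀ b → b ∈ bs → f b ≡ g b) fs gs → perm fs bs ≡ perm gs bs
perm-cong bs []       = refl
perm-cong bs (e ∷ es) =
  psum-cong bs (λ b cs b∈ s → cong₂ _*_ (e b b∈) (perm-cong cs (weaken s es)))
  where
  weaken : ∀ {cs fs gs} → cs ⊆ bs →
           Pointwise (λ f g → ∀ b → b ∈ bs → f b ≡ g b) fs gs →
           Pointwise (λ f g → ∀ b → b ∈ cs → f b ≡ g b) fs gs
  weaken s []       = []
  weaken s (e ∷ es) = (λ b b∈ → e b (s b∈)) ∷ weaken s es

perm-map : {B C : Set} (g : B → C) (fs : List (C → ℕ)) (bs : List B) →
           perm fs (map g bs) ≡ perm (map (_∘ g) fs) bs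
perm-map g []       bs = refl
perm-map g (f ∷ fs) bs =
  trans (psum-map g _ bs) (psum-cong′ bs (λ b cs → cong (f (g b) *_) (perm-map g fs cs)))

perm-↭ : {B : Set} (fs : List (B → ℕ)) {bs cs : List B} → bs ↭ cs → perm fs bs ≡ perm fs cs
perm-↭ []       p = refl
perm-↭ (f ∷ fs) p = psum-↭ (λ b q → cong (f b *_) (perm-↭ fs q)) p

perm-rows-↭ : {B : Set} {fs gs : List (B → ℕ)} → fs ↭ gs → (bs : List B) → perm fs bs ≡ perm gs bs
perm-rows-↭ Perm.refl       bs = refl
perm-rows-↭ (prep f p)      bs = psum-cong′ bs (λ b cs → cong (f b *_) (perm-rows-↭ p cs))
perm-rows-↭ (swap {fs} {gs} f g p) bs = begin
  psum (λ b cs → f b * psum (λ c ds → g c * perm fs ds) cs) bs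
    ≡⟨ psum-cong′ bs (λ b cs → sym (psum-*ˡ (f b) _ cs)) ⟩
  psum (λ b cs → psum (λ c ds → f b * (g c * perm fs ds)) cs) bs
    ≡⟨ psum-swap (λ b c ds → f b * (g c * perm fs ds)) bs ⟩
  psum (λ b cs → psum (λ c ds → f c * (g b * perm fs ds)) cs) bs
    ≡⟨ psum-cong′ bs (λ b cs → trans (psum-cong′ cs (λ c ds → x*[y*z]≡y*[x*z] (f c) (g b) (perm fs ds)))
                                     (psum-*ˡ (g b) _ cs)) ⟩
  psum (λ b cs → g b * psum (λ c ds → f c * perm fs ds) cs) bs
    ≡⟨ psum-cong′ bs (λ b cs → cong (g b *_) (psum-cong′ cs (λ c ds → cong (f c *_) (perm-rows-↭ p ds)))) ⟩
  psum (λ b cs → g b * psum (λ c ds → f c * perm gs ds) cs) bs ∎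
  where open ≡-Reasoning
perm-rows-↭ (Perm.trans p q) bs = trans (perm-rows-↭ p bs) (perm-rows-↭ q bs)

perm-row-+ : {B : Set} (f g h : B → ℕ) (fs : List (B → ℕ)) (bs : List B) →
             (∀ b → b ∈ bs → f b ≡ g b + h b) →
             perm (f ∷ fs) bs ≡ perm (g ∷ fs) bs + perm (h ∷ fs) bs
perm-row-+ f g h fs bs e =
  trans (psum-cong bs (λ b cs b∈ _ → trans (cong (_* perm fs cs) (e b b∈)) (*-distribʳ-+ (perm fs cs) (g b) (h b))))
        (psum-+ _ _ bs)

-- The rows must all be used, the columns need not: `b` either stays free, which is the first
-- summand, or serves exactly one row.
perm-column : {B : Set} (fs : List (B → ℕ)) (b : B) (bs : List B) →
              perm fs (b ∷ bs) ≡ perm fs bs + psum (λ f gs → f b * perm gs bs) fs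
perm-column []       b bs = refl
perm-column (f ∷ fs) b bs = begin
  f b * perm fs bs + psum (λ c cs → f c * perm fs (b ∷ cs)) bs
    ≡⟨ cong (λ s → f b * perm fs bs + s) (psum-cong′ bs (λ c cs →
         trans (cong (f c *_) (perm-column fs b cs)) (*-distribˡ-+ (f c) (perm fs cs) _))) ⟩
  f b * perm fs bs + psum (λ c cs → f c * perm fs cs + f c * psum (λ g gs → g b * perm gs cs) fs) bs
    ≡⟨ cong (λ s → f b * perm fs bs + s) (psum-+ _ _ bs) ⟩
  f b * perm fs bs + (perm (f ∷ fs) bs + psum (λ c cs → f c * psum (λ g gs → g b * perm gs cs) fs) bs)
    ≡⟨ cong (λ s → f b * perm fs bs + (perm (f ∷ fs) bs + s)) inner ⟩
  f b * perm fs bs + (perm (f ∷ fs) bs + psum (λ g gs → g b * perm (f ∷ gs) bs) fs)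
    ≡⟨ x+[y+z]≡y+[x+z] (f b * perm fs bs) (perm (f ∷ fs) bs) _ ⟩
  perm (f ∷ fs) bs + (f b * perm fs bs + psum (λ g gs → g b * perm (f ∷ gs) bs) fs) ∎
  where
  open ≡-Reasoning
  inner : psum (λ c cs → f c * psum (λ g gs → g b * perm gs cs) fs) bs ≡
          psum (λ g gs → g b * perm (f ∷ gs) bs) fs
  inner = begin
    psum (λ c cs → f c * psum (λ g gs → g b * perm gs cs) fs) bs
      ≡⟨ psum-cong′ bs (λ c cs → sym (psum-*ˡ (f c) _ fs)) ⟩
    psum (λ c cs → psum (λ g gs → f c * (g b * perm gs cs)) fs) bs
      ≡⟨ psum-comm (λ c cs g gs → f c * (g b * perm gs cs)) bs fs ⟩
    psum (λ g gs → psum (λ c cs → f c * (g b * perm gs cs)) bs) fs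
      ≡⟨ psum-cong′ fs (λ g gs → trans (psum-cong′ bs (λ c cs → x*[y*z]≡y*[x*z] (f c) (g b) (perm gs cs)))
                                       (psum-*ˡ (g b) _ bs)) ⟩
    psum (λ g gs → g b * perm (f ∷ gs) bs) fs ∎

VanishOn : {B : Set} → List B → (B → ℕ) → Set
VanishOn bs f = ∀ b → b ∈ bs → f b ≡ 0

perm-drop : {B : Set} (fs : List (B → ℕ)) (bs cs : List B) → All (VanishOn bs) fs →
            perm fs (bs ++ cs) ≡ perm fs cs
perm-drop fs []       cs z = refl
perm-drop fs (b ∷ bs) cs z =
  trans (perm-column fs b (bs ++ cs))
        (trans (cong₂ _+_ (perm-drop fs bs cs (All.map (λ v c c∈ → v c (there c∈)) z))
                          (psum-0 fs (λ f gs f∈ → cong (_* perm gs (bs ++ cs)) (All.lookup z f∈ b (here refl)))))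
               (+-identityʳ _))

-- The matrix is block diagonal, so an injection is a pair of injections.
perm-split : {B : Set} (fs gs : List (B → ℕ)) (bs cs : List B) →
             All (VanishOn cs) fs → All (VanishOn bs) gs →
             perm (fs ++ gs) (bs ++ cs) ≡ perm fs bs * perm gs cs
perm-split []       gs bs cs zf zg = trans (perm-drop gs bs cs zg) (sym (+-identityʳ _))
perm-split (f ∷ fs) gs bs cs (z ∷ zf) zg = begin
  psum (λ b ds → f b * perm (fs ++ gs) ds) (bs ++ cs)
    ≡⟨ psum-++ _ bs cs ⟩
  psum (λ b ds → f b * perm (fs ++ gs) (ds ++ cs)) bs + psum (λ b ds → f b * perm (fs ++ gs) (bs ++ ds)) cs
    ≡⟨ cong₂ _+_ (psum-cong bs (λ b ds b∈ s → trans (cong (f b *_)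
                    (perm-split fs gs ds cs zf (All.map (λ v d d∈ → v d (s d∈)) zg)))
                    (x*[y*z]≡z*[x*y] (f b) (perm fs ds) (perm gs cs))))
                 (psum-0 cs (λ b ds b∈ → cong (_* perm (fs ++ gs) (bs ++ ds)) (z b b∈))) ⟩
  psum (λ b ds → perm gs cs * (f b * perm fs ds)) bs + 0
    ≡⟨ +-identityʳ _ ⟩
  psum (λ b ds → perm gs cs * (f b * perm fs ds)) bs
    ≡⟨ psum-*ˡ (perm gs cs) _ bs ⟩
  perm gs cs * perm (f ∷ fs) bs
    ≡⟨ *-comm (perm gs cs) _ ⟩
  perm (f ∷ fs) bs * perm gs cs ∎
  where open ≡-Reasoning

-- Block diagonal apart from the row `f`, which takes its column from one block or from the other.
perm-share : {B : Set} (f : B → ℕ) (fs gs : List (B → ℕ)) (bs cs : List B) →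
             All (VanishOn cs) fs → All (VanishOn bs) gs →
             perm (f ∷ fs ++ gs) (bs ++ cs) ≡ perm (f ∷ fs) bs * perm gs cs + perm fs bs * perm (f ∷ gs) cs
perm-share f fs gs bs cs zf zg = trans (psum-++ _ bs cs) (cong₂ _+_
  (trans (psum-cong bs (λ b ds b∈ s → trans (cong (f b *_)
            (perm-split fs gs ds cs zf (All.map (λ v d d∈ → v d (s d∈)) zg)))
            (x*[y*z]≡z*[x*y] (f b) (perm fs ds) (perm gs cs))))
         (trans (psum-*ˡ (perm gs cs) _ bs) (*-comm (perm gs cs) _)))
  (trans (psum-cong cs (λ c ds c∈ s → trans (cong (f c *_)
            (perm-split fs gs bs ds (All.map (λ v d d∈ → v d (s d∈)) zf) zg))
            (x*[y*z]≡y*[x*z] (f c) (perm fs bs) (perm gs ds))))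
         (psum-*ˡ (perm fs bs) _ cs)))

-- Triangulated polygons

opt : {A : Set} → Bool → A → List A
opt true  x = x ∷ []
opt false x = []

when : Bool → ℕ → ℕ
when true  n = n
when false n = 0

module _ {B : Set} where

  -- Rows fs only meet the columns bs and rows gs only the columns cs; the row
  -- r may use either group, and the column τ serves p, q and r.
  permShare : Bool → (p r q : B → ℕ) (fs gs : List (B → ℕ)) (bs cs : List B) → Bool → Bool → ℕ
  permShare true  p r q fs gs bs cs a b =
    perm (opt a p ++ r ∷ fs) bs * perm (opt b q ++ gs) cs + perm (opt a p ++ fs) bs * perm (r ∷ opt b q ++ gs) cs
  permShare false p r q fs gs bs cs a b =
    perm (opt a p ++ fs) bs * perm (opt b q ++ gs) cs

  private
    rows-↭ : (a b : Bool) (p q : B → ℕ) (fs gs : List (B → ℕ)) →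
             opt a p ++ opt b q ++ fs ++ gs ↭ (opt a p ++ fs) ++ (opt b q ++ gs)
    rows-↭ a b p q fs gs =
      ↭-trans (++⁺ˡ (opt a p) (shifts (opt b q) fs)) (↭-reflexive (sym (++-assoc (opt a p) fs _)))

    All-opt : {P : (B → ℕ) → Set} (a : Bool) {p : B → ℕ} {fs : List (B → ℕ)} → P p → All P fs → All P (opt a p ++ fs)
    All-opt true  z zs = z ∷ zs
    All-opt false z zs = zs

  perm-rows-share : (a b s : Bool) (p r q : B → ℕ) (fs gs : List (B → ℕ)) (bs cs : List B) →
    All (VanishOn cs) (p ∷ fs) → All (VanishOn bs) (q ∷ gs) →
    perm (opt a p ++ opt b q ++ opt s r ++ fs ++ gs) (bs ++ cs) ≡ permShare s p r q fs gs bs cs a b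
  perm-rows-share a b false p r q fs gs bs cs (zp ∷ zf) (zq ∷ zg) =
    trans (perm-rows-↭ (rows-↭ a b p q fs gs) (bs ++ cs))
          (perm-split (opt a p ++ fs) (opt b q ++ gs) bs cs (All-opt a zp zf) (All-opt b zq zg))
  perm-rows-share a b true p r q fs gs bs cs (zp ∷ zf) (zq ∷ zg) =
    trans (perm-rows-↭ r-first (bs ++ cs))
          (trans (perm-share r (opt a p ++ fs) (opt b q ++ gs) bs cs (All-opt a zp zf) (All-opt b zq zg))
                 (cong (λ n → n * perm (opt b q ++ gs) cs + perm (opt a p ++ fs) bs * perm (r ∷ opt b q ++ gs) cs)
                       (perm-rows-↭ (↭-sym (shift r (opt a p) fs)) bs)))
    where
    r-first : opt a p ++ opt b q ++ r ∷ fs ++ gs ↭ r ∷ (opt a p ++ fs) ++ (opt b q ++ gs)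
    r-first = ↭-trans (++⁺ˡ (opt a p) (shift r (opt b q) (fs ++ gs)))
                      (↭-trans (shift r (opt a p) _) (prep r (rows-↭ a b p q fs gs)))

  psum-opt : (h : (B → ℕ) → List (B → ℕ) → ℕ) (a : Bool) (p : B → ℕ) (fs : List (B → ℕ)) →
             psum h (opt a p ++ fs) ≡ when a (h p fs) + psum (λ f gs → h f (opt a p ++ gs)) fs
  psum-opt h true  p fs = refl
  psum-opt h false p fs = refl

  -- Expansion along the column `τ`: it stays free, or serves `p`, `q` or `r`. Once it serves `r`,
  -- nothing links the two blocks any more, whence `permShare false` in the last term.
  perm-node : (a b s : Bool) (p r q : B → ℕ) (fs gs : List (B → ℕ)) (τ : B) (bs cs : List B) →
    p τ ≡ 1 → r τ ≡ 1 → q τ ≡ 1 → All (λ f → f τ ≡ 0) (fs ++ gs) →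
    All (VanishOn cs) (p ∷ fs) → All (VanishOn bs) (q ∷ gs) →
    let Y = permShare s p r q fs gs bs cs in
    perm (opt a p ++ opt b q ++ opt s r ++ fs ++ gs) (τ ∷ bs ++ cs) ≡
    Y a b + (when a (Y false b) + (when b (Y a false) + when s (permShare false p r q fs gs bs cs a b)))
  perm-node a b s p r q fs gs τ bs cs p1 r1 q1 zτ zp zq =
    trans (perm-column (opt a p ++ opt b q ++ opt s r ++ fs ++ gs) τ (bs ++ cs))
    (cong₂ _+_ (perm-rows-share a b s p r q fs gs bs cs zp zq)
    (trans (psum-opt h a p (opt b q ++ opt s r ++ fs ++ gs))
    (cong₂ _+_ (cong (when a) (unit p1 (perm-rows-share false b s p r q fs gs bs cs zp zq)))
    (trans (psum-opt (λ f hs → h f (opt a p ++ hs)) b q (opt s r ++ fs ++ gs))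
    (cong₂ _+_ (cong (when b) (unit q1 (perm-rows-share a false s p r q fs gs bs cs zp zq)))
    (trans (psum-opt (λ f hs → h f (opt a p ++ opt b q ++ hs)) s r (fs ++ gs))
    (trans (cong₂ _+_ (cong (when s) (unit r1 (perm-rows-share a b false p r q fs gs bs cs zp zq)))
                      (psum-0 (fs ++ gs) (λ f hs f∈ → cong (_* perm (opt a p ++ opt b q ++ opt s r ++ hs) (bs ++ cs)) (All.lookup zτ f∈))))
           (+-identityʳ _))))))))
    where
    h : (B → ℕ) → List (B → ℕ) → ℕ
    h f hs = f τ * perm hs (bs ++ cs)
    unit : ∀ {x y z} → x ≡ 1 → y ≡ z → x * y ≡ z
    unit refl refl = +-identityʳ _

Triple : Set
Triple = ℕ × ℕ × ℕ

-- Triangulations of the polygon with vertices p, p + 1, ..., q, rooted at the side from p to q: a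
-- node is the root triangle with apex r together with the triangulations behind its other two
-- sides, and a leaf is a boundary side.
data Tree : ℕ → ℕ → Set where
  leaf : ∀ {p} → Tree p (suc p)
  node : ∀ {p r q} → Tree p r → Tree r q → Tree p q

tree-< : ∀ {p q} → Tree p q → p < q
tree-< leaf       = n<1+n _
tree-< (node s t) = <-trans (tree-< s) (tree-< t)

regs : ∀ {p q} → Tree p q → List Triple
regs leaf                 = []
regs (node {p} {r} {q} s t) = (p , r , q) ∷ regs s ++ regs t

ints : (ℕ → Bool) → ∀ {p q} → Tree p q → List ℕ
ints sel leaf               = []
ints sel (node {r = r} s t) = opt (sel r) r ++ ints sel s ++ ints sel t

regs-bounds : ∀ {p q x y z} (t : Tree p q) → (x , y , z) ∈ regs t → p ≤ x × x < y × y < z × z ≤ q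
regs-bounds (node s t) (here refl) = ≤-refl , tree-< s , tree-< t , ≤-refl
regs-bounds (node s t) (there m) with ∈-++⁻ (regs s) m
... | inj₁ m′ = let a , b , c , d = regs-bounds s m′ in a , b , c , ≤-trans d (<⇒≤ (tree-< t))
... | inj₂ m′ = let a , b , c , d = regs-bounds t m′ in ≤-trans (<⇒≤ (tree-< s)) a , b , c , d

∈-opt⁻ : {A : Set} (b : Bool) {x y : A} → x ∈ opt b y → b ≡ true × x ≡ y
∈-opt⁻ true (here refl) = refl , refl

∈-ints⁻ : ∀ sel {p q v} (t : Tree p q) → v ∈ ints sel t → p < v × v < q × sel v ≡ true
∈-ints⁻ sel (node {r = r} s t) m with ∈-++⁻ (opt (sel r) r) m
... | inj₁ m′ with ∈-opt⁻ (sel r) m′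
...   | e , refl = tree-< s , tree-< t , e
∈-ints⁻ sel (node s t) m | inj₂ m′ with ∈-++⁻ (ints sel s) m′
... | inj₁ k = let a , b , c = ∈-ints⁻ sel s k in a , <-trans b (tree-< t) , c
... | inj₂ k = let a , b , c = ∈-ints⁻ sel t k in <-trans (tree-< s) a , b , c

∈-ints⁺ : ∀ sel {p q v} (t : Tree p q) → p < v → v < q → sel v ≡ true → v ∈ ints sel t
∈-ints⁺ sel leaf p<v v<q e = ⊥-elim (<-irrefl refl (≤-trans v<q p<v))
∈-ints⁺ sel {v = v} (node {r = r} s t) p<v v<q e with <-cmp v r
... | tri< v<r _ _ = ∈-++⁺ʳ (opt (sel r) r) (∈-++⁺ˡ (∈-ints⁺ sel s p<v v<r e))
... | tri> _ _ r<v = ∈-++⁺ʳ (opt (sel r) r) (∈-++⁺ʳ (ints sel s) (∈-ints⁺ sel t r<v v<q e))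
... | tri≈ _ refl _ rewrite e = here refl

Unique-ints : ∀ sel {p q} (t : Tree p q) → Unique (ints sel t)
Unique-ints sel leaf = []
Unique-ints sel (node {r = r} s t) =
  Unique.++⁺ (unique-opt (sel r))
    (Unique.++⁺ (Unique-ints sel s) (Unique-ints sel t)
      (λ (m , m′) → <-asym (proj₁ (proj₂ (∈-ints⁻ sel s m))) (proj₁ (∈-ints⁻ sel t m′))))
    r-apart
  where
  unique-opt : ∀ b → Unique (opt b r)
  unique-opt true  = [] ∷ []
  unique-opt false = []
  r-apart : ∀ {v} → ¬ (v ∈ opt (sel r) r × v ∈ ints sel s ++ ints sel t)
  r-apart (m , m′) with ∈-opt⁻ (sel r) m | ∈-++⁻ (ints sel s) m′
  ... | _ , refl | inj₁ k = <-irrefl refl (proj₁ (proj₂ (∈-ints⁻ sel s k)))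
  ... | _ , refl | inj₂ k = <-irrefl refl (proj₁ (∈-ints⁻ sel t k))

Unique-regs : ∀ {p q} (t : Tree p q) → Unique (regs t)
Unique-regs leaf = []
Unique-regs (node {p} {r} {q} s t) =
  All.tabulate root-apart ∷ Unique.++⁺ (Unique-regs s) (Unique-regs t)
    (λ (m , m′) → let _ , x<y , y<z , z≤r = regs-bounds s m
                      r≤x , _ = regs-bounds t m′
                  in <-irrefl refl (<-≤-trans x<y (≤-trans (<⇒≤ y<z) (≤-trans z≤r r≤x))))
  where
  root-apart : ∀ {τ} → τ ∈ regs s ++ regs t → (p , r , q) ≢ τ
  root-apart m refl with ∈-++⁻ (regs s) m
  ... | inj₁ k = <-irrefl refl (<-≤-trans (tree-< t) (proj₂ (proj₂ (proj₂ (regs-bounds s k)))))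
  ... | inj₂ k = <-irrefl refl (<-≤-trans (tree-< s) (proj₁ (regs-bounds t k)))

δ : ℕ → ℕ → ℕ
δ v x = if v ≡ᵇ x then 1 else 0

wt : ℕ → Triple → ℕ
wt v (x , y , z) = δ v x + (δ v y + δ v z)

δ-refl : ∀ v → δ v v ≡ 1
δ-refl v with v ≡ᵇ v in e
... | true  = refl
... | false = ⊥-elim (subst T e (≡⇒≡ᵇ v v refl))

δ-≢ : ∀ {v x} → v ≢ x → δ v x ≡ 0
δ-≢ {v} {x} ne with v ≡ᵇ x in e
... | true  = ⊥-elim (ne (≡ᵇ⇒≡ v x (subst T (sym e) _)))
... | false = refl

wt-0 : ∀ {v x y z} → v ≢ x → v ≢ y → v ≢ z → wt v (x , y , z) ≡ 0
wt-0 a b c = cong₂ _+_ (δ-≢ a) (cong₂ _+_ (δ-≢ b) (δ-≢ c))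

wt-below : ∀ {p q v} (t : Tree p q) → v < p → VanishOn (regs t) (wt v)
wt-below t v<p (x , y , z) m with regs-bounds t m
... | p≤x , x<y , y<z , _ = wt-0 (<⇒≢ v<x) (<⇒≢ (<-trans v<x x<y)) (<⇒≢ (<-trans v<x (<-trans x<y y<z)))
  where v<x = <-≤-trans v<p p≤x

wt-above : ∀ {p q v} (t : Tree p q) → q < v → VanishOn (regs t) (wt v)
wt-above t q<v (x , y , z) m with regs-bounds t m
... | _ , x<y , y<z , z≤q = wt-0 (>⇒≢ (<-trans x<y (<-trans y<z z<v))) (>⇒≢ (<-trans y<z z<v)) (>⇒≢ z<v)
  where z<v = ≤-<-trans z≤q q<v

whenℤ : Bool → ℤ → ℤ
whenℤ true  n = n
whenℤ false n = ℤ.0ℤ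

-- Integer forms of `permShare` and of the right-hand side of `perm-node`, written in the four
-- counts of each half. The apex is the last vertex of the left half and the first vertex of the
-- right half. Integers allow the counts to be replaced by determinants.
shareℤ : Bool → (Bool → Bool → ℤ) → (Bool → Bool → ℤ) → Bool → Bool → ℤ
shareℤ true  L R a b = L a true ℤ.* R false b ℤ.+ L a false ℤ.* R true b
shareℤ false L R a b = L a false ℤ.* R false b

nodeℤ : Bool → (Bool → Bool → ℤ) → (Bool → Bool → ℤ) → Bool → Bool → ℤ
nodeℤ s L R a b =
  shareℤ s L R a b ℤ.+ (whenℤ a (shareℤ s L R false b) ℤ.+ (whenℤ b (shareℤ s L R a false) ℤ.+
    whenℤ s (shareℤ false L R a b)))

-- W sel t a b is the number of matchings into the triangles of t of the
-- selected interior vertices of t, together with its first vertex (if a) and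
-- its last vertex (if b).
W : (ℕ → Bool) → ∀ {p q} → Tree p q → Bool → Bool → ℤ
W sel leaf               true  b     = ℤ.0ℤ
W sel leaf               false true  = ℤ.0ℤ
W sel leaf               false false = ℤ.1ℤ
W sel (node {r = r} s t) a     b     = nodeℤ (sel r) (W sel s) (W sel t) a b

points : (ℕ → Bool) → ∀ {p q} → Tree p q → Bool → Bool → List ℕ
points sel {p} {q} t a b = opt a p ++ opt b q ++ ints sel t

shareℤ-cong : ∀ s {L L′ R R′} → (∀ a b → L a b ≡ L′ a b) → (∀ a b → R a b ≡ R′ a b) →
              ∀ a b → shareℤ s L R a b ≡ shareℤ s L′ R′ a b
shareℤ-cong true  l r a b = cong₂ ℤ._+_ (cong₂ ℤ._*_ (l a true) (r false b)) (cong₂ ℤ._*_ (l a false) (r true b))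
shareℤ-cong false l r a b = cong₂ ℤ._*_ (l a false) (r false b)

nodeℤ-cong : ∀ s {L L′ R R′} → (∀ a b → L a b ≡ L′ a b) → (∀ a b → R a b ≡ R′ a b) →
             ∀ a b → nodeℤ s L R a b ≡ nodeℤ s L′ R′ a b
nodeℤ-cong s l r a b =
  cong₂ ℤ._+_ (shareℤ-cong s l r a b) (cong₂ ℤ._+_ (cong (whenℤ a) (shareℤ-cong s l r false b))
    (cong₂ ℤ._+_ (cong (whenℤ b) (shareℤ-cong s l r a false)) (cong (whenℤ s) (shareℤ-cong false l r a b))))

map-opt : {A B : Set} (f : A → B) (b : Bool) (x : A) → map f (opt b x) ≡ opt b (f x)
map-opt f true  x = refl
map-opt f false x = refl

-- Away from the root triangle only the row of the apex meets both halves: every other vertex of one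
-- half is out of the range of the other, so `perm-node` applies.
perm-points : ∀ sel {p q} (t : Tree p q) a b → + perm (map wt (points sel t a b)) (regs t) ≡ W sel t a b
perm-points sel leaf true  true  = refl
perm-points sel leaf true  false = refl
perm-points sel leaf false true  = refl
perm-points sel leaf false false = refl
perm-points sel (node {p} {r} {q} s t) a b = begin
  + perm (map wt (points sel (node s t) a b)) (τ ∷ regs s ++ regs t)
    ≡⟨ cong (λ fs → + perm fs (τ ∷ regs s ++ regs t)) rows ⟩
  + perm (opt a (wt p) ++ opt b (wt q) ++ opt (sel r) (wt r) ++ iL ++ iR) (τ ∷ regs s ++ regs t)
    ≡⟨ cong +_ (perm-node a b (sel r) (wt p) (wt r) (wt q) iL iR τ (regs s) (regs t)
          (cong₂ _+_ (δ-refl p) (cong₂ _+_ (δ-≢ (<⇒≢ p<r)) (δ-≢ (<⇒≢ p<q))))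
          (cong₂ _+_ (δ-≢ (>⇒≢ p<r)) (cong₂ _+_ (δ-refl r) (δ-≢ (<⇒≢ r<q))))
          (cong₂ _+_ (δ-≢ (>⇒≢ p<q)) (cong₂ _+_ (δ-≢ (>⇒≢ r<q)) (δ-refl q)))
          (All.++⁺ (All.map⁺ (All.tabulate zτL)) (All.map⁺ (All.tabulate zτR)))
          (wt-below t p<r ∷ All.map⁺ (All.tabulate (λ m → wt-below t (proj₁ (proj₂ (∈-ints⁻ sel s m))))))
          (wt-above s r<q ∷ All.map⁺ (All.tabulate (λ m → wt-above s (proj₁ (∈-ints⁻ sel t m)))))) ⟩
  + (Y a b + (when a (Y false b) + (when b (Y a false) + when (sel r) (Y₀ a b))))
    ≡⟨ trans (ℤ.pos-+ (Y a b) _) (cong₂ ℤ._+_ (hom (sel r) a b)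
         (trans (ℤ.pos-+ (when a (Y false b)) _) (cong₂ ℤ._+_ (hom-when a (hom (sel r) false b))
           (trans (ℤ.pos-+ (when b (Y a false)) _) (cong₂ ℤ._+_ (hom-when b (hom (sel r) a false)) (hom-when (sel r) (hom false a b))))))) ⟩
  nodeℤ (sel r) (λ a b → + L a b) (λ a b → + R a b) a b
    ≡⟨ nodeℤ-cong (sel r) ihL ihR a b ⟩
  W sel (node s t) a b ∎
  where
  open ≡-Reasoning
  τ = (p , r , q)
  iL = map wt (ints sel s)
  iR = map wt (ints sel t)
  p<r = tree-< s
  r<q = tree-< t
  p<q = <-trans p<r r<q
  Y = permShare (sel r) (wt p) (wt r) (wt q) iL iR (regs s) (regs t)
  Y₀ = permShare false (wt p) (wt r) (wt q) iL iR (regs s) (regs t)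
  L R : Bool → Bool → ℕ
  L a b = perm (opt a (wt p) ++ opt b (wt r) ++ iL) (regs s)
  R a b = perm (opt a (wt r) ++ opt b (wt q) ++ iR) (regs t)
  map-points : ∀ a b x y zs → map wt (opt a x ++ opt b y ++ zs) ≡ opt a (wt x) ++ opt b (wt y) ++ map wt zs
  map-points a b x y zs = trans (map-++ wt (opt a x) _) (cong₂ _++_ (map-opt wt a x)
    (trans (map-++ wt (opt b y) zs) (cong (_++ map wt zs) (map-opt wt b y))))
  ihL : ∀ a b → + L a b ≡ W sel s a b
  ihL a b = trans (cong (λ fs → + perm fs (regs s)) (sym (map-points a b p r (ints sel s)))) (perm-points sel s a b)
  ihR : ∀ a b → + R a b ≡ W sel t a b
  ihR a b = trans (cong (λ fs → + perm fs (regs t)) (sym (map-points a b r q (ints sel t)))) (perm-points sel t a b)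
  rows : map wt (points sel (node s t) a b) ≡ opt a (wt p) ++ opt b (wt q) ++ opt (sel r) (wt r) ++ iL ++ iR
  rows = trans (map-points a b p q _) (cong (λ zs → opt a (wt p) ++ opt b (wt q) ++ zs)
    (trans (map-++ wt (opt (sel r) r) _) (cong₂ _++_ (map-opt wt (sel r) r) (map-++ wt (ints sel s) (ints sel t)))))
  zτL : ∀ {v} → v ∈ ints sel s → wt v τ ≡ 0
  zτL m = let p<v , v<r , _ = ∈-ints⁻ sel s m in wt-0 (>⇒≢ p<v) (<⇒≢ v<r) (<⇒≢ (<-trans v<r r<q))
  zτR : ∀ {v} → v ∈ ints sel t → wt v τ ≡ 0
  zτR m = let r<v , v<q , _ = ∈-ints⁻ sel t m in wt-0 (>⇒≢ (<-trans p<r r<v)) (>⇒≢ r<v) (<⇒≢ v<q)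
  hom-when : ∀ c {m n} → + m ≡ n → + when c m ≡ whenℤ c n
  hom-when true  e = e
  hom-when false e = refl
  hom : ∀ σ a b → + permShare σ (wt p) (wt r) (wt q) iL iR (regs s) (regs t) a b ≡
                  shareℤ σ (λ a b → + L a b) (λ a b → + R a b) a b
  hom true  a b = trans (ℤ.pos-+ (L a true * R false b) _) (cong₂ ℤ._+_ (ℤ.pos-* (L a true) _) (ℤ.pos-* (L a false) _))
  hom false a b = ℤ.pos-* (L a false) _

-- Matching numbers of a labelled polygon

Vec² : Set
Vec² = ℤ × ℤ

-- The negative of the usual determinant. With this sign the value is positive from left to right in
-- the cover, and pairing with (1 , 0) on the right gives the second coordinate.
det : Vec² → Vec² → ℤ
det (a , b) (c , d) = c ℤ.* b ℤ.- a ℤ.* d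

_⊞_ : Vec² → Vec² → Vec²
(a , b) ⊞ (c , d) = (a ℤ.+ c , b ℤ.+ d)

det-⊞ʳ : ∀ u v → det u (u ⊞ v) ≡ det u v
det-⊞ʳ (a , b) (c , d) = identity a b c d
  where
  identity : ∀ a b c d → (a ℤ.+ c) ℤ.* b ℤ.- a ℤ.* (b ℤ.+ d) ≡ c ℤ.* b ℤ.- a ℤ.* d
  identity = ℤ-Solver.solve-∀

det-⊞ˡ : ∀ u v → det (u ⊞ v) v ≡ det u v
det-⊞ˡ (a , b) (c , d) = identity a b c d
  where
  identity : ∀ a b c d → c ℤ.* (b ℤ.+ d) ℤ.- (a ℤ.+ c) ℤ.* d ≡ c ℤ.* b ℤ.- a ℤ.* d
  identity = ℤ-Solver.solve-∀

det-self : ∀ u → det u u ≡ 0ℤ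
det-self (a , b) = ℤ.+-inverseʳ (a ℤ.* b)

-- Additivity at the apex u ⊞ v, in the form used for a vertex x on the left of the apex;
-- `det-above` is the form for the right.
det-below : ∀ u v x → det u x ℤ.+ det x (u ⊞ v) ≡ det x v
det-below (a , b) (c , d) (e , f) = identity a b c d e f
  where
  identity : ∀ a b c d e f → (e ℤ.* b ℤ.- a ℤ.* f) ℤ.+ ((a ℤ.+ c) ℤ.* f ℤ.- e ℤ.* (b ℤ.+ d)) ≡ c ℤ.* f ℤ.- e ℤ.* d
  identity = ℤ-Solver.solve-∀

det-above : ∀ u v x → det (u ⊞ v) x ℤ.+ det x v ≡ det u x
det-above (a , b) (c , d) (e , f) = identity a b c d e f
  where
  identity : ∀ a b c d e f → (e ℤ.* (b ℤ.+ d) ℤ.- (a ℤ.+ c) ℤ.* f) ℤ.+ (c ℤ.* f ℤ.- e ℤ.* d) ≡ e ℤ.* b ℤ.- a ℤ.* f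
  identity = ℤ-Solver.solve-∀

plücker : ∀ u v w x → det u w ℤ.* det v x ≡ det u v ℤ.* det w x ℤ.+ det u x ℤ.* det v w
plücker (a , b) (c , d) (e , f) (g , h) = identity a b c d e f g h
  where
  identity : ∀ a b c d e f g h →
    (e ℤ.* b ℤ.- a ℤ.* f) ℤ.* (g ℤ.* d ℤ.- c ℤ.* h) ≡
    (c ℤ.* b ℤ.- a ℤ.* d) ℤ.* (g ℤ.* f ℤ.- e ℤ.* h) ℤ.+ (g ℤ.* b ℤ.- a ℤ.* h) ℤ.* (e ℤ.* d ℤ.- c ℤ.* f)
  identity = ℤ-Solver.solve-∀

-- The common value of the two counts in which the vertices x and y lie on
-- different sides of the apex r of the root triangle.
det-across : ∀ u v x y → det u v ≡ 1ℤ → let r = u ⊞ v in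
  det u x ℤ.* det r y ℤ.+ det x r ℤ.* det y v ℤ.+ det x r ℤ.* det r y ≡ det x y
det-across u v x y e = begin
  det u x ℤ.* det r y ℤ.+ det x r ℤ.* det y v ℤ.+ det x r ℤ.* det r y
    ≡⟨ regroup (det u x) (det r y) (det x r) (det y v) ⟩
  det x r ℤ.* det y v ℤ.+ (det u x ℤ.+ det x r) ℤ.* det r y
    ≡⟨ cong (λ n → det x r ℤ.* det y v ℤ.+ n ℤ.* det r y) (det-below u v x) ⟩
  det x r ℤ.* det y v ℤ.+ det x v ℤ.* det r y
    ≡⟨ plücker x r y v ⟨
  det x y ℤ.* det r v
    ≡⟨ cong (det x y ℤ.*_) (trans (det-⊞ˡ u v) e) ⟩
  det x y ℤ.* 1ℤ
    ≡⟨ ℤ.*-identityʳ (det x y) ⟩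
  det x y ∎
  where
  open ≡-Reasoning
  r = u ⊞ v
  regroup : ∀ a b c d → a ℤ.* b ℤ.+ c ℤ.* d ℤ.+ c ℤ.* b ≡ c ℤ.* d ℤ.+ (a ℤ.+ c) ℤ.* b
  regroup = ℤ-Solver.solve-∀

Additive : (ℕ → Vec²) → ∀ {p q} → Tree p q → Set
Additive U t = ∀ {x y z} → (x , y , z) ∈ regs t → U y ≡ U x ⊞ U z

Within : ℕ → ℕ → (ℕ → Set) → Set
Within p q P = ∀ v → p < v → v < q → P v

module _ (sel : ℕ → Bool) where

  On Off : ℕ → ℕ → Set
  On  p q = Within p q (λ v → sel v ≡ true)
  Off p q = Within p q (λ v → sel v ≡ false)

  private
    lower : ∀ {p q r P} → r < q → Within p q P → Within p r P
    lower r<q h v p<v v<r = h v p<v (<-trans v<r r<q)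

    upper : ∀ {p q r P} → p < r → Within p q P → Within r q P
    upper p<r h v r<v = h v (<-trans p<r r<v)

  W-off : ∀ {p q} (t : Tree p q) → Off p q → W sel t false false ≡ 1ℤ
  W-off leaf _ = refl
  W-off (node {r = r} s t) off
    rewrite off r (tree-< s) (tree-< t) | W-off s (lower (tree-< t) off) | W-off t (upper (tree-< s) off) = refl

  record Saturated {p q} (t : Tree p q) : Set where
    constructor saturated
    field
      ff : W sel t false false ≡ 1ℤ
      ft : W sel t false true  ≡ 0ℤ
      tf : W sel t true  false ≡ 0ℤ
      tt : W sel t true  true  ≡ 0ℤ

  -- There are q - p - 1 triangles, as many as interior vertices, so no end can be matched in
  -- addition. The only matching of the interior vertices sends each to the triangle of which it is
  -- the apex: both halves are already full, which forces the apex of the root into the root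
  -- triangle.
  W-on : ∀ {p q} (t : Tree p q) → On p q → Saturated t
  W-on leaf _ = saturated refl refl refl refl
  W-on (node {r = r} s t) on
    with W-on s (lower (tree-< t) on) | W-on t (upper (tree-< s) on)
  ... | saturated a b c d | saturated a′ b′ c′ d′ =
    saturated eff eft etf ett
    where
    eff : W sel (node s t) false false ≡ 1ℤ
    eff rewrite on r (tree-< s) (tree-< t) | a | b | a′ | c′ = refl
    eft : W sel (node s t) false true ≡ 0ℤ
    eft rewrite on r (tree-< s) (tree-< t) | a | b | b′ | c′ | d′ = refl
    etf : W sel (node s t) true false ≡ 0ℤ
    etf rewrite on r (tree-< s) (tree-< t) | a | b | c | d | c′ = refl
    ett : W sel (node s t) true true ≡ 0ℤ
    ett rewrite on r (tree-< s) (tree-< t) | a | b | c | d | d′ = refl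

  module _ (U : ℕ → Vec²) where

    private
      Add-l : ∀ {p r q} (s : Tree p r) (t : Tree r q) → Additive U (node s t) → Additive U s
      Add-l s t A m = A (there (∈-++⁺ˡ m))
      Add-r : ∀ {p r q} (s : Tree p r) (t : Tree r q) → Additive U (node s t) → Additive U t
      Add-r s t A m = A (there (∈-++⁺ʳ (regs s) m))
      Add-0 : ∀ {p r q} (s : Tree p r) (t : Tree r q) → Additive U (node s t) → U r ≡ U p ⊞ U q
      Add-0 s t A = A (here refl)
      unit-l : ∀ {p r q} (s : Tree p r) (t : Tree r q) → Additive U (node s t) → det (U p) (U q) ≡ 1ℤ → det (U p) (U r) ≡ 1ℤ
      unit-l {p} {r} {q} s t A e = trans (cong (det (U p)) (Add-0 s t A)) (trans (det-⊞ʳ (U p) (U q)) e)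
      unit-r : ∀ {p r q} (s : Tree p r) (t : Tree r q) → Additive U (node s t) → det (U p) (U q) ≡ 1ℤ → det (U r) (U q) ≡ 1ℤ
      unit-r {p} {r} {q} s t A e = trans (cong (λ u → det u (U q)) (Add-0 s t A)) (trans (det-⊞ˡ (U p) (U q)) e)

      below : ∀ {p r q} (s : Tree p r) (t : Tree r q) → Additive U (node s t) → ∀ x →
              det (U p) (U x) ℤ.+ det (U x) (U r) ≡ det (U x) (U q)
      below {p} {r} {q} s t A x = trans (cong (λ u → det (U p) (U x) ℤ.+ det (U x) u) (Add-0 s t A)) (det-below (U p) (U q) (U x))
      above : ∀ {p r q} (s : Tree p r) (t : Tree r q) → Additive U (node s t) → ∀ x →
              det (U r) (U x) ℤ.+ det (U x) (U q) ≡ det (U p) (U x)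
      above {p} {r} {q} s t A x = trans (cong (λ u → det u (U x) ℤ.+ det (U x) (U q)) (Add-0 s t A)) (det-above (U p) (U q) (U x))

    -- Both values count the vertices strictly between two others in the cyclic order of the
    -- polygon: x + 1, ..., q - 1 lie between x and q, while x + 1, ..., q lie between x and p when
    -- one goes on past q. If the apex is selected, the right half is full; if not, the left half
    -- has no selected interior vertex.
    W-after : ∀ {p q x} (t : Tree p q) → Additive U t → det (U p) (U q) ≡ 1ℤ → p ≤ x → x < q →
              Off p (suc x) → On x q →
              W sel t false false ≡ det (U x) (U q) × W sel t false true ≡ det (U p) (U x)
    W-after {p} {x = x} leaf A e p≤x x<q off on with ≤-antisym p≤x (≤-pred x<q)
    ... | refl = sym e , sym (det-self (U p))
    W-after {p} {q} {x} (node {r = r} s t) A e p≤x x<q off on with <-≤-connex x r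
    ... | inj₁ x<r
      with W-after s (Add-l s t A) (unit-l s t A e) p≤x x<r off (lower (tree-< t) on) | W-on t (upper x<r on)
    ...   | l , m | saturated a b c d = eff , eft
      where
      ring₁ : ∀ u v → u ℤ.* 1ℤ ℤ.+ v ℤ.* 0ℤ ℤ.+ (0ℤ ℤ.+ (0ℤ ℤ.+ v ℤ.* 1ℤ)) ≡ u ℤ.+ v
      ring₁ = ℤ-Solver.solve-∀
      ring₂ : ∀ u v → u ℤ.* 0ℤ ℤ.+ v ℤ.* 0ℤ ℤ.+ (0ℤ ℤ.+ ((u ℤ.* 1ℤ ℤ.+ v ℤ.* 0ℤ) ℤ.+ v ℤ.* 0ℤ)) ≡ u
      ring₂ = ℤ-Solver.solve-∀
      eff : W sel (node s t) false false ≡ det (U x) (U q)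
      eff rewrite on r x<r (tree-< t) | l | m | a | c = trans (ring₁ (det (U p) (U x)) (det (U x) (U r))) (below s t A x)
      eft : W sel (node s t) false true ≡ det (U p) (U x)
      eft rewrite on r x<r (tree-< t) | l | m | a | b | c | d = ring₂ (det (U p) (U x)) (det (U x) (U r))
    W-after {p} {q} {x} (node {r = r} s t) A e p≤x x<q off on | inj₂ r≤x
      with W-after t (Add-r s t A) (unit-r s t A e) r≤x x<q (upper (tree-< s) off) on
    ...   | l , m rewrite off r (tree-< s) (s≤s r≤x) | W-off s (lower (s≤s r≤x) off) | l | m =
      ring₁ (det (U x) (U q)) , trans (ring₂ (det (U r) (U x)) (det (U x) (U q))) (above s t A x)
      where
      ring₁ : ∀ u → 1ℤ ℤ.* u ℤ.+ (0ℤ ℤ.+ (0ℤ ℤ.+ 0ℤ)) ≡ u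
      ring₁ = ℤ-Solver.solve-∀
      ring₂ : ∀ u v → 1ℤ ℤ.* u ℤ.+ (0ℤ ℤ.+ (1ℤ ℤ.* v ℤ.+ 0ℤ)) ≡ u ℤ.+ v
      ring₂ = ℤ-Solver.solve-∀

    -- Mirror image of `W-after`: the vertices p, ..., y - 1 lie between q and y in the cyclic
    -- order.
    W-before : ∀ {p q y} (t : Tree p q) → Additive U t → det (U p) (U q) ≡ 1ℤ → p < y → y ≤ q →
               On p y → (∀ v → y ≤ v → v < q → sel v ≡ false) →
               W sel t false false ≡ det (U p) (U y) × W sel t true false ≡ det (U y) (U q)
    W-before {p} leaf A e p<y y≤q on off with ≤-antisym y≤q p<y
    ... | refl = sym e , sym (det-self (U (suc p)))
    W-before {p} {q} {y} (node {r = r} s t) A e p<y y≤q on off with <-≤-connex r y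
    ... | inj₁ r<y
      with W-on s (lower r<y on) | W-before t (Add-r s t A) (unit-r s t A e) r<y y≤q (upper (tree-< s) on) off
    ...   | saturated a b c d | l , m = eff , etf
      where
      ring₁ : ∀ u v → 0ℤ ℤ.* u ℤ.+ 1ℤ ℤ.* v ℤ.+ (0ℤ ℤ.+ (0ℤ ℤ.+ 1ℤ ℤ.* u)) ≡ u ℤ.+ v
      ring₁ = ℤ-Solver.solve-∀
      ring₂ : ∀ u v → 0ℤ ℤ.* u ℤ.+ 0ℤ ℤ.* v ℤ.+ ((0ℤ ℤ.* u ℤ.+ 1ℤ ℤ.* v) ℤ.+ (0ℤ ℤ.+ 0ℤ ℤ.* u)) ≡ v
      ring₂ = ℤ-Solver.solve-∀
      eff : W sel (node s t) false false ≡ det (U p) (U y)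
      eff rewrite on r (tree-< s) r<y | a | b | l | m = trans (ring₁ (det (U r) (U y)) (det (U y) (U q))) (above s t A y)
      etf : W sel (node s t) true false ≡ det (U y) (U q)
      etf rewrite on r (tree-< s) r<y | a | b | c | d | m = ring₂ (det (U r) (U y)) (det (U y) (U q))
    W-before {p} {q} {y} (node {r = r} s t) A e p<y y≤q on off | inj₂ y≤r
      with W-before s (Add-l s t A) (unit-l s t A e) p<y y≤r on (λ v y≤v v<r → off v y≤v (<-trans v<r (tree-< t)))
    ...   | l , m rewrite off r y≤r (tree-< t) | W-off t (λ v r<v → off v (≤-trans y≤r (<⇒≤ r<v))) | l | m =
      ring₁ (det (U p) (U y)) , trans (ring₂ (det (U p) (U y)) (det (U y) (U r))) (below s t A y)
      where
      ring₁ : ∀ u → u ℤ.* 1ℤ ℤ.+ (0ℤ ℤ.+ (0ℤ ℤ.+ 0ℤ)) ≡ u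
      ring₁ = ℤ-Solver.solve-∀
      ring₂ : ∀ u v → v ℤ.* 1ℤ ℤ.+ (u ℤ.* 1ℤ ℤ.+ (0ℤ ℤ.+ 0ℤ)) ≡ u ℤ.+ v
      ring₂ = ℤ-Solver.solve-∀

    -- If the apex is not strictly between x and y, one half has nothing to match and the other half
    -- carries the whole count. If it is, `W-after` on the left and `W-before` on the right supply
    -- the terms that `det-across` adds up.
    W-between : ∀ {p q x y} (t : Tree p q) → Additive U t → det (U p) (U q) ≡ 1ℤ → p ≤ x → x < y → y ≤ q →
                Off p (suc x) → On x y → (∀ v → y ≤ v → v < q → sel v ≡ false) →
                W sel t false false ≡ det (U x) (U y)
    W-between leaf A e p≤x x<y y≤q _ _ _
      with ≤-antisym p≤x (≤-pred (≤-trans x<y y≤q)) | ≤-antisym y≤q (≤-trans (s≤s p≤x) x<y)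
    ... | refl | refl = sym e
    W-between {p} {q} {x} {y} (node {r = r} s t) A e p≤x x<y y≤q off on off′ with <-≤-connex x r
    ... | inj₂ r≤x rewrite off r (tree-< s) (s≤s r≤x) | W-off s (lower (s≤s r≤x) off)
                         | W-between t (Add-r s t A) (unit-r s t A e) r≤x x<y y≤q (upper (tree-< s) off) on off′ =
      ring₁ (det (U x) (U y))
      where
      ring₁ : ∀ u → 1ℤ ℤ.* u ℤ.+ (0ℤ ℤ.+ (0ℤ ℤ.+ 0ℤ)) ≡ u
      ring₁ = ℤ-Solver.solve-∀
    ... | inj₁ x<r with <-≤-connex r y
    ...   | inj₂ y≤r rewrite off′ r y≤r (tree-< t) | W-off t (λ v r<v → off′ v (≤-trans y≤r (<⇒≤ r<v)))
                           | W-between s (Add-l s t A) (unit-l s t A e) p≤x x<y y≤r off on (λ v y≤v v<r → off′ v y≤v (<-trans v<r (tree-< t))) =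
      ring₁ (det (U x) (U y))
      where
      ring₁ : ∀ u → u ℤ.* 1ℤ ℤ.+ (0ℤ ℤ.+ (0ℤ ℤ.+ 0ℤ)) ≡ u
      ring₁ = ℤ-Solver.solve-∀
    ...   | inj₁ r<y
      with W-after s (Add-l s t A) (unit-l s t A e) p≤x x<r off (lower r<y on)
         | W-before t (Add-r s t A) (unit-r s t A e) r<y y≤q (upper x<r on) off′
    ...     | l , m | l′ , m′ rewrite on r x<r r<y | l | m | l′ | m′ | Add-0 s t A =
      trans (ring₁ (det (U p) (U x)) (det (U x) (U p ⊞ U q)) (det (U p ⊞ U q) (U y)) (det (U y) (U q)))
            (det-across (U p) (U q) (U x) (U y) e)
      where
      ring₁ : ∀ u v u′ v′ → u ℤ.* u′ ℤ.+ v ℤ.* v′ ℤ.+ (0ℤ ℤ.+ (0ℤ ℤ.+ v ℤ.* u′)) ≡ u ℤ.* u′ ℤ.+ v ℤ.* v′ ℤ.+ v ℤ.* u′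
      ring₁ = ℤ-Solver.solve-∀

    record Missing {p q} (t : Tree p q) (x : ℕ) : Set where
      constructor missing
      field
        ft : W sel t false true  ≡ det (U p) (U x)
        tf : W sel t true  false ≡ det (U x) (U q)
        tt : W sel t true  true  ≡ 0ℤ

    -- With one end required, exactly two vertices are left out, x and the other end; with both ends
    -- required there is one vertex too many for the triangles. A half that does not have x inside
    -- is saturated. The remaining count `W sel t false false`, with three vertices left out, enters
    -- the recursion only next to a factor 0.
    W-missing : ∀ {p q x} (t : Tree p q) → Additive U t → det (U p) (U q) ≡ 1ℤ → p < x → x < q →
                On p x → sel x ≡ false → On x q → Missing t x
    W-missing leaf A e p<x x<q _ _ _ = ⊥-elim (<-irrefl refl (<-≤-trans p<x (≤-pred x<q)))
    W-missing {p} {q} {x} (node {r = r} s t) A e p<x x<q on x∉ on′ with <-cmp x r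
    ... | tri< x<r _ _
      with W-missing s (Add-l s t A) (unit-l s t A e) p<x x<r on x∉ (lower (tree-< t) on′) | W-on t (upper x<r on′)
    ...   | missing k l m | saturated a b c d = missing eft etf ett
      where
      ring₁ : ∀ u v → v ℤ.* 0ℤ ℤ.+ u ℤ.* 0ℤ ℤ.+ (0ℤ ℤ.+ ((v ℤ.* 1ℤ ℤ.+ u ℤ.* 0ℤ) ℤ.+ u ℤ.* 0ℤ)) ≡ v
      ring₁ = ℤ-Solver.solve-∀
      ring₂ : ∀ u v w → 0ℤ ℤ.* 1ℤ ℤ.+ w ℤ.* 0ℤ ℤ.+ ((v ℤ.* 1ℤ ℤ.+ u ℤ.* 0ℤ) ℤ.+ (0ℤ ℤ.+ w ℤ.* 1ℤ)) ≡ v ℤ.+ w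
      ring₂ = ℤ-Solver.solve-∀
      ring₃ : ∀ u v w → 0ℤ ℤ.* 0ℤ ℤ.+ w ℤ.* 0ℤ ℤ.+ ((v ℤ.* 0ℤ ℤ.+ u ℤ.* 0ℤ) ℤ.+ ((0ℤ ℤ.* 1ℤ ℤ.+ w ℤ.* 0ℤ) ℤ.+ w ℤ.* 0ℤ)) ≡ 0ℤ
      ring₃ = ℤ-Solver.solve-∀
      eft : W sel (node s t) false true ≡ det (U p) (U x)
      eft rewrite on′ r x<r (tree-< t) | k | a | b | c | d = ring₁ (W sel s false false) (det (U p) (U x))
      etf : W sel (node s t) true false ≡ det (U x) (U q)
      etf rewrite on′ r x<r (tree-< t) | k | l | m | a | c = trans (ring₂ (W sel s false false) (det (U p) (U x)) (det (U x) (U r))) (below s t A x)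
      ett : W sel (node s t) true true ≡ 0ℤ
      ett rewrite on′ r x<r (tree-< t) | k | l | m | b | c | d = ring₃ (W sel s false false) (det (U p) (U x)) (det (U x) (U r))
    W-missing {p} {q} {x} (node {r = r} s t) A e p<x x<q on x∉ on′ | tri≈ _ refl _
      with W-on s on | W-on t on′
    ...   | saturated a b c d | saturated a′ b′ c′ d′ = missing eft etf ett
      where
      eft : W sel (node s t) false true ≡ det (U p) (U r)
      eft rewrite x∉ | a | a′ | b′ = sym (unit-l s t A e)
      etf : W sel (node s t) true false ≡ det (U r) (U q)
      etf rewrite x∉ | a | c | a′ = sym (unit-r s t A e)
      ett : W sel (node s t) true true ≡ 0ℤ
      ett rewrite x∉ | a | c | b′ = refl
    W-missing {p} {q} {x} (node {r = r} s t) A e p<x x<q on x∉ on′ | tri> _ _ r<x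
      with W-on s (lower r<x on) | W-missing t (Add-r s t A) (unit-r s t A e) r<x x<q (upper (tree-< s) on) x∉ on′
    ...   | saturated a b c d | missing k l m = missing eft etf ett
      where
      ring₁ : ∀ u v w → 0ℤ ℤ.* v ℤ.+ 1ℤ ℤ.* 0ℤ ℤ.+ (0ℤ ℤ.+ ((0ℤ ℤ.* u ℤ.+ 1ℤ ℤ.* w) ℤ.+ 1ℤ ℤ.* v)) ≡ v ℤ.+ w
      ring₁ = ℤ-Solver.solve-∀
      ring₂ : ∀ u w → 0ℤ ℤ.* u ℤ.+ 0ℤ ℤ.* w ℤ.+ ((0ℤ ℤ.* u ℤ.+ 1ℤ ℤ.* w) ℤ.+ (0ℤ ℤ.+ 0ℤ ℤ.* u)) ≡ w
      ring₂ = ℤ-Solver.solve-∀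
      ring₃ : ∀ u v w → 0ℤ ℤ.* v ℤ.+ 0ℤ ℤ.* 0ℤ ℤ.+ ((0ℤ ℤ.* v ℤ.+ 1ℤ ℤ.* 0ℤ) ℤ.+ ((0ℤ ℤ.* u ℤ.+ 0ℤ ℤ.* w) ℤ.+ 0ℤ ℤ.* v)) ≡ 0ℤ
      ring₃ = ℤ-Solver.solve-∀
      eft : W sel (node s t) false true ≡ det (U p) (U x)
      eft rewrite on r (tree-< s) r<x | a | b | k | l | m = trans (ring₁ (W sel t false false) (det (U r) (U x)) (det (U x) (U q))) (above s t A x)
      etf : W sel (node s t) true false ≡ det (U x) (U q)
      etf rewrite on r (tree-< s) r<x | a | b | c | d | l = ring₂ (W sel t false false) (det (U x) (U q))
      ett : W sel (node s t) true true ≡ 0ℤ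
      ett rewrite on r (tree-< s) r<x | a | b | c | d | m = ring₃ (W sel t false false) (det (U r) (U x)) (det (U x) (U q))

    -- The dual of `W-between`, with the same case split: when both exceptional vertices lie on one
    -- side of the apex, or one of them is the apex, saturation of a half leaves a single term; when
    -- they lie on opposite sides, two uses of `W-missing` feed `det-across`.
    W-missing₂ : ∀ {p q x y} (t : Tree p q) → Additive U t → det (U p) (U q) ≡ 1ℤ → p < x → x < y → y < q →
                 On p x → sel x ≡ false → On x y → sel y ≡ false → On y q →
                 W sel t true true ≡ det (U x) (U y)
    W-missing₂ leaf A e p<x x<y y<q _ _ _ _ _ = ⊥-elim (<-irrefl refl (<-≤-trans (<-trans p<x x<y) (≤-pred y<q)))
    W-missing₂ {p} {q} {x} {y} (node {r = r} s t) A e p<x x<y y<q on x∉ on′ y∉ on″ with <-cmp x r | <-cmp y r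
    ... | tri< x<r _ _ | tri< y<r _ _
      with W-missing₂ s (Add-l s t A) (unit-l s t A e) p<x x<y y<r on x∉ on′ y∉ (lower (tree-< t) on″) | W-on t (upper y<r on″)
    ...   | k | saturated a b c d
      rewrite on″ r y<r (tree-< t) | k | a | b | c | d = ring (W sel s false false) (W sel s false true) (W sel s true false) (det (U x) (U y))
      where
      ring : ∀ u v w z → z ℤ.* 0ℤ ℤ.+ w ℤ.* 0ℤ ℤ.+ ((v ℤ.* 0ℤ ℤ.+ u ℤ.* 0ℤ) ℤ.+ ((z ℤ.* 1ℤ ℤ.+ w ℤ.* 0ℤ) ℤ.+ w ℤ.* 0ℤ)) ≡ z
      ring = ℤ-Solver.solve-∀
    W-missing₂ {p} {q} {x} {y} (node {r = r} s t) A e p<x x<y y<q on x∉ on′ y∉ on″ | tri< x<r _ _ | tri≈ _ refl _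
      with W-missing s (Add-l s t A) (unit-l s t A e) p<x x<r on x∉ on′ | W-on t on″
    ...   | missing k l m | saturated a b c d
      rewrite y∉ | l | a | b = ring (W sel s false false) (det (U x) (U r))
      where
      ring : ∀ u w → w ℤ.* 0ℤ ℤ.+ (u ℤ.* 0ℤ ℤ.+ (w ℤ.* 1ℤ ℤ.+ 0ℤ)) ≡ w
      ring = ℤ-Solver.solve-∀
    W-missing₂ {p} {q} {x} {y} (node {r = r} s t) A e p<x x<y y<q on x∉ on′ y∉ on″ | tri< x<r _ _ | tri> _ _ r<y
      with W-missing s (Add-l s t A) (unit-l s t A e) p<x x<r on x∉ (lower r<y on′)
         | W-missing t (Add-r s t A) (unit-r s t A e) r<y y<q (upper x<r on′) y∉ on″
    ...   | missing k l m | missing k′ l′ m′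
      rewrite on′ r x<r r<y | k | l | m | k′ | l′ | m′ | Add-0 s t A =
      trans (ring (W sel s false false) (W sel t false false) (det (U p) (U x)) (det (U x) (U p ⊞ U q)) (det (U p ⊞ U q) (U y)) (det (U y) (U q)))
            (det-across (U p) (U q) (U x) (U y) e)
      where
      ring : ∀ z z′ v w v′ w′ → 0ℤ ℤ.* v′ ℤ.+ w ℤ.* 0ℤ ℤ.+ ((v ℤ.* v′ ℤ.+ z ℤ.* 0ℤ) ℤ.+ ((0ℤ ℤ.* z′ ℤ.+ w ℤ.* w′) ℤ.+ w ℤ.* v′)) ≡ v ℤ.* v′ ℤ.+ w ℤ.* w′ ℤ.+ w ℤ.* v′
      ring = ℤ-Solver.solve-∀
    W-missing₂ {p} {q} {x} {y} (node {r = r} s t) A e p<x x<y y<q on x∉ on′ y∉ on″ | tri≈ _ refl _ | tri> _ _ r<y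
      with W-on s on | W-missing t (Add-r s t A) (unit-r s t A e) r<y y<q on′ y∉ on″
    ...   | saturated a b c d | missing k l m
      rewrite x∉ | a | c | k = ring (W sel t false false) (det (U r) (U y))
      where
      ring : ∀ u v → 0ℤ ℤ.* v ℤ.+ (1ℤ ℤ.* v ℤ.+ (0ℤ ℤ.* u ℤ.+ 0ℤ)) ≡ v
      ring = ℤ-Solver.solve-∀
    W-missing₂ {p} {q} {x} {y} (node {r = r} s t) A e p<x x<y y<q on x∉ on′ y∉ on″ | tri> _ _ r<x | tri> _ _ r<y
      with W-on s (lower r<x on) | W-missing₂ t (Add-r s t A) (unit-r s t A e) r<x x<y y<q (upper (tree-< s) on) x∉ on′ y∉ on″
    ...   | saturated a b c d | k
      rewrite on r (tree-< s) r<x | a | b | c | d | k = ring (W sel t false false) (W sel t false true) (W sel t true false) (det (U x) (U y))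
      where
      ring : ∀ u v w z → 0ℤ ℤ.* v ℤ.+ 0ℤ ℤ.* z ℤ.+ ((0ℤ ℤ.* v ℤ.+ 1ℤ ℤ.* z) ℤ.+ ((0ℤ ℤ.* u ℤ.+ 0ℤ ℤ.* w) ℤ.+ 0ℤ ℤ.* v)) ≡ z
      ring = ℤ-Solver.solve-∀
    W-missing₂ (node s t) A e p<x x<y y<q on x∉ on′ y∉ on″ | tri≈ _ refl _ | tri< y<r _ _ = ⊥-elim (<-asym x<y y<r)
    W-missing₂ (node s t) A e p<x x<y y<q on x∉ on′ y∉ on″ | tri≈ _ refl _ | tri≈ _ refl _ = ⊥-elim (<-irrefl refl x<y)
    W-missing₂ (node s t) A e p<x x<y y<q on x∉ on′ y∉ on″ | tri> _ _ r<x | tri< y<r _ _ = ⊥-elim (<-asym (<-trans r<x x<y) y<r)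
    W-missing₂ (node s t) A e p<x x<y y<q on x∉ on′ y∉ on″ | tri> _ _ r<x | tri≈ _ refl _ = ⊥-elim (<-asym r<x x<y)

-- Noncrossing edges

least : {P : ℕ → Set} → (∀ n → Dec (P n)) → ∀ {a} b → a ≤ b → P b →
        ∃ λ r → a ≤ r × r ≤ b × P r × (∀ v → a ≤ v → v < r → ¬ P v)
least P? {zero} zero a≤b pb = zero , z≤n , z≤n , pb , λ v _ ()
least {P} P? {a} (suc b) a≤b pb with m≤n⇒m<n∨m≡n a≤b
... | inj₂ refl = suc b , ≤-refl , ≤-refl , pb , λ v a≤v v<a → ⊥-elim (<-irrefl refl (≤-trans v<a a≤v))
... | inj₁ a<sb with P? a
...   | yes pa = a , ≤-refl , a≤b , pa , λ v a≤v v<a → ⊥-elim (<-irrefl refl (≤-trans v<a a≤v))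
...   | no ¬pa with least {λ n → P (suc n)} (λ n → P? (suc n)) b (≤-pred a<sb) pb
...     | r , a≤r , r≤b , pr , min = suc r , ≤-trans a≤r (n≤1+n r) , s≤s r≤b , pr , below
  where
  below : ∀ v → a ≤ v → v < suc r → ¬ P v
  below zero    z≤n v<r = ¬pa
  below (suc v) a≤v v<r with m≤n⇒m<n∨m≡n a≤v
  ... | inj₁ a<v = min v (≤-pred a<v) (≤-pred v<r)
  ... | inj₂ refl = ¬pa

greatest : {P : ℕ → Set} → (∀ n → Dec (P n)) → ∀ {a} b → a < b → P a →
           ∃ λ r → a ≤ r × r < b × P r × (∀ v → r < v → v < b → ¬ P v)
greatest P? {a} (suc b) a<b pa with P? b
... | yes pb = b , ≤-pred a<b , ≤-refl , pb , λ v b<v v<sb → ⊥-elim (<-irrefl refl (<-≤-trans b<v (≤-pred v<sb)))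
... | no ¬pb with m≤n⇒m<n∨m≡n (≤-pred a<b)
...   | inj₂ refl = ⊥-elim (¬pb pa)
...   | inj₁ a<b′ with greatest P? b a<b′ pa
...     | r , a≤r , r<b , pr , max = r , a≤r , <-trans r<b ≤-refl , pr , above
  where
  above : ∀ v → r < v → v < suc b → ¬ _
  above v r<v v<sb with m≤n⇒m<n∨m≡n (≤-pred v<sb)
  ... | inj₁ v<b  = max v r<v v<b
  ... | inj₂ refl = ¬pb

-- What is needed of the edges of a triangulated polygon. `apex` is the form that maximality takes
-- here: behind every side that is not a boundary side there is a triangle.
module Noncrossing
  (G : ℕ → ℕ → Set)
  (noncrossing : ∀ {x x′ y y′} → x < x′ → x′ < y → y < y′ → G x y → G x′ y′ → ⊥)
  (apex : ∀ {p q} → suc p < q → G p q → ∃ λ r → p < r × r < q × G p r × G r q)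
  where

  Triangle : Triple → Set
  Triangle (x , y , z) = G x y × G y z × G x z

  Fine : ∀ {p q} → Tree p q → Set
  Fine t = ∀ {τ} → τ ∈ regs t → Triangle τ

  triangulate : ∀ n {p q} → p < q → q ≤ p + n → G p q → Σ (Tree p q) Fine
  triangulate zero    {p} p<q q≤ g = ⊥-elim (<-irrefl refl (<-≤-trans p<q (≤-trans q≤ (≤-reflexive (+-identityʳ p)))))
  triangulate (suc n) {p} {q} p<q q≤ g with m≤n⇒m<n∨m≡n p<q
  ... | inj₂ refl = leaf , λ ()
  ... | inj₁ 1+p<q with apex 1+p<q g
  ...   | r , p<r , r<q , gl , gr
      with triangulate n p<r (≤-pred (<-≤-trans r<q (≤-trans q≤ (≤-reflexive (+-suc p n))))) gl
         | triangulate n r<q (≤-trans q≤ (≤-trans (≤-reflexive (+-suc p n)) (+-monoˡ-≤ n p<r))) gr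
  ...     | s , hs | t , ht = node s t , triangles
      where
      triangles : Fine (node s t)
      triangles (here refl) = gl , gr , g
      triangles (there m) with ∈-++⁻ (regs s) m
      ... | inj₁ m′ = hs m′
      ... | inj₂ m′ = ht m′

  fine-l : ∀ {p r q} (s : Tree p r) (t : Tree r q) → Fine (node s t) → Fine s
  fine-l s t h m = h (there (∈-++⁺ˡ m))

  fine-r : ∀ {p r q} (s : Tree p r) (t : Tree r q) → Fine (node s t) → Fine t
  fine-r s t h m = h (there (∈-++⁺ʳ (regs s) m))

  over-apex : ∀ {p r q x y} → G p r → G r q → p ≤ x → x < r → r < y → y ≤ q → G x y → x ≡ p × y ≡ q
  over-apex gl gr p≤x x<r r<y y≤q g with m≤n⇒m<n∨m≡n p≤x | m≤n⇒m<n∨m≡n y≤q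
  ... | inj₁ p<x | _         = ⊥-elim (noncrossing p<x x<r r<y gl g)
  ... | inj₂ refl | inj₁ y<q = ⊥-elim (noncrossing x<r r<y y<q g gr)
  ... | inj₂ refl | inj₂ refl = refl , refl

  -- By `over-apex`, a triangle reaching across the apex of the root has the root side as its
  -- longest side. Its middle vertex is then the apex, since otherwise one of its short sides would
  -- cross a side of the root triangle.
  complete : ∀ {p q x y z} (t : Tree p q) → Fine t → p ≤ x → x < y → y < z → z ≤ q →
             Triangle (x , y , z) → (x , y , z) ∈ regs t
  complete leaf h p≤x x<y y<z z≤q _ = ⊥-elim (<-irrefl refl (≤-trans (s≤s p≤x) (≤-trans x<y (≤-pred (≤-trans y<z z≤q)))))
  complete {x = x} {y} {z} (node {p} {r} {q} s t) h p≤x x<y y<z z≤q (gxy , gyz , gxz) with <-≤-connex r z | <-≤-connex x r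
  ... | inj₂ z≤r | _ = there (∈-++⁺ˡ (complete s (fine-l s t h) p≤x x<y y<z z≤r (gxy , gyz , gxz)))
  ... | inj₁ r<z | inj₂ r≤x = there (∈-++⁺ʳ (regs s) (complete t (fine-r s t h) r≤x x<y y<z z≤q (gxy , gyz , gxz)))
  ... | inj₁ r<z | inj₁ x<r with h (here refl)
  ...   | gl , gr , _ with over-apex gl gr p≤x x<r r<z z≤q gxz
  ...     | refl , refl with <-cmp y r
  ...       | tri< y<r _ _  = ⊥-elim (noncrossing x<y y<r r<z gl gyz)
  ...       | tri≈ _ refl _ = here refl
  ...       | tri> _ _ r<y  = ⊥-elim (noncrossing x<r r<y y<z gxy gr)

  -- An edge inside the polygon is the root side of some subtree, and determinant 1 passes from a
  -- root side (u , v) to the sides (u , u ⊞ v) and (u ⊞ v , v) at its apex.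
  edge-unimodular : (U : ℕ → Vec²) → ∀ {p q x y} (t : Tree p q) → Fine t →
         Additive U t → det (U p) (U q) ≡ 1ℤ →
         p ≤ x → x < y → y ≤ q → G x y → det (U x) (U y) ≡ 1ℤ
  edge-unimodular U leaf h A e p≤x x<y y≤q g
    with ≤-antisym p≤x (≤-pred (≤-trans x<y y≤q)) | ≤-antisym y≤q (≤-trans (s≤s p≤x) x<y)
  ... | refl | refl = e
  edge-unimodular U {x = x} {y} (node {p} {r} {q} s t) h A e p≤x x<y y≤q g with <-≤-connex r y | <-≤-connex x r
  ... | inj₂ y≤r | _ = edge-unimodular U s (fine-l s t h) (λ m → A (there (∈-++⁺ˡ m)))
          (trans (cong (det (U p)) (A (here refl))) (trans (det-⊞ʳ (U p) (U q)) e)) p≤x x<y y≤r g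
  ... | inj₁ _ | inj₂ r≤x = edge-unimodular U t (fine-r s t h) (λ m → A (there (∈-++⁺ʳ (regs s) m)))
          (trans (cong (λ u → det u (U q)) (A (here refl))) (trans (det-⊞ˡ (U p) (U q)) e)) r≤x x<y y≤q g
  ... | inj₁ r<y | inj₁ x<r with h (here refl)
  ...   | gl , gr , _ with over-apex gl gr p≤x x<r r<y y≤q g
  ...     | refl , refl = e

-- Residues

module Residues (N : ℕ) .{{_ : NonZero N}} where

  infix 4 _≋_
  _≋_ : ℕ → ℕ → Set
  x ≋ y = x % N ≡ y % N

  0<N : 0 < N
  0<N = >-nonZero⁻¹ N

  ≋-+N : ∀ x → x + N ≋ x
  ≋-+N x = [m+n]%n≡m%n x N

  ≋-+kN : ∀ x k → x + k * N ≋ x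
  ≋-+kN x k = [m+kn]%n≡m%n x k N

  ≋-% : ∀ x → x % N ≋ x
  ≋-% x = m%n%n≡m%n x N

  ≋-+ʳ : ∀ {x y} k → x ≋ y → x + k ≋ y + k
  ≋-+ʳ {x} {y} k e = trans (%-distribˡ-+ x k N)
    (trans (cong (λ m → (m + k % N) % N) e) (sym (%-distribˡ-+ y k N)))

  ≋-cancelʳ : ∀ {x y} k → x + k ≋ y + k → x ≋ y
  ≋-cancelʳ {x} {y} k e = trans (sym (back x)) (trans (≋-+ʳ {x + k % N} {y + k % N} (N ∸ k % N) e′) (back y))
    where
    reduce : ∀ x → x + k % N ≋ x + k
    reduce x = trans (cong (_% N) (+-comm x _)) (trans (≋-+ʳ x (≋-% k)) (cong (_% N) (+-comm k x)))
    e′ : x + k % N ≋ y + k % N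
    e′ = trans (reduce x) (trans e (sym (reduce y)))
    back : ∀ x → (x + k % N) + (N ∸ k % N) ≋ x
    back x = trans (cong (_% N) (trans (+-assoc x _ _) (cong (λ m → x + m) (m+[n∸m]≡n (m%n≤n k N))))) (≋-+N x)

  ≋-unique : ∀ {x y} → x ≋ y → x ≤ y → y < x + N → x ≡ y
  ≋-unique {x} {y} e x≤y y<x+N = sym (trans (sym (m∸n+n≡m x≤y)) (cong (_+ x) d≡0))
    where
    d<N : y ∸ x < N
    d<N = +-cancelʳ-< x (y ∸ x) N (subst₂ _<_ (sym (m∸n+n≡m x≤y)) (+-comm x N) y<x+N)
    d≡0 : y ∸ x ≡ 0
    d≡0 = trans (sym (m<n⇒m%n≡m d<N))
      (trans (≋-cancelʳ {y ∸ x} {0} x (trans (cong (_% N) (m∸n+n≡m x≤y)) (sym e))) (m<n⇒m%n≡m 0<N))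

  toℕ⌊⌋ : ∀ x → toℕ (⌊_⌋ N x) ≡ x % N
  toℕ⌊⌋ x = toℕ-fromℕ< (m%n<n x N)

  ⌊⌋-cong : ∀ {x y} → x ≋ y → ⌊_⌋ N x ≡ ⌊_⌋ N y
  ⌊⌋-cong {x} {y} e = toℕ-injective (trans (toℕ⌊⌋ x) (trans e (sym (toℕ⌊⌋ y))))

  ⌊⌋-inj : ∀ {x y} → ⌊_⌋ N x ≡ ⌊_⌋ N y → x ≋ y
  ⌊⌋-inj {x} {y} e = trans (sym (toℕ⌊⌋ x)) (trans (cong toℕ e) (toℕ⌊⌋ y))

  ⌊toℕ⌋ : ∀ i → ⌊_⌋ N (toℕ i) ≡ i
  ⌊toℕ⌋ i = toℕ-injective (trans (toℕ⌊⌋ (toℕ i)) (m<n⇒m%n≡m (toℕ<n i)))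

  ⌊⌋-⊕ : ∀ x k → _⊕_ N (⌊_⌋ N x) k ≡ ⌊_⌋ N (x + k)
  ⌊⌋-⊕ x k = ⌊⌋-cong (≋-+ʳ k (trans (cong (_% N) (toℕ⌊⌋ x)) (≋-% x)))

  dist-spec : ∀ i j → toℕ i + dist N i j ≋ toℕ j
  dist-spec i j = trans (cong (_% N) (+-comm (toℕ i) _))
    (trans (≋-+ʳ (toℕ i) (≋-% (toℕ j + N ∸ toℕ i)))
      (trans (cong (_% N) (m∸n+n≡m (≤-trans (<⇒≤ (toℕ<n i)) (m≤n+m N (toℕ j))))) (≋-+N (toℕ j))))

  dist<N : ∀ i j → dist N i j < N
  dist<N i j = m%n<n _ N

  len-spec : ∀ i j → toℕ i + len N i j ≋ toℕ j
  len-spec i j with dist N i j ≡ᵇ 0 in e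
  ... | false = dist-spec i j
  ... | true  = trans (≋-+N (toℕ i)) (trans (cong (_% N) (sym (trans (cong (λ s → toℕ i + s) d≡0) (+-identityʳ _)))) (dist-spec i j))
    where
    d≡0 : dist N i j ≡ 0
    d≡0 = ≡ᵇ⇒≡ _ 0 (subst T (sym e) _)

  0<len : ∀ i j → 0 < len N i j
  0<len i j with dist N i j in e
  ... | zero  = 0<N
  ... | suc _ = s≤s z≤n

  len≤N : ∀ i j → len N i j ≤ N
  len≤N i j with dist N i j ≡ᵇ 0
  ... | true  = ≤-refl
  ... | false = <⇒≤ (dist<N i j)

  ⌊⌋-toℕ : ∀ x → toℕ (⌊_⌋ N x) ≋ x
  ⌊⌋-toℕ x = trans (cong (_% N) (toℕ⌊⌋ x)) (≋-% x)

  ⌊+⌋ : ∀ x j {d} → toℕ (⌊_⌋ N x) + d ≋ toℕ j → ⌊_⌋ N (x + d) ≡ j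
  ⌊+⌋ x j {d} e = trans (⌊⌋-cong (trans (sym (≋-+ʳ d (⌊⌋-toℕ x))) e)) (⌊toℕ⌋ j)

  dist-lift : ∀ x d → d < N → dist N (⌊_⌋ N x) (⌊_⌋ N (x + d)) ≡ d
  dist-lift x d d<N = trans (sym (m<n⇒m%n≡m (dist<N i j))) (trans (≋-cancelʳ (toℕ i) eq) (m<n⇒m%n≡m d<N))
    where
    i = ⌊_⌋ N x
    j = ⌊_⌋ N (x + d)
    eq : dist N i j + toℕ i ≋ d + toℕ i
    eq = trans (cong (_% N) (+-comm (dist N i j) _)) (trans (dist-spec i j) (trans (⌊⌋-toℕ (x + d))
           (trans (sym (≋-+ʳ d (⌊⌋-toℕ x))) (cong (_% N) (+-comm (toℕ i) d)))))

  len-lift : ∀ x d → 0 < d → d ≤ N → len N (⌊_⌋ N x) (⌊_⌋ N (x + d)) ≡ d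
  len-lift x d 0<d d≤N with m≤n⇒m<n∨m≡n d≤N
  ... | inj₁ d<N rewrite dist-lift x d d<N with d
  ...   | suc _ = refl
  len-lift x d 0<d d≤N | inj₂ refl
    rewrite trans (cong (dist N (⌊_⌋ N x)) (⌊⌋-cong {x + N} {x + 0} (trans (≋-+N x) (cong (_% N) (sym (+-identityʳ x)))))) (dist-lift x 0 0<N) = refl

-- Labelling a polygon by vectors

-- Farey mediants: the apex receives the sum of the two ends. The apex itself is sent to the left
-- half; `label-right` confirms that the right half gives it the same vector.
label : ∀ {p q} → Tree p q → Vec² → Vec² → ℕ → Vec²
label (leaf {p}) u v x with x ≤? p
... | yes _ = u
... | no  _ = v
label (node {r = r} s t) u v x with x ≤? r
... | yes _ = label s u (u ⊞ v) x
... | no  _ = label t (u ⊞ v) v x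

label-first : ∀ {p q} (t : Tree p q) u v {x} → x ≤ p → label t u v x ≡ u
label-first (leaf {p}) u v {x} x≤p with x ≤? p
... | yes _   = refl
... | no  x≰p = ⊥-elim (x≰p x≤p)
label-first (node {r = r} s t) u v {x} x≤p with x ≤? r
... | yes _   = label-first s u (u ⊞ v) x≤p
... | no  x≰r = ⊥-elim (x≰r (≤-trans x≤p (<⇒≤ (tree-< s))))

label-last : ∀ {p q} (t : Tree p q) u v {x} → q ≤ x → label t u v x ≡ v
label-last (leaf {p}) u v {x} q≤x with x ≤? p
... | yes x≤p = ⊥-elim (<-irrefl refl (≤-trans q≤x x≤p))
... | no  _   = refl
label-last (node {r = r} s t) u v {x} q≤x with x ≤? r
... | yes x≤r = ⊥-elim (<-irrefl refl (<-≤-trans (tree-< t) (≤-trans q≤x x≤r)))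
... | no  _   = label-last t (u ⊞ v) v q≤x

label-left : ∀ {p r q} (s : Tree p r) (t : Tree r q) u v {x} → x ≤ r → label (node s t) u v x ≡ label s u (u ⊞ v) x
label-left {r = r} s t u v {x} x≤r with x ≤? r
... | yes _   = refl
... | no  x≰r = ⊥-elim (x≰r x≤r)

label-right : ∀ {p r q} (s : Tree p r) (t : Tree r q) u v {x} → r ≤ x → label (node s t) u v x ≡ label t (u ⊞ v) v x
label-right {r = r} s t u v {x} r≤x with x ≤? r
... | no  _   = refl
... | yes x≤r = trans (label-last s u (u ⊞ v) r≤x) (sym (label-first t (u ⊞ v) v x≤r))

label-additive : ∀ {p q} (t : Tree p q) u v → Additive (label t u v) t
label-additive (node {p} {r} {q} s t) u v (here refl) =
  trans (trans (label-left s t u v ≤-refl) (label-last s u (u ⊞ v) ≤-refl))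
        (sym (cong₂ _⊞_ (label-first (node s t) u v ≤-refl) (label-last (node s t) u v ≤-refl)))
label-additive (node {p} {r} {q} s t) u v {x} {y} {z} (there m) with ∈-++⁻ (regs s) m
... | inj₁ m′ = let _ , x<y , y<z , z≤r = regs-bounds s m′
                    y≤r = ≤-trans (<⇒≤ y<z) z≤r
                    x≤r = ≤-trans (<⇒≤ x<y) y≤r
                in trans (label-left s t u v y≤r) (trans (label-additive s u (u ⊞ v) m′)
                     (sym (cong₂ _⊞_ (label-left s t u v x≤r) (label-left s t u v z≤r))))
... | inj₂ m′ = let r≤x , x<y , y<z , _ = regs-bounds t m′
                    r≤y = ≤-trans r≤x (<⇒≤ x<y)
                    r≤z = ≤-trans r≤y (<⇒≤ y<z)
                in trans (label-right s t u v r≤y) (trans (label-additive t (u ⊞ v) v m′)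
                     (sym (cong₂ _⊞_ (label-right s t u v r≤x) (label-right s t u v r≤z))))

-- The last vertex is excluded because its second coordinate may be 0; in the application it is the
-- puncture, with vector `e∞`.
label-positive : ∀ {p q} (t : Tree p q) u v → 0ℤ ℤ.< proj₂ u → 0ℤ ℤ.≤ proj₂ v →
                 ∀ {x} → x < q → 0ℤ ℤ.< proj₂ (label t u v x)
label-positive (leaf {p}) u v 0<u 0≤v {x} x<q with x ≤? p
... | yes _   = 0<u
... | no  x≰p = ⊥-elim (x≰p (≤-pred x<q))
label-positive (node {r = r} s t) u v 0<u 0≤v {x} x<q with x ≤? r
... | no  _   = label-positive t (u ⊞ v) v (ℤ.+-mono-<-≤ 0<u 0≤v) 0≤v x<q
... | yes x≤r with m≤n⇒m<n∨m≡n x≤r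
...   | inj₁ x<r  = label-positive s u (u ⊞ v) 0<u (ℤ.<⇒≤ (ℤ.+-mono-<-≤ 0<u 0≤v)) x<r
...   | inj₂ refl = subst (λ w → 0ℤ ℤ.< proj₂ w) (sym (label-last s u (u ⊞ v) ≤-refl)) (ℤ.+-mono-<-≤ 0<u 0≤v)

e₀ e∞ : Vec²
e₀ = 0ℤ , 1ℤ
e∞ = 1ℤ , 0ℤ

-- The stabiliser of e∞; translation by N in the cover acts through it.
shear : ℤ → Vec² → Vec²
shear n (a , b) = a ℤ.+ n ℤ.* b , b

det-e∞ : ∀ u → det u e∞ ≡ proj₂ u
det-e∞ (a , b) = identity a b
  where
  identity : ∀ a b → 1ℤ ℤ.* b ℤ.- a ℤ.* 0ℤ ≡ b
  identity = ℤ-Solver.solve-∀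

det-shear : ∀ n u v → det (shear n u) (shear n v) ≡ det u v
det-shear n (a , b) (c , d) = identity n a b c d
  where
  identity : ∀ n a b c d → (c ℤ.+ n ℤ.* d) ℤ.* b ℤ.- (a ℤ.+ n ℤ.* b) ℤ.* d ≡ c ℤ.* b ℤ.- a ℤ.* d
  identity = ℤ-Solver.solve-∀

shear-⊞ : ∀ n u v → shear n (u ⊞ v) ≡ shear n u ⊞ shear n v
shear-⊞ n (a , b) (c , d) = cong (_, b ℤ.+ d) (identity n a b c d)
  where
  identity : ∀ n a b c d → a ℤ.+ c ℤ.+ n ℤ.* (b ℤ.+ d) ≡ (a ℤ.+ n ℤ.* b) ℤ.+ (c ℤ.+ n ℤ.* d)
  identity = ℤ-Solver.solve-∀

shear-e∞ : ∀ n → shear n e∞ ≡ e∞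
shear-e∞ n = cong (_, 0ℤ) (identity n)
  where
  identity : ∀ n → 1ℤ ℤ.+ n ℤ.* 0ℤ ≡ 1ℤ
  identity = ℤ-Solver.solve-∀

shear-suc : ∀ ρ n u → shear (ρ ℤ.* + suc n) u ≡ shear ρ (shear (ρ ℤ.* + n) u)
shear-suc ρ n (a , b) = cong (_, b) (trans (cong (λ k → a ℤ.+ ρ ℤ.* k ℤ.* b) (ℤ.pos-+ 1 n)) (identity ρ (+ n) a b))
  where
  identity : ∀ ρ n a b → a ℤ.+ ρ ℤ.* (1ℤ ℤ.+ n) ℤ.* b ≡ (a ℤ.+ ρ ℤ.* n ℤ.* b) ℤ.+ ρ ℤ.* b
  identity = ℤ-Solver.solve-∀

-- Lists without repetitions

unique-↭ : {A : Set} {xs ys : List A} → Unique xs → Unique ys → xs ⊆ ys → ys ⊆ xs → xs ↭ ys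
unique-↭ {xs = []} {[]}     u v s t = ↭-refl
unique-↭ {xs = []} {y ∷ ys} u v s t with t (here refl)
... | ()
unique-↭ {A} {xs = x ∷ xs} {ys} (x∉ ∷ u) v s t with ∈-∃++ (s (here refl))
... | as , bs , refl = ↭-trans (prep x (unique-↭ u v′ s′ t′)) (↭-sym move)
  where
  move : as ++ x ∷ bs ↭ x ∷ (as ++ bs)
  move = shift x as bs
  v″ : Unique (x ∷ (as ++ bs))
  v″ = PermSetoid.Unique-resp-↭ (setoid A) (↭⇒↭ₛ move) v
  v′ : Unique (as ++ bs)
  v′ with _ ∷ w ← v″ = w
  s′ : xs ⊆ as ++ bs
  s′ z∈ with ∈-resp-↭ move (s (there z∈))
  ... | here refl = ⊥-elim (All.lookup x∉ z∈ refl)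
  ... | there z∈′ = z∈′
  t′ : as ++ bs ⊆ xs
  t′ z∈ with t (∈-resp-↭ (↭-sym move) (there z∈)) | v″
  ... | here refl | x∉′ ∷ _ = ⊥-elim (All.lookup x∉′ z∈ refl)
  ... | there z∈′ | _       = z∈′

∈-concatMap⁻′ : {A B : Set} (f : A → List B) (xs : List A) {y : B} → y ∈ concatMap f xs → ∃ λ x → x ∈ xs × y ∈ f x
∈-concatMap⁻′ f xs m = find (∈-concatMap⁻ f {xs = xs} m)

∈-concatMap⁺′ : {A B : Set} (f : A → List B) {xs : List A} {x : A} {y : B} → x ∈ xs → y ∈ f x → y ∈ concatMap f xs
∈-concatMap⁺′ f x∈ y∈ = ∈-concatMap⁺ f (lose x∈ y∈)

unique-concatMap : {A B : Set} {f : A → List B} (xs : List A) → Unique xs → (∀ x → Unique (f x)) →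
                   (∀ {x x′ y} → y ∈ f x → y ∈ f x′ → x ≡ x′) → Unique (concatMap f xs)
unique-concatMap []       u v inj = []
unique-concatMap {f = f} (x ∷ xs) (x∉ ∷ u) v inj =
  Unique.++⁺ (v x) (unique-concatMap xs u v inj)
    (λ (m , m′) → let x′ , x′∈ , m″ = ∈-concatMap⁻′ f xs m′ in All.lookup x∉ x′∈ (inj m m″))

unique-map : {A B : Set} (g : A → B) (xs : List A) → Unique xs →
             (∀ {x y} → x ∈ xs → y ∈ xs → g x ≡ g y → x ≡ y) → Unique (map g xs)
unique-map g []       u inj = []
unique-map g (x ∷ xs) (x∉ ∷ u) inj =
  All.tabulate (λ m eq → let y , y∈ , e = ∈-map⁻ g m in
                         All.lookup x∉ y∈ (inj (here refl) (there y∈) (trans eq e)))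
  ∷ unique-map g xs u (λ m m′ → inj (there m) (there m′))

∈-if⁻ : {A : Set} (b : Bool) {x y : A} → x ∈ (if b then y ∷ [] else []) → b ≡ true × x ≡ y
∈-if⁻ true (here refl) = refl , refl

∈-if⁺ : {A : Set} {b : Bool} {x : A} → b ≡ true → x ∈ (if b then x ∷ [] else [])
∈-if⁺ refl = here refl

unique-if : {A : Set} (b : Bool) {x : A} → Unique (if b then x ∷ [] else [])
unique-if true  = [] ∷ []
unique-if false = []

perm-filter : {B : Set} {P : B → Set} (P? : Decidable P) (fs : List (B → ℕ)) (bs : List B) →
              (∀ {f b} → f ∈ fs → ¬ P b → f b ≡ 0) → perm fs bs ≡ perm fs (filter P? bs)
perm-filter P? fs []       z = refl
perm-filter P? fs (b ∷ bs) z with P? b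
... | no ¬p = trans (perm-drop fs (b ∷ []) bs (All.tabulate (λ f∈ → λ { _ (here refl) → z f∈ ¬p })))
                    (perm-filter P? fs bs z)
... | yes p = begin
  perm fs (b ∷ bs)
    ≡⟨ perm-column fs b bs ⟩
  perm fs bs + psum (λ f gs → f b * perm gs bs) fs
    ≡⟨ cong₂ _+_ (perm-filter P? fs bs z) (psum-cong fs (λ f gs _ s →
         cong (f b *_) (perm-filter P? gs bs (λ g∈ → z (s g∈))))) ⟩
  perm fs (filter P? bs) + psum (λ f gs → f b * perm gs (filter P? bs)) fs
    ≡⟨ perm-column fs b (filter P? bs) ⟨
  perm fs (b ∷ filter P? bs) ∎
  where open ≡-Reasoning

-- Allows one list of triangles to be exchanged for another when the two differ only in triangles
-- that have no corner at a point to be matched.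
perm-support : {B : Set} (fs : List (B → ℕ)) {bs cs : List B} → Unique bs → Unique cs →
               (∀ {f b} → f ∈ fs → f b ≢ 0 → b ∈ bs → b ∈ cs) →
               (∀ {f b} → f ∈ fs → f b ≢ 0 → b ∈ cs → b ∈ bs) →
               perm fs bs ≡ perm fs cs
perm-support {B} fs {bs} {cs} u v s t = begin
  perm fs bs                 ≡⟨ perm-filter P? fs bs vanish ⟩
  perm fs (filter P? bs)     ≡⟨ perm-↭ fs (unique-↭ (Unique.filter⁺ P? u) (Unique.filter⁺ P? v) (sub s) (sub t)) ⟩
  perm fs (filter P? cs)     ≡⟨ perm-filter P? fs cs vanish ⟨
  perm fs cs                 ∎
  where
  open ≡-Reasoning
  P : B → Set
  P b = Any (λ f → f b ≢ 0) fs
  P? : Decidable P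
  P? b = Any.any? (λ f → ¬? (f b ≟ 0)) fs
  vanish : ∀ {f b} → f ∈ fs → ¬ P b → f b ≡ 0
  vanish {f} {b} f∈ ¬p with f b ≟ 0
  ... | yes e = e
  ... | no ne = ⊥-elim (¬p (lose f∈ ne))
  sub : ∀ {xs ys} → (∀ {f b} → f ∈ fs → f b ≢ 0 → b ∈ xs → b ∈ ys) → filter P? xs ⊆ filter P? ys
  sub h {b} m = let b∈ , p = ∈-filter⁻ P? m
                    f , f∈ , ne = find p
                in ∈-filter⁺ P? (h f∈ ne b∈) p

map-agree : {A B : Set} (g h : A → B → ℕ) (xs : List A) {bs : List B} →
            (∀ {x b} → x ∈ xs → b ∈ bs → g x b ≡ h x b) →
            Pointwise (λ f f′ → ∀ b → b ∈ bs → f b ≡ f′ b) (map g xs) (map h xs)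
map-agree g h []       e = []
map-agree g h (x ∷ xs) e = (λ b b∈ → e (here refl) b∈) ∷ map-agree g h xs (λ x∈ → e (there x∈))

gap : ∀ {x y} → x < y → ∃ λ d → y ≡ x + suc d
gap {x} x<y = let d , e = m≤n⇒∃[o]m+o≡n x<y in d , trans (sym e) (sym (+-suc x d))

-- Counting in a window of the cover

mult : ℕ → List ℕ → ℕ
mult v []       = 0
mult v (x ∷ xs) = δ v x + mult v xs

mult-∈ : ∀ v xs → mult v xs ≢ 0 → v ∈ xs
mult-∈ v []       ne = ⊥-elim (ne refl)
mult-∈ v (x ∷ xs) ne with v ≟ x
... | yes refl = here refl
... | no  n    = there (mult-∈ v xs (λ e → ne (cong₂ _+_ (δ-≢ n) e)))

mult-filter : ∀ (f : ℕ → Bool) v xs → f v ≡ true → mult v (filterᵇ f xs) ≡ mult v xs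
mult-filter f v []       e = refl
mult-filter f v (x ∷ xs) e with f x in fx
... | true  = cong (λ n → δ v x + n) (mult-filter f v xs e)
... | false = trans (mult-filter f v xs e) (sym (cong (_+ mult v xs) (δ-≢ v≢x)))
  where
  v≢x : v ≢ x
  v≢x refl with trans (sym e) fx
  ... | ()

occ-∷ : ∀ p q r → occ p (q ∷ r) ≡ (if p ==ᴾ q then 1 else 0) + occ p r
occ-∷ p q r with p ==ᴾ q
... | true  = refl
... | false = refl

occ-map-fin : ∀ v xs → occ (fin v) (map fin xs) ≡ mult v xs
occ-map-fin v []       = refl
occ-map-fin v (x ∷ xs) = trans (occ-∷ (fin v) (fin x) (map fin xs)) (cong (λ n → δ v x + n) (occ-map-fin v xs))

concatMap-concatMap : {A B C : Set} (f : B → List C) (g : A → List B) (xs : List A) →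
                      concatMap f (concatMap g xs) ≡ concatMap (λ x → concatMap f (g x)) xs
concatMap-concatMap f g []       = refl
concatMap-concatMap f g (x ∷ xs) = trans (concatMap-++ f (g x) (concatMap g xs)) (cong (concatMap f (g x) ++_) (concatMap-concatMap f g xs))

concatMap-if : {A B : Set} (q : A → Bool) (f : A → B) (xs : List A) →
               concatMap (λ x → if q x then f x ∷ [] else []) xs ≡ map f (filterᵇ q xs)
concatMap-if q f []       = refl
concatMap-if q f (x ∷ xs) with q x
... | true  = cong (f x ∷_) (concatMap-if q f xs)
... | false = concatMap-if q f xs

∈-filterᵇ⁻ : {A : Set} (q : A → Bool) {xs : List A} {x : A} → x ∈ filterᵇ q xs → x ∈ xs × q x ≡ true
∈-filterᵇ⁻ q {xs} m = let x∈ , t = ∈-filter⁻ (T? ∘ q) {xs = xs} m in x∈ , Equivalence.to T-≡ t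

∈-filterᵇ⁺ : {A : Set} (q : A → Bool) {xs : List A} {x : A} → x ∈ xs → q x ≡ true → x ∈ filterᵇ q xs
∈-filterᵇ⁺ q x∈ e = ∈-filter⁺ (T? ∘ q) x∈ (Equivalence.from T-≡ e)

not-≡ᵇ⁺ : ∀ {v r} → v ≢ r → not (v ≡ᵇ r) ≡ true
not-≡ᵇ⁺ {v} {r} ne with v ≡ᵇ r in e
... | true  = ⊥-elim (ne (≡ᵇ⇒≡ v r (Equivalence.from T-≡ e)))
... | false = refl

not-≡ᵇ-refl : ∀ r → not (r ≡ᵇ r) ≡ false
not-≡ᵇ-refl r = cong not (Equivalence.to T-≡ (≡⇒≡ᵇ r r refl))

not-≡ᵇ⁻ : ∀ {v r} → not (v ≡ᵇ r) ≡ true → v ≢ r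
not-≡ᵇ⁻ {v} e refl with trans (sym e) (not-≡ᵇ-refl v)
... | ()

*-positive : ∀ {a b} → 0ℤ ℤ.< a → 0ℤ ℤ.< b → 0ℤ ℤ.< a ℤ.* b
*-positive {a} {b} 0<a 0<b = subst (ℤ._< a ℤ.* b) (ℤ.*-zeroʳ a) (ℤ.*-monoˡ-<-pos a {{ℤ.positive 0<a}} 0<b)

*-positive⁻ˡ : ∀ {a b} → 0ℤ ℤ.< b → 0ℤ ℤ.< a ℤ.* b → 0ℤ ℤ.< a
*-positive⁻ˡ {a} {b} 0<b 0<ab =
  ℤ.*-cancelʳ-<-nonNeg b {{ℤ.nonNegative (ℤ.<⇒≤ 0<b)}} (subst (ℤ._< a ℤ.* b) (sym (ℤ.*-zeroˡ b)) 0<ab)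

-- The lifted triangulation

module Lift (N : ℕ) .{{_ : NonZero N}} (3≤N : 3 ≤ N) (𝒯 : Triangulation N) where

  open Triangulation 𝒯 using (inT; nonCross; maximal) public
  open Residues N public

  ⟦_⟧ : ℕ → Fin N
  ⟦_⟧ = ⌊_⌋ N

  -- The segment from x to y is a boundary edge or a lift of an arc of 𝒯. Since `side` sees only
  -- residues, `le` singles out the true lift among the segments with the same end residues.
  record E (x y : ℕ) : Set where
    constructor mkE
    field
      lt   : x < y
      le   : y ≤ x + N
      side : y ≡ suc x ⊎ inT (D ⟦ x ⟧ ⟦ y ⟧) ≡ true
  open E

  Cr : ℕ → Set
  Cr x = inT (C ⟦ x ⟧) ≡ true

  Cr? : ∀ x → Dec (Cr x)
  Cr? x = inT (C ⟦ x ⟧) ≟ᵇ true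

  E? : ∀ x y → Dec (E x y)
  E? x y = map′ (λ (a , b , c) → mkE a b c) (λ e → lt e , le e , side e)
    ((x <? y) ×-dec (y ≤? x + N) ×-dec ((y ≟ suc x) ⊎-dec (inT (D ⟦ x ⟧ ⟦ y ⟧) ≟ᵇ true)))

  Cr-≋ : ∀ {x y} → x ≋ y → Cr x → Cr y
  Cr-≋ e c = trans (cong (λ i → inT (C i)) (sym (⌊⌋-cong e))) c

  E-≋ : ∀ {x x′} d → x ≋ x′ → E x (x + d) → E x′ (x′ + d)
  E-≋ {x} {x′} d e (mkE l m s) = mkE
    (subst (_< x′ + d) (+-identityʳ x′) (+-monoʳ-< x′ (+-cancelˡ-< x 0 d (subst (_< x + d) (sym (+-identityʳ x)) l))))
    (+-monoʳ-≤ x′ (+-cancelˡ-≤ x d N m)) (side′ s)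
    where
    side′ : _ → x′ + d ≡ suc x′ ⊎ inT (D ⟦ x′ ⟧ ⟦ x′ + d ⟧) ≡ true
    side′ (inj₁ p) = inj₁ (trans (cong (λ s → x′ + s) (+-cancelˡ-≡ x d 1 (trans p (+-comm 1 x)))) (+-comm x′ 1))
    side′ (inj₂ p) = inj₂ (trans (cong₂ (λ i j → inT (D i j)) (sym (⌊⌋-cong e)) (sym (⌊⌋-cong (≋-+ʳ d e)))) p)

  E-shift : ∀ {x y} k → E x y → E (x + k * N) (y + k * N)
  E-shift {x} {y} k e = subst (E (x + k * N)) eq (E-≋ (y ∸ x) (sym (≋-+kN x k)) (subst (E x) (sym (m+[n∸m]≡n (<⇒≤ (lt e)))) e))
    where
    rearrange : ∀ a b c → (a + b) + c ≡ (a + c) + b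
    rearrange = solve-∀
    eq : (x + k * N) + (y ∸ x) ≡ y + k * N
    eq = trans (rearrange x (k * N) (y ∸ x)) (cong (_+ k * N) (m+[n∸m]≡n (<⇒≤ (lt e))))

  E-unshift : ∀ {x y} k → E (x + k * N) (y + k * N) → E x y
  E-unshift {x} {y} k e = subst (E x) (m+[n∸m]≡n x≤y)
    (E-≋ (y ∸ x) (≋-+kN x k) (subst (E (x + k * N)) eq e))
    where
    rearrange : ∀ a b c → (a + b) + c ≡ (a + c) + b
    rearrange = solve-∀
    x≤y : x ≤ y
    x≤y = <⇒≤ (+-cancelʳ-< (k * N) x y (lt e))
    eq : y + k * N ≡ (x + k * N) + (y ∸ x)
    eq = trans (cong (_+ k * N) (sym (m+[n∸m]≡n x≤y))) (rearrange x (y ∸ x) (k * N))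

  -- Crossing and maximality in the cover.

  private
    Arc-lift : ∀ {x y x′ y′} → x < x′ → x′ < y → y < y′ → y ≤ x + N → y′ ≤ x′ + N →
               Cross N (D ⟦ x ⟧ ⟦ y ⟧) (D ⟦ x′ ⟧ ⟦ y′ ⟧)
    Arc-lift {x} {y} {x′} {y′} a b c m m′ =
      inj₁ (subst (0 <_) (sym d₁) (m<n⇒0<n∸m a) ,
            subst₂ _<_ (sym d₁) (sym d₂) (∸-monoˡ-< b (<⇒≤ a)) ,
            subst₂ _<_ (sym d₂) (sym (cong₂ _+_ d₁ d₃))
              (subst (y ∸ x <_) total (∸-monoˡ-< c (<⇒≤ (<-trans a b)))))
      where
      at : ∀ {u v} → u ≤ v → u + (v ∸ u) ≡ v
      at = m+[n∸m]≡n
      shrink : ∀ {u v w} → u ≤ v → v < u + w → v ∸ u < w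
      shrink {u} {v} {w} u≤v l = +-cancelˡ-< u (v ∸ u) w (subst (_< u + w) (sym (at u≤v)) l)
      shrink≤ : ∀ {u v w} → u ≤ v → v ≤ u + w → v ∸ u ≤ w
      shrink≤ {u} {v} {w} u≤v l = +-cancelˡ-≤ u (v ∸ u) w (subst (_≤ u + w) (sym (at u≤v)) l)
      d₁ : dist N ⟦ x ⟧ ⟦ x′ ⟧ ≡ x′ ∸ x
      d₁ = trans (cong (λ v → dist N ⟦ x ⟧ ⟦ v ⟧) (sym (at (<⇒≤ a)))) (dist-lift x (x′ ∸ x) (shrink (<⇒≤ a) (<-≤-trans b m)))
      d₂ : len N ⟦ x ⟧ ⟦ y ⟧ ≡ y ∸ x
      d₂ = trans (cong (λ v → len N ⟦ x ⟧ ⟦ v ⟧) (sym (at (<⇒≤ (<-trans a b))))) (len-lift x (y ∸ x) (m<n⇒0<n∸m (<-trans a b)) (shrink≤ (<⇒≤ (<-trans a b)) m))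
      d₃ : len N ⟦ x′ ⟧ ⟦ y′ ⟧ ≡ y′ ∸ x′
      d₃ = trans (cong (λ v → len N ⟦ x′ ⟧ ⟦ v ⟧) (sym (at (<⇒≤ (<-trans b c))))) (len-lift x′ (y′ ∸ x′) (m<n⇒0<n∸m (<-trans b c)) (shrink≤ (<⇒≤ (<-trans b c)) m′))
      total : y′ ∸ x ≡ (x′ ∸ x) + (y′ ∸ x′)
      total = +-cancelˡ-≡ x _ _ (trans (at (<⇒≤ (<-trans a (<-trans b c))))
              (sym (trans (sym (+-assoc x (x′ ∸ x) _)) (trans (cong (_+ (y′ ∸ x′)) (at (<⇒≤ a))) (at (<⇒≤ (<-trans b c)))))))

  E-noncrossing : ∀ {x x′ y y′} → x < x′ → x′ < y → y < y′ → E x y → E x′ y′ → ⊥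
  E-noncrossing a b c (mkE _ _ (inj₁ refl)) _ = <-irrefl refl (<-≤-trans a (≤-pred b))
  E-noncrossing a b c (mkE _ _ (inj₂ _)) (mkE _ _ (inj₁ refl)) = <-irrefl refl (<-≤-trans b (≤-pred c))
  E-noncrossing a b c (mkE _ m (inj₂ p)) (mkE _ m′ (inj₂ p′)) = nonCross _ _ p p′ (Arc-lift a b c m m′)

  C-noncrossing : ∀ {x k y} → x < k → k < y → E x y → Cr k → ⊥
  C-noncrossing a b (mkE _ _ (inj₁ refl)) _ = <-irrefl refl (<-≤-trans a (≤-pred b))
  C-noncrossing {x} {k} {y} a b (mkE _ m (inj₂ p)) c = nonCross (D ⟦ x ⟧ ⟦ y ⟧) (C ⟦ k ⟧) p c
    (subst (0 <_) (sym d₁) (m<n⇒0<n∸m a) , subst₂ _<_ (sym d₁) (sym d₂) (∸-monoˡ-< b (<⇒≤ a)))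
    where
    at : ∀ {u v} → u ≤ v → u + (v ∸ u) ≡ v
    at = m+[n∸m]≡n
    d₁ : dist N ⟦ x ⟧ ⟦ k ⟧ ≡ k ∸ x
    d₁ = trans (cong (λ v → dist N ⟦ x ⟧ ⟦ v ⟧) (sym (at (<⇒≤ a))))
      (dist-lift x (k ∸ x) (+-cancelˡ-< x (k ∸ x) N (subst (_< x + N) (sym (at (<⇒≤ a))) (<-≤-trans b m))))
    d₂ : len N ⟦ x ⟧ ⟦ y ⟧ ≡ y ∸ x
    d₂ = trans (cong (λ v → len N ⟦ x ⟧ ⟦ v ⟧) (sym (at (<⇒≤ (<-trans a b)))))
      (len-lift x (y ∸ x) (m<n⇒0<n∸m (<-trans a b)) (+-cancelˡ-≤ x (y ∸ x) N (subst (_≤ x + N) (sym (at (<⇒≤ (<-trans a b)))) m)))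

  E-arc : ∀ {x k l} → ⟦ x ⟧ ≡ k → inT (D k l) ≡ true → E x (x + len N k l)
  E-arc {x} {k} {l} refl p = mkE
    (subst (_< x + len N k l) (+-identityʳ x) (+-monoʳ-< x (0<len k l)))
    (+-monoʳ-≤ x (len≤N k l))
    (inj₂ (trans (cong (λ j → inT (D k j)) (⌊+⌋ x l (len-spec k l))) p))

  lift-back : ∀ {x} k → N ≤ x → ⟦ x ∸ dist N k ⟦ x ⟧ ⟧ ≡ k
  lift-back {x} k N≤x = trans (⌊⌋-cong (≋-cancelʳ d (trans (cong (_% N) (m∸n+n≡m d≤x))
      (trans (sym (⌊⌋-toℕ x)) (sym (dist-spec k ⟦ x ⟧)))))) (⌊toℕ⌋ k)
    where
    d = dist N k ⟦ x ⟧
    d≤x : d ≤ x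
    d≤x = ≤-trans (<⇒≤ (dist<N k ⟦ x ⟧)) N≤x

  -- `N ≤ x` leaves room in ℕ for a lift that begins to the left of x. Later statements about small
  -- positions are obtained from this one and from `E-maximal` by translating by `N`.
  C-maximal : ∀ {x} → N ≤ x → Cr x ⊎ ∃₂ λ x′ y′ → x′ < x × x < y′ × E x′ y′
  C-maximal {x} N≤x with inT (C ⟦ x ⟧) in e
  ... | true  = inj₁ refl
  ... | false with maximal (C ⟦ x ⟧) _ e
  ...   | D k l , p , 0<d , d<l = inj₂ (x ∸ d , x ∸ d + len N k l ,
            ∸-monoʳ-< {x} 0<d d≤x , subst (_< x ∸ d + len N k l) (m∸n+n≡m d≤x) (+-monoʳ-< (x ∸ d) d<l) ,
            E-arc (lift-back k N≤x) p)
    where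
    d = dist N k ⟦ x ⟧
    d≤x : d ≤ x
    d≤x = ≤-trans (<⇒≤ (dist<N k ⟦ x ⟧)) N≤x

  E-maximal : ∀ {x y} → N ≤ x → x < y → y ≤ x + N →
              E x y ⊎ (∃ λ k → x < k × k < y × Cr k) ⊎
              (∃₂ λ x′ y′ → E x′ y′ × ((x < x′ × x′ < y × y < y′) ⊎ (x′ < x × x < y′ × y′ < y)))
  E-maximal {x} {y} N≤x x<y y≤x+N with E? x y
  ... | yes e = inj₁ e
  ... | no ¬e = inj₂ (go _ refl)
    where
    d = y ∸ x
    at : x + d ≡ y
    at = m+[n∸m]≡n (<⇒≤ x<y)
    d≤N : d ≤ N
    d≤N = +-cancelˡ-≤ x d N (subst (_≤ x + N) (sym at) y≤x+N)
    len≡ : len N ⟦ x ⟧ ⟦ y ⟧ ≡ d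
    len≡ = trans (cong (λ v → len N ⟦ x ⟧ ⟦ v ⟧) (sym at)) (len-lift x d (m<n⇒0<n∸m x<y) d≤N)
    y≢ : y ≢ suc x
    y≢ eq = ¬e (mkE x<y y≤x+N (inj₁ eq))
    isArc : ⟦ y ⟧ ≢ _⊕_ N ⟦ x ⟧ 1
    isArc eq = y≢ (sym (≋-unique (sym (⌊⌋-inj (trans eq (trans (⌊⌋-⊕ x 1) (cong ⟦_⟧ (+-comm x 1)))))) x<y
                        (≤-<-trans y≤x+N ≤-refl)))
    Found : Set
    Found = (∃ λ k → x < k × k < y × Cr k) ⊎
            (∃₂ λ x′ y′ → E x′ y′ × ((x < x′ × x′ < y × y < y′) ⊎ (x′ < x × x < y′ × y′ < y)))
    step : ∀ {m} → 0 < m → x < x + m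
    step {m} 0<g = subst (_< x + m) (+-identityʳ x) (+-monoʳ-< x 0<g)
    to-y : ∀ {m} → m < len N ⟦ x ⟧ ⟦ y ⟧ → x + m < y
    to-y {m} l = subst (x + m <_) at (+-monoʳ-< x (subst (m <_) len≡ l))
    at-k : ∀ k → ⟦ x + dist N ⟦ x ⟧ k ⟧ ≡ k
    at-k k = ⌊+⌋ x k (dist-spec ⟦ x ⟧ k)
    go : ∀ b → inT (D ⟦ x ⟧ ⟦ y ⟧) ≡ b → Found
    go true  p = ⊥-elim (¬e (mkE x<y y≤x+N (inj₂ p)))
    go false p with maximal (D ⟦ x ⟧ ⟦ y ⟧) isArc p
    ... | C k , q , 0<g , g<l = inj₁ (x + dist N ⟦ x ⟧ k , step 0<g , to-y g<l ,
                                      trans (cong (λ i → inT (C i)) (at-k k)) q)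
    ... | D k l , q , inj₁ (0<g , g<l , l<) =
      inj₂ (x + g , x + g + len N k l , E-arc (at-k k) q ,
            inj₁ (step 0<g , to-y g<l , subst₂ _<_ at (sym (+-assoc x g _)) (+-monoʳ-< x (subst (_< g + len N k l) len≡ l<))))
      where g = dist N ⟦ x ⟧ k
    ... | D k l , q , inj₂ (0<g , g<l , l<) =
      inj₂ (x′ , x′ + len N k l , E-arc (lift-back k N≤x) q ,
            inj₂ (∸-monoʳ-< {x} 0<g g≤x , subst (_< x′ + len N k l) (m∸n+n≡m g≤x) (+-monoʳ-< x′ g<l) ,
                  subst (x′ + len N k l <_) end (+-monoʳ-< x′ (subst (λ n → len N k l < g + n) len≡ l<))))
      where
      g = dist N k ⟦ x ⟧
      g≤x : g ≤ x
      g≤x = ≤-trans (<⇒≤ (dist<N k ⟦ x ⟧)) N≤x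
      x′ = x ∸ g
      end : x′ + (g + d) ≡ y
      end = trans (sym (+-assoc x′ g d)) (trans (cong (_+ d) (m∸n+n≡m g≤x)) at)

  E-shift₁ : ∀ {x y} → E x y → E (x + N) (y + N)
  E-shift₁ {x} {y} e = subst (λ n → E (x + n) (y + n)) (+-identityʳ N) (E-shift 1 e)

  E-unshift₁ : ∀ {x y} → E (x + N) (y + N) → E x y
  E-unshift₁ {x} {y} e = E-unshift 1 (subst (λ n → E (x + n) (y + n)) (sym (+-identityʳ N)) e)

  private
    -- Let r be the last position before q joined to p. If r and q were not joined, maximality would
    -- give an arc across the segment from r to q. A central arc there, or an arc leaving beyond q
    -- or starting before p, crosses the edge from p to q; an arc starting at p contradicts the
    -- choice of r; one starting between p and r crosses the edge from p to r.
    apex-high : ∀ {p q} → N ≤ p → suc p < q → E p q → ∃ λ r → p < r × r < q × E p r × E r q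
    apex-high {p} {q} N≤p 1+p<q e
      with greatest (E? p) q 1+p<q (mkE ≤-refl (subst (_≤ p + N) (+-comm p 1) (+-monoʳ-≤ p 0<N)) (inj₁ refl))
    ... | r , p<r , r<q , epr , max
      with E-maximal (≤-trans N≤p (<⇒≤ p<r)) r<q (≤-trans (E.le e) (+-monoˡ-≤ N (<⇒≤ p<r)))
    ...   | inj₁ erq = r , p<r , r<q , epr , erq
    ...   | inj₂ (inj₁ (k , r<k , k<q , c)) = ⊥-elim (C-noncrossing (<-trans p<r r<k) k<q e c)
    ...   | inj₂ (inj₂ (x , y , exy , inj₁ (r<x , x<q , q<y))) = ⊥-elim (E-noncrossing (<-trans p<r r<x) x<q q<y e exy)
    ...   | inj₂ (inj₂ (x , y , exy , inj₂ (x<r , r<y , y<q))) with <-cmp x p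
    ...     | tri< x<p _ _  = ⊥-elim (E-noncrossing x<p (<-trans p<r r<y) y<q exy e)
    ...     | tri≈ _ refl _ = ⊥-elim (max y r<y y<q exy)
    ...     | tri> _ _ p<x  = ⊥-elim (E-noncrossing p<x x<r r<y epr exy)

  E-apex : ∀ {p q} → suc p < q → E p q → ∃ λ r → p < r × r < q × E p r × E r q
  E-apex {p} {q} 1+p<q e with apex-high (m≤n+m N p) (+-monoˡ-< N 1+p<q) (E-shift₁ e)
  ... | r , p<r , r<q , epr , erq =
    r ∸ N , +-cancelʳ-< N p (r ∸ N) (subst (p + N <_) (sym back) p<r) ,
    +-cancelʳ-< N (r ∸ N) q (subst (_< q + N) (sym back) r<q) ,
    E-unshift₁ (subst (E (p + N)) (sym back) epr) , E-unshift₁ (subst (λ v → E v (q + N)) (sym back) erq)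
    where
    back : r ∸ N + N ≡ r
    back = m∸n+n≡m (≤-trans (m≤n+m N p) (<⇒≤ p<r))

  -- An arc crossing a missing central arc at the end of a given arc is longer
  -- than that arc, so iterating this must reach a central arc of 𝒯.
  central-above : ∀ n {x y} → x + N ≤ y + n → E x y → ∃ Cr
  central-above n {x} {y} len e with C-maximal (m≤n+m N x)
  ... | inj₁ c = x + N , c
  ... | inj₂ (x′ , y′ , x′<x , x<y′ , e′) with <-≤-connex y′ (y + N)
  ...   | inj₁ y′<y = ⊥-elim (E-noncrossing x′<x x<y′ y′<y e′ (E-shift₁ e))
  central-above zero {x} {y} len e | inj₂ (x′ , y′ , x′<x , x<y′ , e′) | inj₂ y≤y′ =
    ⊥-elim (<-irrefl refl (<-≤-trans (+-monoˡ-< N x′<x)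
      (≤-trans (+-monoˡ-≤ N (subst (x + N ≤_) (+-identityʳ y) len)) (≤-trans y≤y′ (E.le e′)))))
  central-above (suc n) {x} {y} len e | inj₂ (x′ , y′ , x′<x , x<y′ , e′) | inj₂ y≤y′ =
    central-above n (≤-pred (≤-trans (+-monoˡ-< N x′<x)
      (≤-trans (+-monoˡ-≤ N len) (≤-trans (≤-reflexive (rearrange y n N)) (s≤s (+-monoˡ-≤ n y≤y′)))))) e′
    where
    rearrange : ∀ a b c → (a + suc b) + c ≡ suc (a + c + b)
    rearrange = solve-∀

  abstract
    central : ∃ λ k → k < N × Cr k
    central with C-maximal {N} ≤-refl
    ... | inj₁ c = N % N , m%n<n N N , Cr-≋ (sym (≋-% N)) c
    -- An edge falls short of the full length `N` by at most `N`, and every round of `central-above`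
    -- reduces this deficit.
    ... | inj₂ (x , y , _ , _ , e) with central-above N (+-monoˡ-≤ N (<⇒≤ (E.lt e))) e
    ...   | k , c = k % N , m%n<n k N , Cr-≋ (sym (≋-% k)) c

  Cr-+N : ∀ {k} → Cr k → Cr (k + N)
  Cr-+N {k} = Cr-≋ (sym (≋-+N k))

  -- An arc across the segment from k to l would have to pass over k or over l and cross the central
  -- ray there; a central ray between them is excluded. So maximality puts the segment into 𝒯.
  E-consecutive : ∀ {k l} → Cr k → Cr l → k < l → l ≤ k + N → (∀ v → k < v → v < l → ¬ Cr v) → E k l
  E-consecutive {k} {l} ck cl k<l l≤ none
    with E-maximal (m≤n+m N k) (+-monoˡ-< N k<l) (+-monoˡ-≤ N l≤)
  ... | inj₁ e = E-unshift₁ e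
  ... | inj₂ (inj₁ (v , k<v , v<l , c)) =
    ⊥-elim (none (v ∸ N) (+-cancelʳ-< N k (v ∸ N) (subst (k + N <_) (sym back) k<v))
                         (+-cancelʳ-< N (v ∸ N) l (subst (_< l + N) (sym back) v<l))
                         (Cr-≋ (trans (cong (_% N) (sym back)) (≋-+N (v ∸ N))) c))
    where
    back : v ∸ N + N ≡ v
    back = m∸n+n≡m (≤-trans (m≤n+m N k) (<⇒≤ k<v))
  ... | inj₂ (inj₂ (x , y , e , inj₁ (_ , x<l , l<y))) = ⊥-elim (C-noncrossing x<l l<y e (Cr-+N cl))
  ... | inj₂ (inj₂ (x , y , e , inj₂ (x<k , k<y , _))) = ⊥-elim (C-noncrossing x<k k<y e (Cr-+N ck))

  -- Provides the triangle behind a central ray: k, the next central position r and the puncture. At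
  -- most one turn separates k and r because `k + N` is central again.
  next-central : ∀ {k l} → Cr k → Cr l → k < l → ∃ λ r → k < r × r ≤ l × Cr r × E k r
  next-central {k} {l} ck cl k<l with least {Cr} Cr? {suc k} l k<l cl
  ... | r , k<r , r≤l , cr , min = r , k<r , r≤l , cr , E-consecutive ck cr k<r r≤k+N min
    where
    r≤k+N : r ≤ k + N
    r≤k+N with <-≤-connex (k + N) r
    ... | inj₂ r≤ = r≤
    ... | inj₁ <r = ⊥-elim (min (k + N) (subst (_≤ k + N) (+-comm k 1) (+-monoʳ-≤ k 0<N)) <r (Cr-+N ck))

  -- Edges among the positions up to K and the puncture, which is numbered
  -- suc K.
  module Window (K : ℕ) (cK : Cr K) where

    data G (x : ℕ) : ℕ → Set where
      finite : ∀ {y} → y ≤ K → E x y → G x y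
      ideal  : x ≤ K → Cr x → G x (suc K)

    G-noncrossing : ∀ {x x′ y y′} → x < x′ → x′ < y → y < y′ → G x y → G x′ y′ → ⊥
    G-noncrossing a b c (finite _ e) (finite _ e′) = E-noncrossing a b c e e′
    G-noncrossing a b c (finite _ e) (ideal _ cr)  = C-noncrossing a b e cr
    G-noncrossing a b c (ideal _ _)  (finite y≤K _) = <-irrefl refl (<-≤-trans c (≤-trans y≤K (n≤1+n K)))
    G-noncrossing a b c (ideal _ _)  (ideal _ _)   = <-irrefl refl c

    G-apex : ∀ {p q} → suc p < q → G p q → ∃ λ r → p < r × r < q × G p r × G r q
    G-apex 1+p<q (finite q≤K e) =
      let r , p<r , r<q , epr , erq = E-apex 1+p<q e
      in r , p<r , r<q , finite (≤-trans (<⇒≤ r<q) q≤K) epr , finite q≤K erq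
    G-apex 1+p<q (ideal p≤K c) =
      let r , p<r , r≤K , cr , e = next-central c cK (≤-pred 1+p<q)
      in r , p<r , s≤s r≤K , finite r≤K e , ideal r≤K cr

    open Noncrossing G G-noncrossing G-apex public

    polygon : ∀ {k} → k ≤ K → Cr k → Σ (Tree k (suc K)) Fine
    polygon {k} k≤K c = triangulate (suc K) (s≤s k≤K) (m≤n+m (suc K) k) (ideal k≤K c)

  -- The vectors attached to the positions of the cover.

  k₀ : ℕ
  k₀ = proj₁ central

  k₀<N : k₀ < N
  k₀<N = proj₁ (proj₂ central)

  Cr-k₀ : Cr k₀
  Cr-k₀ = proj₂ (proj₂ central)

  -- The disc cut open along the central arc at `k₀`: a polygon on k₀, ..., k₀ + N and the puncture,
  -- whose root side is the central arc at its first copy.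
  module Base = Window (k₀ + N) (Cr-+N Cr-k₀)

  base-polygon : Σ (Tree k₀ (suc (k₀ + N))) Base.Fine
  base-polygon = Base.polygon (m≤m+n k₀ N) Cr-k₀

  base-tree : Tree k₀ (suc (k₀ + N))
  base-tree = proj₁ base-polygon

  base : ℕ → Vec²
  base = label base-tree e₀ e∞

  base-k₀ : base k₀ ≡ e₀
  base-k₀ = label-first base-tree e₀ e∞ ≤-refl

  base-∞ : base (suc (k₀ + N)) ≡ e∞
  base-∞ = label-last base-tree e₀ e∞ ≤-refl

  base-additive : Additive base base-tree
  base-additive = label-additive base-tree e₀ e∞

  base-edge : ∀ {x y} → k₀ ≤ x → x < y → y ≤ suc (k₀ + N) → Base.G x y → det (base x) (base y) ≡ 1ℤ
  base-edge = Base.edge-unimodular base base-tree (proj₂ base-polygon) base-additive (cong₂ det base-k₀ base-∞)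

  base-central : ∀ {x} → k₀ ≤ x → x ≤ k₀ + N → Cr x → proj₂ (base x) ≡ 1ℤ
  base-central {x} k₀≤x x≤ c = trans (sym (det-e∞ (base x)))
    (trans (cong (det (base x)) (sym base-∞)) (base-edge k₀≤x (s≤s x≤) ≤-refl (Base.ideal x≤ c)))

  base-positive : ∀ {x} → x ≤ k₀ + N → 0ℤ ℤ.< proj₂ (base x)
  base-positive x≤ = label-positive base-tree e₀ e∞ (ℤ.+<+ (s≤s z≤n)) ℤ.≤-refl (s≤s x≤)

  -- The number of central arcs of 𝒯.
  ρ : ℤ
  ρ = proj₁ (base (k₀ + N))

  -- Each turn applies the shear by `ρ` once more. Below `k₀` truncated subtraction makes the value
  -- constant, with no geometric meaning, so the statements about `V` carry the bound `k₀ ≤ x`.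
  V : ℕ → Vec²
  V x = shear (ρ ℤ.* + ((x ∸ k₀) / N)) (base (k₀ + (x ∸ k₀) % N))

  private
    V-split : ∀ s n → s < N → V (k₀ + s + n * N) ≡ shear (ρ ℤ.* + n) (base (k₀ + s))
    V-split s n s<N = cong₂ (λ a b → shear (ρ ℤ.* + a) (base (k₀ + b))) quot rem
      where
      sub : k₀ + s + n * N ∸ k₀ ≡ s + n * N
      sub = trans (cong (_∸ k₀) (+-assoc k₀ s _)) (m+n∸m≡n k₀ _)
      rem : (k₀ + s + n * N ∸ k₀) % N ≡ s
      rem = trans (cong (_% N) sub) (trans ([m+kn]%n≡m%n s n N) (m<n⇒m%n≡m s<N))
      quot : (k₀ + s + n * N ∸ k₀) / N ≡ n
      quot = trans (cong (_/ N) sub) (trans (+-distrib-/-∣ʳ s (divides-refl n)) (cong₂ _+_ (m<n⇒m/n≡0 s<N) (m*n/n≡m n N)))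

  -- The right end `k₀ + N` belongs to two sheets: it closes one and opens the next. The two values
  -- agree because the vector (ρ , 1) of `k₀ + N` in `base` is the shear by `ρ` of the vector `e₀`
  -- of `k₀`.
  V-at : ∀ n {x} → k₀ ≤ x → x ≤ k₀ + N → V (x + n * N) ≡ shear (ρ ℤ.* + n) (base x)
  V-at n {x} k₀≤x x≤ with m≤n⇒m<n∨m≡n x≤
  ... | inj₁ x< = subst (λ v → V (v + n * N) ≡ shear (ρ ℤ.* + n) (base v)) (m+[n∸m]≡n k₀≤x)
      (V-split (x ∸ k₀) n (+-cancelˡ-< k₀ (x ∸ k₀) N (subst (_< k₀ + N) (sym (m+[n∸m]≡n k₀≤x)) x<)))
  ... | inj₂ refl = begin
    V (k₀ + N + n * N)                       ≡⟨ cong V (trans (+-assoc k₀ N (n * N)) (cong (_+ (N + n * N)) (sym (+-identityʳ k₀)))) ⟩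
    V (k₀ + 0 + suc n * N)                   ≡⟨ V-split 0 (suc n) 0<N ⟩
    shear (ρ ℤ.* + suc n) (base (k₀ + 0))    ≡⟨ cong (λ v → shear (ρ ℤ.* + suc n) (base v)) (+-identityʳ k₀) ⟩
    shear (ρ ℤ.* + suc n) (base k₀)          ≡⟨ cong (shear (ρ ℤ.* + suc n)) base-k₀ ⟩
    shear (ρ ℤ.* + suc n) e₀                 ≡⟨ cong (_, 1ℤ) (trans (cong (λ k → 0ℤ ℤ.+ ρ ℤ.* k ℤ.* 1ℤ) (ℤ.pos-+ 1 n)) (identity ρ (+ n))) ⟩
    shear (ρ ℤ.* + n) (ρ , 1ℤ)               ≡⟨ cong (λ c → shear (ρ ℤ.* + n) (ρ , c)) (sym (base-central (m≤m+n k₀ N) ≤-refl (Cr-+N Cr-k₀))) ⟩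
    shear (ρ ℤ.* + n) (base (k₀ + N))        ∎
    where
    open ≡-Reasoning
    identity : ∀ ρ n → 0ℤ ℤ.+ ρ ℤ.* (1ℤ ℤ.+ n) ℤ.* 1ℤ ≡ ρ ℤ.+ ρ ℤ.* n ℤ.* 1ℤ
    identity = ℤ-Solver.solve-∀

  reduce : ∀ {x} → k₀ ≤ x → ∃₂ λ n x′ → k₀ ≤ x′ × x′ < k₀ + N × x ≡ x′ + n * N
  reduce {x} k₀≤x = (x ∸ k₀) / N , k₀ + (x ∸ k₀) % N , m≤m+n k₀ _ , +-monoʳ-< k₀ (m%n<n (x ∸ k₀) N) ,
    trans (sym (m+[n∸m]≡n k₀≤x)) (trans (cong (λ v → k₀ + v) (m≡m%n+[m/n]*n (x ∸ k₀) N)) (sym (+-assoc k₀ _ _)))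

  -- The central rays over the translates of `k₀` cut the cover into sheets, and no edge passes over
  -- such a ray; hence an edge can be moved as a whole into the base sheet.
  reduce-edge : ∀ {x y} → k₀ ≤ x → E x y →
    ∃ λ n → ∃₂ λ x′ y′ → k₀ ≤ x′ × x′ < k₀ + N × y′ ≤ k₀ + N × x ≡ x′ + n * N × y ≡ y′ + n * N × E x′ y′
  reduce-edge {x} {y} k₀≤x e with reduce k₀≤x
  ... | n , x′ , k₀≤x′ , x′< , refl = n , x′ , y ∸ n * N , k₀≤x′ , x′< ,
        +-cancelʳ-≤ (n * N) _ _ (subst (_≤ k₀ + N + n * N) (sym back) y≤) , refl , sym back ,
        E-unshift n (subst (E (x′ + n * N)) (sym back) e)
    where
    back : y ∸ n * N + n * N ≡ y
    back = m∸n+n≡m (≤-trans (m≤n+m (n * N) x′) (<⇒≤ (E.lt e)))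
    y≤ : y ≤ k₀ + N + n * N
    y≤ with <-≤-connex (k₀ + N + n * N) y
    ... | inj₂ l = l
    ... | inj₁ l = ⊥-elim (C-noncrossing (+-monoˡ-< (n * N) x′<) l e (Cr-≋ (sym (≋-+kN (k₀ + N) n)) (Cr-+N Cr-k₀)))

  V-shift : ∀ {x} → k₀ ≤ x → V (x + N) ≡ shear ρ (V x)
  V-shift k₀≤x with reduce k₀≤x
  ... | n , x′ , k₀≤x′ , x′< , refl = begin
    V (x′ + n * N + N)               ≡⟨ cong V (trans (+-assoc x′ (n * N) N) (cong (λ v → x′ + v) (+-comm (n * N) N))) ⟩
    V (x′ + suc n * N)               ≡⟨ V-at (suc n) k₀≤x′ (<⇒≤ x′<) ⟩
    shear (ρ ℤ.* + suc n) (base x′)  ≡⟨ shear-suc ρ n (base x′) ⟩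
    shear ρ (shear (ρ ℤ.* + n) (base x′)) ≡⟨ cong (shear ρ) (V-at n k₀≤x′ (<⇒≤ x′<)) ⟨
    shear ρ (V (x′ + n * N))         ∎
    where open ≡-Reasoning

  V-edge : ∀ {x y} → k₀ ≤ x → E x y → det (V x) (V y) ≡ 1ℤ
  V-edge k₀≤x e with reduce-edge k₀≤x e
  ... | n , x′ , y′ , k₀≤x′ , x′< , y′≤ , refl , refl , e′ =
    trans (cong₂ det (V-at n k₀≤x′ (<⇒≤ x′<)) (V-at n (≤-trans k₀≤x′ (<⇒≤ (E.lt e′))) y′≤))
      (trans (det-shear (ρ ℤ.* + n) (base x′) (base y′))
             (base-edge k₀≤x′ (E.lt e′) (≤-trans y′≤ (n≤1+n _)) (Base.finite y′≤ e′)))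

  V-positive : ∀ {x} → k₀ ≤ x → 0ℤ ℤ.< proj₂ (V x)
  V-positive k₀≤x with reduce k₀≤x
  ... | n , x′ , k₀≤x′ , x′< , refl =
    subst (λ w → 0ℤ ℤ.< proj₂ w) (sym (V-at n k₀≤x′ (<⇒≤ x′<))) (base-positive (<⇒≤ x′<))

  V-central : ∀ {x} → k₀ ≤ x → Cr x → proj₂ (V x) ≡ 1ℤ
  V-central k₀≤x c with reduce k₀≤x
  ... | n , x′ , k₀≤x′ , x′< , refl =
    trans (cong proj₂ (V-at n k₀≤x′ (<⇒≤ x′<))) (base-central k₀≤x′ (<⇒≤ x′<) (Cr-≋ (≋-+kN x′ n) c))

  -- Moved to the base sheet, the triangle belongs to `base-tree` by `complete`; additivity holds
  -- there and the shears are linear.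
  V-triangle : ∀ {x y z} → k₀ ≤ x → E x y → E y z → E x z → V y ≡ V x ⊞ V z
  V-triangle {y = y} k₀≤x exy eyz exz with reduce-edge k₀≤x exz
  ... | n , x′ , z′ , k₀≤x′ , x′< , z′≤ , refl , refl , exz′ = begin
    V y                                                ≡⟨ cong V (sym back) ⟩
    V (y′ + n * N)                                     ≡⟨ V-at n k₀≤y′ y′≤ ⟩
    shear (ρ ℤ.* + n) (base y′)                        ≡⟨ cong (shear (ρ ℤ.* + n)) (base-additive member) ⟩
    shear (ρ ℤ.* + n) (base x′ ⊞ base z′)              ≡⟨ shear-⊞ (ρ ℤ.* + n) (base x′) (base z′) ⟩
    shear (ρ ℤ.* + n) (base x′) ⊞ shear (ρ ℤ.* + n) (base z′)
      ≡⟨ cong₂ _⊞_ (V-at n k₀≤x′ (<⇒≤ x′<)) (V-at n (≤-trans k₀≤y′ (<⇒≤ (E.lt eyz′))) z′≤) ⟨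
    V (x′ + n * N) ⊞ V (z′ + n * N)                    ∎
    where
    open ≡-Reasoning
    y′ = y ∸ n * N
    back : y′ + n * N ≡ y
    back = m∸n+n≡m (≤-trans (m≤n+m (n * N) x′) (<⇒≤ (E.lt exy)))
    exy′ : E x′ y′
    exy′ = E-unshift n (subst (E (x′ + n * N)) (sym back) exy)
    eyz′ : E y′ z′
    eyz′ = E-unshift n (subst (λ v → E v (z′ + n * N)) (sym back) eyz)
    k₀≤y′ = ≤-trans k₀≤x′ (<⇒≤ (E.lt exy′))
    y′≤ = ≤-trans (<⇒≤ (E.lt eyz′)) z′≤
    member : (x′ , y′ , z′) ∈ regs base-tree
    member = Base.complete base-tree (proj₂ base-polygon) k₀≤x′ (E.lt exy′) (E.lt eyz′) (≤-trans z′≤ (n≤1+n _))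
               (Base.finite y′≤ exy′ , Base.finite z′≤ eyz′ , Base.finite z′≤ exz′)

  -- This is how `ρ` comes to count central arcs: each step from a central position to the next adds
  -- `e∞`, and a full turn takes one step for each central arc.
  V-ideal : ∀ {x y} → k₀ ≤ x → E x y → Cr x → Cr y → V y ≡ V x ⊞ e∞
  V-ideal k₀≤x e cx cy with reduce-edge k₀≤x e
  ... | n , x′ , y′ , k₀≤x′ , x′< , y′≤ , refl , refl , e′ = begin
    V (y′ + n * N)                                     ≡⟨ V-at n k₀≤y′ y′≤ ⟩
    shear (ρ ℤ.* + n) (base y′)                        ≡⟨ cong (shear (ρ ℤ.* + n)) (trans (base-additive member) (cong (base x′ ⊞_) base-∞)) ⟩
    shear (ρ ℤ.* + n) (base x′ ⊞ e∞)                   ≡⟨ shear-⊞ (ρ ℤ.* + n) (base x′) e∞ ⟩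
    shear (ρ ℤ.* + n) (base x′) ⊞ shear (ρ ℤ.* + n) e∞ ≡⟨ cong₂ _⊞_ (sym (V-at n k₀≤x′ (<⇒≤ x′<))) (shear-e∞ (ρ ℤ.* + n)) ⟩
    V (x′ + n * N) ⊞ e∞                                ∎
    where
    open ≡-Reasoning
    k₀≤y′ = ≤-trans k₀≤x′ (<⇒≤ (E.lt e′))
    member : (x′ , y′ , suc (k₀ + N)) ∈ regs base-tree
    member = Base.complete base-tree (proj₂ base-polygon) k₀≤x′ (E.lt e′) (s≤s y′≤) ≤-refl
               (Base.finite y′≤ e′ , Base.ideal y′≤ (Cr-≋ (≋-+kN y′ n) cy) , Base.ideal (<⇒≤ x′<) (Cr-≋ (≋-+kN x′ n) cx))

  -- The list of triangles and its lifts.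

  open Numbers N inT public

  edge⇒E : ∀ {x} d → suc d ≤ N → edge x (suc d) ≡ true → E x (x + suc d)
  edge⇒E {x} zero    le e = mkE (m<m+n x (s≤s z≤n)) (+-monoʳ-≤ x le) (inj₁ (+-comm x 1))
  edge⇒E {x} (suc d) le e = mkE (m<m+n x (s≤s z≤n)) (+-monoʳ-≤ x le) (inj₂ e)

  E⇒edge : ∀ {x} d → E x (x + suc d) → edge x (suc d) ≡ true
  E⇒edge         zero    _                = refl
  E⇒edge {x}     (suc d) (mkE _ _ (inj₁ e)) with +-cancelˡ-≡ x (suc (suc d)) 1 (trans e (+-comm 1 x))
  ... | ()
  E⇒edge         (suc d) (mkE _ _ (inj₂ e)) = e

  IsTri : Tri N → Set
  IsTri (fT x y z) = E x y × E y z × E x z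
  IsTri (iT x y)   = Cr x × Cr y × E x y

  start : Tri N → ℕ
  start (fT x y z) = x
  start (iT x y)   = x

  private
    finTri : ℕ → ℕ → ℕ → List (Tri N)
    finTri a p q = if edge a (suc p) ∧ edge (a + suc p) (q ∸ suc p) ∧ edge a q
                   then fT a (a + suc p) (a + q) ∷ [] else []

    qs : ℕ → List ℕ
    qs p = map (λ e → suc p + suc e) (upTo (N ∸ suc p))

    idTri : ℕ → ℕ → List (Tri N)
    idTri a p = if inT (C ⟦ a ⟧) ∧ inT (C ⟦ a + p ⟧) ∧ edge a p then iT a (a + p) ∷ [] else []

  ∈-finTris⁻ : ∀ {t} → t ∈ finTris → start t < N × IsTri t
  ∈-finTris⁻ m with ∈-concatMap⁻′ (λ a → concatMap (λ p → concatMap (finTri a p) (qs p)) (upTo (N ∸ 1))) (upTo N) m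
  ... | a , a∈ , m₁ with ∈-concatMap⁻′ (λ p → concatMap (finTri a p) (qs p)) (upTo (N ∸ 1)) m₁
  ... | p , p∈ , m₂ with ∈-concatMap⁻′ (finTri a p) (qs p) m₂
  ... | q , q∈ , m₃ with ∈-map⁻ (λ e → suc p + suc e) q∈
  ... | e , e∈ , refl
    with edge a (suc p) in e₁ | edge (a + suc p) (p + suc e ∸ p) in e₂ | edge a (suc p + suc e) in e₃
  ∈-finTris⁻ m | a , a∈ , m₁ | p , p∈ , m₂ | q , q∈ , here refl | e , e∈ , refl | true | true | true =
    ∈-upTo⁻ a∈ ,
    edge⇒E p (≤-trans (m≤m+n (suc p) (suc e)) bound) e₁ ,
    subst (E (a + suc p)) (+-assoc a (suc p) (suc e))
      (edge⇒E e (≤-trans (m≤n+m (suc e) (suc p)) bound) (trans (cong (edge (a + suc p)) (sym (m+n∸m≡n p (suc e)))) e₂)) ,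
    edge⇒E (p + suc e) bound e₃
    where
    bound : suc p + suc e ≤ N
    bound = subst (_≤ N) (+-comm (suc e) (suc p)) (m≤o∸n⇒m+n≤o (suc e) (≤-trans (∈-upTo⁻ p∈) (m∸n≤m N 1)) (∈-upTo⁻ e∈))

  ∈-finTris⁺ : ∀ {x y z} → x < N → IsTri (fT x y z) → fT x y z ∈ finTris
  ∈-finTris⁺ {x} {y} {z} x<N (exy , eyz , exz) with gap (E.lt exy) | gap (E.lt eyz)
  ... | p , refl | e , refl =
    ∈-concatMap⁺′ (λ a → concatMap (λ p → concatMap (finTri a p) (qs p)) (upTo (N ∸ 1))) (∈-upTo⁺ x<N)
      (∈-concatMap⁺′ (λ p → concatMap (finTri x p) (qs p)) (∈-upTo⁺ (m+n≤o⇒m≤o∸n (suc p) (≤-trans (+-monoʳ-≤ (suc p) (s≤s z≤n)) bound)))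
        (∈-concatMap⁺′ (finTri x p) (∈-map⁺ (λ e → suc p + suc e) (∈-upTo⁺ (m+n≤o⇒m≤o∸n (suc e) (subst (_≤ N) (+-comm (suc p) (suc e)) bound))))
          (subst (λ v → fT x (x + suc p) v ∈ finTri x p (suc p + suc e)) (sym assoc) (∈-if⁺ edges))))
    where
    assoc : x + suc p + suc e ≡ x + (suc p + suc e)
    assoc = +-assoc x (suc p) (suc e)
    bound : suc p + suc e ≤ N
    bound = +-cancelˡ-≤ x _ N (subst (_≤ x + N) assoc (E.le exz))
    edges : edge x (suc p) ∧ edge (x + suc p) (suc p + suc e ∸ suc p) ∧ edge x (suc p + suc e) ≡ true
    edges rewrite E⇒edge p exy | m+n∸m≡n p (suc e) | E⇒edge e eyz | E⇒edge (p + suc e) (subst (E x) assoc exz) = refl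

  ∈-idTris⁻ : ∀ {t} → t ∈ idTris → start t < N × IsTri t
  ∈-idTris⁻ m with ∈-concatMap⁻′ (λ a → concatMap (idTri a) (map suc (upTo N))) (upTo N) m
  ... | a , a∈ , m₁ with ∈-concatMap⁻′ (idTri a) (map suc (upTo N)) m₁
  ... | q , q∈ , m₂ with ∈-map⁻ suc q∈
  ... | p , p∈ , refl
    with inT (C ⟦ a ⟧) in e₁ | inT (C ⟦ a + suc p ⟧) in e₂ | edge a (suc p) in e₃
  ∈-idTris⁻ m | a , a∈ , m₁ | q , q∈ , here refl | p , p∈ , refl | true | true | true =
    ∈-upTo⁻ a∈ , e₁ , e₂ , edge⇒E p (∈-upTo⁻ p∈) e₃

  ∈-idTris⁺ : ∀ {x y} → x < N → IsTri (iT x y) → iT x y ∈ idTris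
  ∈-idTris⁺ {x} x<N (cx , cy , e) with gap (E.lt e)
  ... | p , refl =
    ∈-concatMap⁺′ (λ a → concatMap (idTri a) (map suc (upTo N))) (∈-upTo⁺ x<N)
      (∈-concatMap⁺′ (idTri x) (∈-map⁺ suc (∈-upTo⁺ (+-cancelˡ-≤ x _ N (E.le e)))) (∈-if⁺ edges))
    where
    edges : inT (C ⟦ x ⟧) ∧ inT (C ⟦ x + suc p ⟧) ∧ edge x (suc p) ≡ true
    edges rewrite cx | cy | E⇒edge p e = refl

  ∈-triangles⁻ : ∀ {t} → t ∈ triangles → start t < N × IsTri t
  ∈-triangles⁻ m with ∈-++⁻ finTris m
  ... | inj₁ m′ = ∈-finTris⁻ m′
  ... | inj₂ m′ = ∈-idTris⁻ m′

  ∈-triangles⁺ : ∀ t → start t < N → IsTri t → t ∈ triangles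
  ∈-triangles⁺ (fT x y z) l h = ∈-++⁺ˡ (∈-finTris⁺ l h)
  ∈-triangles⁺ (iT x y)   l h = ∈-++⁺ʳ finTris (∈-idTris⁺ l h)

  private
    last : Tri N → ℕ
    last (fT x y z) = z
    last (iT x y)   = y
    middle : Tri N → ℕ
    middle (fT x y z) = y
    middle (iT x y)   = x
    isFinite : Tri N → Bool
    isFinite (fT _ _ _) = true
    isFinite (iT _ _)   = false

    finTri-shape : ∀ {a p q t} → t ∈ finTri a p q → t ≡ fT a (a + suc p) (a + q)
    finTri-shape {a} {p} {q} m = proj₂ (∈-if⁻ (edge a (suc p) ∧ edge (a + suc p) (q ∸ suc p) ∧ edge a q) m)

    finTri-shape₂ : ∀ {a p t} → t ∈ concatMap (finTri a p) (qs p) → middle t ≡ a + suc p × start t ≡ a × isFinite t ≡ true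
    finTri-shape₂ {a} {p} m with ∈-concatMap⁻′ (finTri a p) (qs p) m
    ... | q , _ , m′ rewrite finTri-shape {a} {p} {q} m′ = refl , refl , refl

    finTri-shape₃ : ∀ {a t} → t ∈ concatMap (λ p → concatMap (finTri a p) (qs p)) (upTo (N ∸ 1)) → start t ≡ a × isFinite t ≡ true
    finTri-shape₃ {a} m with ∈-concatMap⁻′ (λ p → concatMap (finTri a p) (qs p)) (upTo (N ∸ 1)) m
    ... | p , _ , m′ = proj₂ (finTri-shape₂ {a} {p} m′)

    idTri-shape : ∀ {a p t} → t ∈ idTri a p → t ≡ iT a (a + p)
    idTri-shape {a} {p} m = proj₂ (∈-if⁻ (inT (C ⟦ a ⟧) ∧ inT (C ⟦ a + p ⟧) ∧ edge a p) m)

    idTri-shape₂ : ∀ {a t} → t ∈ concatMap (idTri a) (map suc (upTo N)) → start t ≡ a × isFinite t ≡ false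
    idTri-shape₂ {a} m with ∈-concatMap⁻′ (idTri a) (map suc (upTo N)) m
    ... | p , _ , m′ rewrite idTri-shape {a} {p} m′ = refl , refl

    finite-finTris : ∀ {t} → t ∈ finTris → isFinite t ≡ true
    finite-finTris m with ∈-concatMap⁻′ (λ a → concatMap (λ p → concatMap (finTri a p) (qs p)) (upTo (N ∸ 1))) (upTo N) m
    ... | a , _ , m′ = proj₂ (finTri-shape₃ {a} m′)

    infinite-idTris : ∀ {t} → t ∈ idTris → isFinite t ≡ false
    infinite-idTris m with ∈-concatMap⁻′ (λ a → concatMap (idTri a) (map suc (upTo N))) (upTo N) m
    ... | a , _ , m′ = proj₂ (idTri-shape₂ {a} m′)

  unique-triangles : Unique triangles
  unique-triangles = Unique.++⁺
    (unique-concatMap (upTo N) (Unique.upTo⁺ N)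
      (λ a → unique-concatMap (upTo (N ∸ 1)) (Unique.upTo⁺ (N ∸ 1))
        (λ p → unique-concatMap (qs p) (Unique.map⁺ (λ e → suc-injective (+-cancelˡ-≡ (suc p) _ _ e)) (Unique.upTo⁺ (N ∸ suc p)))
          (λ q → unique-if (edge a (suc p) ∧ edge (a + suc p) (q ∸ suc p) ∧ edge a q))
          (λ {q} {q′} m m′ → +-cancelˡ-≡ a q q′ (cong last (trans (sym (finTri-shape {a} {p} {q} m)) (finTri-shape {a} {p} {q′} m′)))))
        (λ {p} {p′} m m′ → suc-injective (+-cancelˡ-≡ a _ _ (trans (sym (proj₁ (finTri-shape₂ {a} {p} m))) (proj₁ (finTri-shape₂ {a} {p′} m′))))))
      (λ {a} {a′} m m′ → trans (sym (proj₁ (finTri-shape₃ {a} m))) (proj₁ (finTri-shape₃ {a′} m′))))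
    (unique-concatMap (upTo N) (Unique.upTo⁺ N)
      (λ a → unique-concatMap (map suc (upTo N)) (Unique.map⁺ suc-injective (Unique.upTo⁺ N))
        (λ p → unique-if (inT (C ⟦ a ⟧) ∧ inT (C ⟦ a + p ⟧) ∧ edge a p))
        (λ {p} {p′} m m′ → +-cancelˡ-≡ a p p′ (cong last (trans (sym (idTri-shape {a} {p} m)) (idTri-shape {a} {p′} m′)))))
      (λ {a} {a′} m m′ → trans (sym (proj₁ (idTri-shape₂ {a} m))) (proj₁ (idTri-shape₂ {a′} m′))))
    (λ (m , m′) → case-⊥ (trans (sym (finite-finTris m)) (infinite-idTris m′)))
    where
    case-⊥ : true ≡ false → ⊥
    case-⊥ ()

  start-shift : ∀ k t → start (shiftT N k t) ≡ start t + k * N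
  start-shift k (fT x y z) = refl
  start-shift k (iT x y)   = refl

  shift-injective : ∀ k t t′ → shiftT N k t ≡ shiftT N k t′ → t ≡ t′
  shift-injective k (fT x y z) (fT x′ y′ z′) e
    with +-cancelʳ-≡ (k * N) x x′ (cong start e) | +-cancelʳ-≡ (k * N) y y′ (cong middle e) | +-cancelʳ-≡ (k * N) z z′ (cong last e)
  ... | refl | refl | refl = refl
  shift-injective k (iT x y) (iT x′ y′) e
    with +-cancelʳ-≡ (k * N) x x′ (cong start e) | +-cancelʳ-≡ (k * N) y y′ (cong last e)
  ... | refl | refl = refl

  IsTri-shift : ∀ k t → IsTri t → IsTri (shiftT N k t)
  IsTri-shift k (fT x y z) (a , b , c) = E-shift k a , E-shift k b , E-shift k c
  IsTri-shift k (iT x y)   (a , b , c) = Cr-≋ (sym (≋-+kN x k)) a , Cr-≋ (sym (≋-+kN y k)) b , E-shift k c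

  unshift : ∀ k t → k * N ≤ start t → IsTri t → ∃ λ t′ → t ≡ shiftT N k t′ × IsTri t′
  unshift k (fT x y z) kN≤x (a , b , c) =
    fT (x ∸ k * N) (y ∸ k * N) (z ∸ k * N) , sym (cong₃ (back kN≤x) (back kN≤y) (back kN≤z)) ,
    E-unshift k (subst₂ E (sym (back kN≤x)) (sym (back kN≤y)) a) ,
    E-unshift k (subst₂ E (sym (back kN≤y)) (sym (back kN≤z)) b) ,
    E-unshift k (subst₂ E (sym (back kN≤x)) (sym (back kN≤z)) c)
    where
    back : ∀ {v} → k * N ≤ v → v ∸ k * N + k * N ≡ v
    back = m∸n+n≡m
    kN≤y = ≤-trans kN≤x (<⇒≤ (E.lt a))
    kN≤z = ≤-trans kN≤x (<⇒≤ (E.lt c))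
    cong₃ : ∀ {x x′ y y′ z z′} → x ≡ x′ → y ≡ y′ → z ≡ z′ → fT {N} x y z ≡ fT x′ y′ z′
    cong₃ refl refl refl = refl
  unshift k (iT x y) kN≤x (a , b , c) =
    iT (x ∸ k * N) (y ∸ k * N) , sym (cong₂ iT (back kN≤x) (back kN≤y)) ,
    Cr-≋ (trans (cong (_% N) (sym (back kN≤x))) (≋-+kN (x ∸ k * N) k)) a ,
    Cr-≋ (trans (cong (_% N) (sym (back kN≤y))) (≋-+kN (y ∸ k * N) k)) b ,
    E-unshift k (subst₂ E (sym (back kN≤x)) (sym (back kN≤y)) c)
    where
    back : ∀ {v} → k * N ≤ v → v ∸ k * N + k * N ≡ v
    back = m∸n+n≡m
    kN≤y = ≤-trans kN≤x (<⇒≤ (E.lt c))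

  lifts : List (Tri N)
  lifts = concatMap (λ t → map (λ k → shiftT N k t) (upTo 3)) triangles

  ∈-lifts⁻ : ∀ {t} → t ∈ lifts → IsTri t
  ∈-lifts⁻ m with ∈-concatMap⁻′ (λ t → map (λ k → shiftT N k t) (upTo 3)) triangles m
  ... | t , t∈ , m′ with ∈-map⁻ (λ k → shiftT N k t) m′
  ... | k , _ , refl = IsTri-shift k t (proj₂ (∈-triangles⁻ t∈))

  -- Quotient and remainder of the start by `N` give the translation and the chosen lift; three
  -- translations reach exactly the starts below `3 * N`.
  ∈-lifts⁺ : ∀ t → start t < 3 * N → IsTri t → t ∈ lifts
  ∈-lifts⁺ t l h with unshift (start t / N) t (m/n*n≤m (start t) N) h
  ... | t′ , e , h′ = subst (_∈ lifts) (sym e)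
    (∈-concatMap⁺′ (λ t → map (λ k → shiftT N k t) (upTo 3)) (∈-triangles⁺ t′ start< h′)
      (∈-map⁺ (λ k → shiftT N k t′) (∈-upTo⁺ (m<n*o⇒m/o<n l))))
    where
    start≡ : start t′ ≡ start t % N
    start≡ = +-cancelʳ-≡ (start t / N * N) _ _
      (trans (sym (start-shift (start t / N) t′)) (trans (cong start (sym e)) (m≡m%n+[m/n]*n (start t) N)))
    start< : start t′ < N
    start< = subst (_< N) (sym start≡) (m%n<n (start t) N)

  unique-lifts : Unique lifts
  unique-lifts = go triangles unique-triangles (λ m → proj₁ (∈-triangles⁻ m))
    where
    same-shift : ∀ k k′ t t′ → start t < N → start t′ < N → shiftT N k t ≡ shiftT N k′ t′ → k ≡ k′
    same-shift k k′ t t′ l l′ e = trans (sym (quotient k t l)) (trans (cong (λ v → start v / N) e) (quotient k′ t′ l′))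
      where
      quotient : ∀ k t → start t < N → start (shiftT N k t) / N ≡ k
      quotient k t l = trans (cong (_/ N) (start-shift k t))
        (trans (+-distrib-/-∣ʳ (start t) (divides-refl k)) (cong₂ _+_ (m<n⇒m/n≡0 l) (m*n/n≡m k N)))
    go : ∀ ts → Unique ts → (∀ {t} → t ∈ ts → start t < N) → Unique (concatMap (λ t → map (λ k → shiftT N k t) (upTo 3)) ts)
    go []       u b = []
    go (t ∷ ts) (t∉ ∷ u) b = Unique.++⁺
      (Unique.map⁺ (λ {k} {k′} e → same-shift k k′ t t (b (here refl)) (b (here refl)) e) (Unique.upTo⁺ 3))
      (go ts u (λ m → b (there m)))
      disjoint
      where
      disjoint : ∀ {s} → ¬ (s ∈ map (λ k → shiftT N k t) (upTo 3) × s ∈ concatMap (λ t → map (λ k → shiftT N k t) (upTo 3)) ts)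
      disjoint (m , m′) with ∈-map⁻ (λ k → shiftT N k t) m | ∈-concatMap⁻′ (λ t → map (λ k → shiftT N k t) (upTo 3)) ts m′
      ... | k , _ , refl | t′ , t′∈ , m″ with ∈-map⁻ (λ k → shiftT N k t′) m″
      ... | k′ , _ , e with same-shift k k′ t t′ (b (here refl)) (b (there t′∈)) e
      ... | refl = All.lookup t∉ t′∈ (shift-injective k t t′ e)

  -- Counting in the polygon between two central rays.

  decode : ℕ → Triple → Tri N
  decode K (x , y , z) with z ≟ suc K
  ... | yes _ = iT x y
  ... | no  _ = fT x y z

  decode-injective : ∀ K {τ τ′} → decode K τ ≡ decode K τ′ → τ ≡ τ′
  decode-injective K {x , y , z} {x′ , y′ , z′} e with z ≟ suc K | z′ ≟ suc K
  decode-injective K refl | yes refl | yes refl = refl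
  decode-injective K ()   | yes _    | no _
  decode-injective K ()   | no _     | yes _
  decode-injective K refl | no _     | no _     = refl

  Between : ℕ → ℕ → Tri N → Set
  Between k K (fT x y z) = k ≤ x × z ≤ K
  Between k K (iT x y)   = k ≤ x × y ≤ K

  U : ℕ → ℕ → Vec²
  U K x with x ≤? K
  ... | yes _ = V x
  ... | no  _ = e∞

  U-≤ : ∀ {K x} → x ≤ K → U K x ≡ V x
  U-≤ {K} {x} x≤K with x ≤? K
  ... | yes _ = refl
  ... | no  n = ⊥-elim (n x≤K)

  U-∞ : ∀ K → U K (suc K) ≡ e∞
  U-∞ K with suc K ≤? K
  ... | yes p = ⊥-elim (<-irrefl refl p)
  ... | no  _ = refl

  inf : Tri N → ℕ
  inf (fT _ _ _) = 0
  inf (iT _ _)   = 1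

  module Count (k K : ℕ) (k₀≤k : k₀ ≤ k) (k≤K : k ≤ K) (ck : Cr k) (cK : Cr K) where
    open Window K cK

    abstract
      tree : Tree k (suc K)
      tree = proj₁ (polygon k≤K ck)

      tree-fine : Fine tree
      tree-fine = proj₂ (polygon k≤K ck)

    private
      E-of : ∀ {x y} → y ≤ K → G x y → E x y
      E-of y≤K (finite _ e) = e
      E-of y≤K (ideal _ _)  = ⊥-elim (<-irrefl refl y≤K)

      Cr-of : ∀ {x} → G x (suc K) → Cr x
      Cr-of (finite l _) = ⊥-elim (<-irrefl refl l)
      Cr-of (ideal _ c)  = c

    decode-tri : ∀ {τ} → τ ∈ regs tree → IsTri (decode K τ) × Between k K (decode K τ)
    decode-tri {x , y , z} m with regs-bounds tree m | tree-fine m | z ≟ suc K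
    ... | k≤x , x<y , y<z , z≤ | gxy , gyz , gxz | yes refl =
      (Cr-of gxz , Cr-of gyz , E-of (≤-pred y<z) gxy) , k≤x , ≤-pred y<z
    ... | k≤x , x<y , y<z , z≤ | gxy , gyz , gxz | no z≢ =
      (E-of (≤-trans (<⇒≤ y<z) z≤K) gxy , E-of z≤K gyz , E-of z≤K gxz) , k≤x , z≤K
      where
      z≤K : z ≤ K
      z≤K = ≤-pred (≤∧≢⇒< z≤ z≢)

    window : List (Tri N)
    window = map (decode K) (regs tree)

    unique-window : Unique window
    unique-window = Unique.map⁺ (decode-injective K) (Unique-regs tree)

    ∈-window⁻ : ∀ {t} → t ∈ window → IsTri t × Between k K t
    ∈-window⁻ m with ∈-map⁻ (decode K) m
    ... | τ , τ∈ , refl = decode-tri τ∈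

    ∈-window⁺ : ∀ t → IsTri t → Between k K t → t ∈ window
    ∈-window⁺ (fT x y z) (exy , eyz , exz) (k≤x , z≤K) =
      subst (_∈ window) eq (∈-map⁺ (decode K) (complete tree tree-fine k≤x (E.lt exy) (E.lt eyz) (≤-trans z≤K (n≤1+n K))
        (finite (≤-trans (<⇒≤ (E.lt eyz)) z≤K) exy , finite z≤K eyz , finite z≤K exz)))
      where
      eq : decode K (x , y , z) ≡ fT x y z
      eq with z ≟ suc K
      ... | yes refl = ⊥-elim (<-irrefl refl z≤K)
      ... | no  _    = refl
    ∈-window⁺ (iT x y) (cx , cy , e) (k≤x , y≤K) =
      subst (_∈ window) eq (∈-map⁺ (decode K) (complete tree tree-fine k≤x (E.lt e) (s≤s y≤K) ≤-refl
        (finite y≤K e , ideal y≤K cy , ideal (≤-trans (<⇒≤ (E.lt e)) y≤K) cx)))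
      where
      eq : decode K (x , y , suc K) ≡ iT x y
      eq with suc K ≟ suc K
      ... | yes _ = refl
      ... | no  n = ⊥-elim (n refl)

    wt-decode : ∀ {v} τ → v ≤ K → mult v (finVerts N (decode K τ)) ≡ wt v τ
    wt-decode {v} (x , y , z) v≤K with z ≟ suc K
    ... | yes refl = cong (λ n → δ v x + (δ v y + n)) (sym (δ-≢ (<⇒≢ (s≤s v≤K))))
    ... | no  _    = cong (λ n → δ v x + (δ v y + n)) (+-identityʳ (δ v z))

    wt-decode-∞ : ∀ {τ} → τ ∈ regs tree → inf (decode K τ) ≡ wt (suc K) τ
    wt-decode-∞ {x , y , z} m with regs-bounds tree m | z ≟ suc K
    ... | _ , x<y , y<z , z≤ | yes refl =
      sym (cong₂ _+_ (δ-≢ (>⇒≢ (<-trans x<y y<z))) (cong₂ _+_ (δ-≢ (>⇒≢ y<z)) (δ-refl z)))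
    ... | _ , x<y , y<z , z≤ | no z≢ = sym (wt-0 (>⇒≢ (<-trans x<y (<-≤-trans y<z z≤))) (>⇒≢ (<-≤-trans y<z z≤)) (λ e → z≢ (sym e)))

    additive : Additive (U K) tree
    additive {x} {y} {z} m with regs-bounds tree m | tree-fine m
    ... | k≤x , x<y , y<z , z≤ | gxy , finite z≤K eyz , gxz =
      trans (U-≤ y≤K) (trans (V-triangle (≤-trans k₀≤k k≤x) (E-of y≤K gxy) eyz (E-of z≤K gxz))
        (sym (cong₂ _⊞_ (U-≤ (≤-trans (<⇒≤ x<y) y≤K)) (U-≤ z≤K))))
      where y≤K = ≤-trans (<⇒≤ y<z) z≤K
    ... | k≤x , x<y , y<z , z≤ | gxy , ideal y≤K cy , gxz =
      trans (U-≤ y≤K) (trans (V-ideal (≤-trans k₀≤k k≤x) (E-of y≤K gxy) (Cr-of gxz) cy)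
        (sym (cong₂ _⊞_ (U-≤ (≤-trans (<⇒≤ x<y) y≤K)) (U-∞ K))))

    unimodular : det (U K k) (U K (suc K)) ≡ 1ℤ
    unimodular = trans (cong₂ det (U-≤ k≤K) (U-∞ K)) (trans (det-e∞ (V k)) (V-central k₀≤k ck))

    -- Passage from the lists of regions in the definitions to a tree. The list `ts` and the window
    -- must share only the triangles incident, according to `f`, with a point to be matched; the
    -- others are zero columns.
    count : ∀ (f : ℕ → Tri N → ℕ) {pts ts} sel a b → Unique ts → pts ↭ points sel tree a b →
            (∀ {v τ} → v ∈ pts → τ ∈ regs tree → f v (decode K τ) ≡ wt v τ) →
            (∀ {v t} → v ∈ pts → f v t ≢ 0 → t ∈ ts → t ∈ window) →
            (∀ {v t} → v ∈ pts → f v t ≢ 0 → t ∈ window → t ∈ ts) →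
            + perm (map f pts) ts ≡ W sel tree a b
    count f {pts} {ts} sel a b u p e to from = trans (cong +_ steps) (perm-points sel tree a b)
      where
      row : ∀ {g} → g ∈ map f pts → ∃ λ v → v ∈ pts × g ≡ f v
      row = ∈-map⁻ f
      steps : perm (map f pts) ts ≡ perm (map wt (points sel tree a b)) (regs tree)
      steps = begin
        perm (map f pts) ts
          ≡⟨ perm-support (map f pts) u unique-window
               (λ {g} {t} g∈ ne t∈ → let v , v∈ , eq = row g∈ in to v∈ (λ z → ne (trans (cong (λ h → h t) eq) z)) t∈)
               (λ {g} {t} g∈ ne t∈ → let v , v∈ , eq = row g∈ in from v∈ (λ z → ne (trans (cong (λ h → h t) eq) z)) t∈) ⟩
        perm (map f pts) window
          ≡⟨ perm-map (decode K) (map f pts) (regs tree) ⟩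
        perm (map (_∘ decode K) (map f pts)) (regs tree)
          ≡⟨ cong (λ fs → perm fs (regs tree)) (map-∘ pts) ⟨
        perm (map (λ v → f v ∘ decode K) pts) (regs tree)
          ≡⟨ perm-cong (regs tree) (map-agree _ wt pts e) ⟩
        perm (map wt pts) (regs tree)
          ≡⟨ perm-rows-↭ (Perm.map⁺ wt p) (regs tree) ⟩
        perm (map wt (points sel tree a b)) (regs tree) ∎
        where open ≡-Reasoning

  -- The longest finite side of the triangle spans all its finite corners, in particular v. Were it
  -- to leave the range, it would pass over k or K and cross the central ray there.
  IsTri-between : ∀ {k K v} t → Cr k → Cr K → IsTri t → v ∈ finVerts N t → k < v → v < K → Between k K t
  IsTri-between {k} {K} {v} t ck cK h m k<v v<K = go t h m
    where
    span : ∀ {x y} → E x y → x ≤ v → v ≤ y → k ≤ x × y ≤ K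
    span {x} {y} e x≤v v≤y with <-≤-connex x k | <-≤-connex K y
    ... | inj₁ x<k | _        = ⊥-elim (C-noncrossing x<k (<-≤-trans k<v v≤y) e ck)
    ... | inj₂ _   | inj₁ K<y = ⊥-elim (C-noncrossing (≤-<-trans x≤v v<K) K<y e cK)
    ... | inj₂ k≤x | inj₂ y≤K = k≤x , y≤K
    go : ∀ t → IsTri t → v ∈ finVerts N t → Between k K t
    go (fT x y z) (exy , eyz , exz) (here refl)                 = span exz ≤-refl (<⇒≤ (E.lt exz))
    go (fT x y z) (exy , eyz , exz) (there (here refl))         = span exz (<⇒≤ (E.lt exy)) (<⇒≤ (E.lt eyz))
    go (fT x y z) (exy , eyz , exz) (there (there (here refl))) = span exz (<⇒≤ (E.lt exz)) ≤-refl
    go (iT x y)   (cx , cy , e)     (here refl)                 = span e ≤-refl (<⇒≤ (E.lt e))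
    go (iT x y)   (cx , cy , e)     (there (here refl))         = span e (<⇒≤ (E.lt e)) ≤-refl

  start≤ : ∀ {v} t → IsTri t → v ∈ finVerts N t → start t ≤ v
  start≤ (fT x y z) h               (here refl)                 = ≤-refl
  start≤ (fT x y z) (exy , _ , _)   (there (here refl))         = <⇒≤ (E.lt exy)
  start≤ (fT x y z) (_ , _ , exz)   (there (there (here refl))) = <⇒≤ (E.lt exz)
  start≤ (iT x y)   h               (here refl)                 = ≤-refl
  start≤ (iT x y)   (_ , _ , e)     (there (here refl))         = <⇒≤ (E.lt e)

  Cr-k₀+ : ∀ n → Cr (k₀ + n * N)
  Cr-k₀+ n = Cr-≋ (sym (≋-+kN k₀ n)) Cr-k₀

  -- The truncated discs.

  inside : ℕ → ℕ → ℕ → Bool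
  inside x d v = (x <ᵇ v) ∧ (v <ᵇ x + d)

  inside⁺ : ∀ {x d v} → x < v → v < x + d → inside x d v ≡ true
  inside⁺ {x} {d} {v} a b = cong₂ _∧_ (Equivalence.to T-≡ (<⇒<ᵇ a)) (Equivalence.to T-≡ (<⇒<ᵇ b))

  inside⁻ : ∀ {x d v} → inside x d v ≡ true → x < v × v < x + d
  inside⁻ {x} {d} {v} e = <ᵇ⇒< x v (Equivalence.from T-≡ (∧-conicalˡ (x <ᵇ v) _ e)) ,
                          <ᵇ⇒< v (x + d) (Equivalence.from T-≡ (∧-conicalʳ (x <ᵇ v) _ e))

  outside : ∀ {x d v} → ¬ (x < v × v < x + d) → inside x d v ≡ false
  outside {x} {d} {v} n with inside x d v in e
  ... | false = refl
  ... | true  = ⊥-elim (n (inside⁻ {x} {d} {v} e))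

  -- Two pieces of one triangle in the truncated disc come from two different lifts, so counting
  -- lifts counts pieces. The ambient polygon runs over three turns from `k₀`, which contain the
  -- segment since it lies between `N` and `3 * N`; lifts with no corner strictly inside the segment
  -- are zero columns. What remains is `W-between`.
  truncation : ∀ i j → 0 < dist N i j →
               + mTrunc i j ≡ det (V (toℕ i + N)) (V (toℕ i + N + dist N i j))
  truncation i j 0<d = begin
    + mTrunc i j
      ≡⟨ cong +_ as-perm ⟩
    + perm (map f pts) lifts
      ≡⟨ count f sel false false unique-lifts pts↭ f-wt to from ⟩
    W sel tree false false
      ≡⟨ W-between sel (U K) tree additive unimodular (<⇒≤ k₀<x) (m<m+n x 0<d) (≤-trans y≤K (n≤1+n K))
           (λ v _ v≤x → outside (λ (x<v , _) → <-irrefl refl (<-≤-trans x<v (≤-pred v≤x))))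
           (λ v → inside⁺) (λ v y≤v _ → outside (λ (_ , v<y) → <-irrefl refl (<-≤-trans v<y y≤v))) ⟩
    det (U K x) (U K (x + d))
      ≡⟨ cong₂ det (U-≤ (≤-trans (m≤m+n x d) y≤K)) (U-≤ y≤K) ⟩
    det (V x) (V (x + d)) ∎
    where
    open ≡-Reasoning
    x = toℕ i + N
    d = dist N i j
    K = k₀ + 3 * N
    open Count k₀ K ≤-refl (m≤m+n k₀ _) Cr-k₀ (Cr-k₀+ 3)
    y<3N : x + d < 3 * N
    y<3N = subst (x + d <_) (sum3 N) (+-mono-<-≤ (+-monoˡ-< N (toℕ<n i)) (<⇒≤ (dist<N i j)))
      where
      sum3 : ∀ n → n + n + n ≡ 3 * n
      sum3 = solve-∀
    y≤K : x + d ≤ K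
    y≤K = ≤-trans (<⇒≤ y<3N) (m≤n+m (3 * N) k₀)
    k₀<x : k₀ < x
    k₀<x = <-≤-trans k₀<N (m≤n+m N (toℕ i))
    sel : ℕ → Bool
    sel = inside x d
    pts : List ℕ
    pts = map (λ e → x + suc e) (upTo (d ∸ 1))
    region : Tri N → List Pt
    region t = map fin (filterᵇ sel (finVerts N t))
    f : ℕ → Tri N → ℕ
    f v t = occ (fin v) (region t)
    f-mult : ∀ {v} t → sel v ≡ true → f v t ≡ mult v (finVerts N t)
    f-mult {v} t e = trans (occ-map-fin v (filterᵇ sel (finVerts N t))) (mult-filter sel v (finVerts N t) e)
    as-perm : mTrunc i j ≡ perm (map f pts) lifts
    as-perm = trans (cong₂ matchings (map-∘ (upTo (d ∸ 1)))
        (sym (map-concatMap region (λ t → map (λ k → shiftT N k t) (upTo 3)) triangles)))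
      (trans (matchings-perm (map fin pts) (map region lifts))
        (trans (perm-map region (map occ (map fin pts)) lifts)
          (cong (λ fs → perm fs lifts) (sym (trans (map-∘ pts) (map-∘ (map fin pts)))))))
    pts⁻ : ∀ {v} → v ∈ pts → x < v × v < x + d
    pts⁻ m with ∈-map⁻ (λ e → x + suc e) m
    ... | e , e∈ , refl = m<m+n x (s≤s z≤n) , +-monoʳ-< x (subst (suc e <_) (m+[n∸m]≡n 0<d) (s≤s (∈-upTo⁻ e∈)))
    pts⁺ : ∀ {v} → x < v → v < x + d → v ∈ pts
    pts⁺ x<v v<y with gap x<v
    ... | e , refl = ∈-map⁺ (λ e → x + suc e) (∈-upTo⁺ (m+n≤o⇒m≤o∸n (suc e) (subst (_≤ d) (+-comm 1 (suc e)) (+-cancelˡ-< x (suc e) d v<y))))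
    pts↭ : pts ↭ points sel tree false false
    pts↭ = unique-↭ (Unique.map⁺ (λ {a} {b} e → suc-injective (+-cancelˡ-≡ x _ _ e)) (Unique.upTo⁺ (d ∸ 1))) (Unique-ints sel tree)
      (λ m → let x<v , v<y = pts⁻ m in ∈-ints⁺ sel tree (<-trans k₀<x x<v) (<-≤-trans v<y (≤-trans y≤K (n≤1+n K))) (inside⁺ x<v v<y))
      (λ {v} m → let x<v , v<y = inside⁻ {x} {d} {v} (proj₂ (proj₂ (∈-ints⁻ sel tree m))) in pts⁺ x<v v<y)
    f-wt : ∀ {v τ} → v ∈ pts → τ ∈ regs tree → f v (decode K τ) ≡ wt v τ
    f-wt {v} {τ} m _ = let x<v , v<y = pts⁻ m in
      trans (f-mult (decode K τ) (inside⁺ x<v v<y)) (wt-decode τ (≤-trans (<⇒≤ v<y) y≤K))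
    corner : ∀ {v t} → v ∈ pts → f v t ≢ 0 → v ∈ finVerts N t
    corner {v} {t} m ne = let x<v , v<y = pts⁻ m in
      mult-∈ v (finVerts N t) (λ z → ne (trans (f-mult t (inside⁺ x<v v<y)) z))
    to : ∀ {v t} → v ∈ pts → f v t ≢ 0 → t ∈ lifts → t ∈ window
    to {v} {t} m ne t∈ = let x<v , v<y = pts⁻ m ; h = ∈-lifts⁻ t∈ in
      ∈-window⁺ t h (IsTri-between t Cr-k₀ (Cr-k₀+ 3) h (corner {v} {t} m ne) (<-trans k₀<x x<v) (<-≤-trans v<y y≤K))
    from : ∀ {v t} → v ∈ pts → f v t ≢ 0 → t ∈ window → t ∈ lifts
    from {v} {t} m ne t∈ = let _ , v<y = pts⁻ m ; h = proj₁ (∈-window⁻ t∈) in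
      ∈-lifts⁺ t (≤-<-trans (start≤ t h (corner {v} {t} m ne)) (<-trans v<y y<3N)) h

  -- The discs at the puncture.

  bounded : ℕ → ℕ → Tri N → Bool
  bounded k K t = allBelow N (λ v → (k ≤ᵇ v) ∧ (v ≤ᵇ K)) (finVerts N t)

  private
    within⁺ : ∀ {k K v} → k ≤ v → v ≤ K → (k ≤ᵇ v) ∧ (v ≤ᵇ K) ≡ true
    within⁺ a b = cong₂ _∧_ (Equivalence.to T-≡ (≤⇒≤ᵇ a)) (Equivalence.to T-≡ (≤⇒≤ᵇ b))

    within⁻ : ∀ {k K v} → (k ≤ᵇ v) ∧ (v ≤ᵇ K) ≡ true → k ≤ v × v ≤ K
    within⁻ {k} {K} {v} e = ≤ᵇ⇒≤ k v (Equivalence.from T-≡ (∧-conicalˡ (k ≤ᵇ v) _ e)) ,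
                            ≤ᵇ⇒≤ v K (Equivalence.from T-≡ (∧-conicalʳ (k ≤ᵇ v) _ e))

  bounded⁺ : ∀ {k K} t → IsTri t → Between k K t → bounded k K t ≡ true
  bounded⁺ {k} {K} (fT x y z) (exy , eyz , exz) (k≤x , z≤K)
    rewrite within⁺ {k} {K} {x} k≤x (≤-trans (<⇒≤ (E.lt exz)) z≤K)
          | within⁺ {k} {K} {y} (≤-trans k≤x (<⇒≤ (E.lt exy))) (≤-trans (<⇒≤ (E.lt eyz)) z≤K)
          | within⁺ {k} {K} {z} (≤-trans k≤x (<⇒≤ (E.lt exz))) z≤K = refl
  bounded⁺ {k} {K} (iT x y) (_ , _ , e) (k≤x , y≤K)
    rewrite within⁺ {k} {K} {x} k≤x (≤-trans (<⇒≤ (E.lt e)) y≤K)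
          | within⁺ {k} {K} {y} (≤-trans k≤x (<⇒≤ (E.lt e))) y≤K = refl

  bounded⁻ : ∀ {k K} t → bounded k K t ≡ true → Between k K t
  bounded⁻ {k} {K} (fT x y z) e =
    let b  = λ v → (k ≤ᵇ v) ∧ (v ≤ᵇ K)
        e₂ = ∧-conicalʳ (b x) _ e
        e₃ = ∧-conicalʳ (b y) _ e₂
    in proj₁ (within⁻ {k} {K} {x} (∧-conicalˡ (b x) _ e)) , proj₂ (within⁻ {k} {K} {z} (∧-conicalˡ (b z) _ e₃))
  bounded⁻ {k} {K} (iT x y) e =
    let b  = λ v → (k ≤ᵇ v) ∧ (v ≤ᵇ K)
        e₂ = ∧-conicalʳ (b x) _ e
    in proj₁ (within⁻ {k} {K} {x} (∧-conicalˡ (b x) _ e)) , proj₂ (within⁻ {k} {K} {y} (∧-conicalˡ (b y) _ e₂))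

  occ-corners : ∀ v t → occ (fin v) (corners N t) ≡ mult v (finVerts N t)
  occ-corners v (fT x y z) = occ-map-fin v (x ∷ y ∷ z ∷ [])
  occ-corners v (iT x y)   = trans (occ-∷ (fin v) (fin x) _) (cong (λ n → δ v x + n) (trans (occ-∷ (fin v) (fin y) _) refl))

  -- `mCentral` with the two bounding rays and the omitted position as parameters, so that both
  -- choices of the omitted copy of the vertex are instances.
  centralMatchings : ℕ → ℕ → ℕ → ℕ
  centralMatchings k K r =
    matchings (map fin (filterᵇ (λ v → not (v ≡ᵇ r)) (map (λ n → k + n) (upTo (suc (K ∸ k))))))
              (concatMap (λ t → concatMap (λ n →
                 if bounded k K (shiftT N n t) then corners N (shiftT N n t) ∷ [] else []) (upTo 3)) triangles)

  module Fan {k K r : ℕ} (k₀≤k : k₀ ≤ k) (k<K : k < K) (K≤3N : K ≤ 3 * N) (ck : Cr k) (cK : Cr K) (k≤r : k ≤ r) (r≤K : r ≤ K) where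
    open Count k K k₀≤k (<⇒≤ k<K) ck cK public

    pts : List ℕ
    pts = filterᵇ (λ v → not (v ≡ᵇ r)) (map (λ n → k + n) (upTo (suc (K ∸ k))))

    unique-pts : Unique pts
    unique-pts = Unique.filter⁺ (T? ∘ (λ v → not (v ≡ᵇ r))) (Unique.map⁺ (λ {a} {b} e → +-cancelˡ-≡ k a b e) (Unique.upTo⁺ _))

    pts⁻ : ∀ {v} → v ∈ pts → k ≤ v × v ≤ K × v ≢ r
    pts⁻ {v} m with ∈-filterᵇ⁻ (λ v → not (v ≡ᵇ r)) {map (λ n → k + n) (upTo (suc (K ∸ k)))} m
    ... | v∈ , e with ∈-map⁻ (λ n → k + n) v∈
    ... | n , n∈ , refl = m≤m+n k n , subst (k + n ≤_) (m+[n∸m]≡n (<⇒≤ k<K)) (+-monoʳ-≤ k (≤-pred (∈-upTo⁻ n∈))) , not-≡ᵇ⁻ {k + n} {r} e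

    pts⁺ : ∀ {v} → k ≤ v → v ≤ K → v ≢ r → v ∈ pts
    pts⁺ {v} k≤v v≤K ne = ∈-filterᵇ⁺ (λ v → not (v ≡ᵇ r))
      (subst (_∈ map (λ n → k + n) (upTo (suc (K ∸ k)))) (m+[n∸m]≡n k≤v) (∈-map⁺ (λ n → k + n) (∈-upTo⁺ (s≤s (∸-monoˡ-≤ k v≤K)))))
      (not-≡ᵇ⁺ ne)

    inside-lifts : List (Tri N)
    inside-lifts = filterᵇ (bounded k K) lifts

    f : ℕ → Tri N → ℕ
    f v t = occ (fin v) (corners N t)

    as-perm : centralMatchings k K r ≡ perm (map f pts) inside-lifts
    as-perm = trans (cong (matchings (map fin pts)) regions)
      (trans (matchings-perm (map fin pts) (map (corners N) inside-lifts))
        (trans (perm-map (corners N) (map occ (map fin pts)) inside-lifts)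
          (cong (λ fs → perm fs inside-lifts) (sym (trans (map-∘ pts) (map-∘ (map fin pts)))))))
      where
      regions : concatMap (λ t → concatMap (λ n →
                  if bounded k K (shiftT N n t) then corners N (shiftT N n t) ∷ [] else []) (upTo 3)) triangles
                ≡ map (corners N) inside-lifts
      regions = trans (sym (concatMap-concatMap (λ t → if bounded k K t then corners N t ∷ [] else [])
                              (λ t → map (λ n → shiftT N n t) (upTo 3)) triangles))
                      (concatMap-if (bounded k K) (corners N) lifts)

    counted : ∀ sel a b → pts ↭ points sel tree a b → + perm (map f pts) inside-lifts ≡ W sel tree a b
    counted sel a b p = count f sel a b (Unique.filter⁺ (T? ∘ bounded k K) unique-lifts) p
      (λ {v} {τ} m _ → trans (occ-corners v (decode K τ)) (wt-decode τ (proj₁ (proj₂ (pts⁻ m)))))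
      (λ {v} {t} _ _ t∈ → let t∈′ , e = ∈-filterᵇ⁻ (bounded k K) {lifts} t∈ in ∈-window⁺ t (∈-lifts⁻ t∈′) (bounded⁻ t e))
      (λ {v} {t} m ne t∈ → let h , b = ∈-window⁻ t∈ in
        ∈-filterᵇ⁺ (bounded k K) (∈-lifts⁺ t (<-≤-trans (start< t h b) K≤3N) h) (bounded⁺ t h b))
      where
      start< : ∀ t → IsTri t → Between k K t → start t < K
      start< (fT x y z) (_ , _ , e) (_ , z≤K) = <-≤-trans (E.lt e) z≤K
      start< (iT x y)   (_ , _ , e) (_ , y≤K) = <-≤-trans (E.lt e) y≤K

  -- The vertices left out are r and the puncture, which is the last vertex of the polygon, and det
  -- (u , e∞) is the second coordinate of u. For r = k the interior is saturated, and the value 1 is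
  -- the second coordinate at a central position.
  centralMatchings-value : ∀ {k K r} → k₀ ≤ k → k < K → K ≤ 3 * N → Cr k → Cr K → k ≤ r → r ≤ K →
                           + centralMatchings k K r ≡ proj₂ (V r)
  centralMatchings-value {k} {K} {r} k₀≤k k<K K≤3N ck cK k≤r r≤K with m≤n⇒m<n∨m≡n k≤r
  ... | inj₂ refl = trans (trans (cong +_ as-perm) (counted sel false false pts↭))
                      (trans (Saturated.ff (W-on sel tree (λ _ _ _ → refl))) (sym (V-central k₀≤k ck)))
    where
    open Fan k₀≤k k<K K≤3N ck cK k≤r r≤K
    sel : ℕ → Bool
    sel _ = true
    pts↭ : pts ↭ points sel tree false false
    pts↭ = unique-↭ unique-pts (Unique-ints sel tree)
      (λ m → let k≤v , v≤K , v≢k = pts⁻ m in ∈-ints⁺ sel tree (≤∧≢⇒< k≤v (λ e → v≢k (sym e))) (s≤s v≤K) refl)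
      (λ m → let k<v , v<sK , _ = ∈-ints⁻ sel tree m in pts⁺ (<⇒≤ k<v) (≤-pred v<sK) (>⇒≢ k<v))
  ... | inj₁ k<r = trans (trans (cong +_ as-perm) (counted sel true false pts↭))
      (trans (Missing.tf (W-missing sel (U K) tree additive unimodular k<r (s≤s r≤K)
               (λ v _ v<r → not-≡ᵇ⁺ (<⇒≢ v<r)) (not-≡ᵇ-refl r) (λ v r<v _ → not-≡ᵇ⁺ (>⇒≢ r<v))))
        (trans (cong₂ det (U-≤ r≤K) (U-∞ K)) (det-e∞ (V r))))
    where
    open Fan k₀≤k k<K K≤3N ck cK k≤r r≤K
    sel : ℕ → Bool
    sel v = not (v ≡ᵇ r)
    pts↭ : pts ↭ points sel tree true false
    pts↭ = unique-↭ unique-pts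
      (All.tabulate (λ m → <⇒≢ (proj₁ (∈-ints⁻ sel tree m))) ∷ Unique-ints sel tree)
      to from
      where
      to : pts ⊆ k ∷ ints sel tree
      to m with pts⁻ m
      ... | k≤v , v≤K , v≢r with m≤n⇒m<n∨m≡n k≤v
      ...   | inj₂ refl = here refl
      ...   | inj₁ k<v  = there (∈-ints⁺ sel tree k<v (s≤s v≤K) (not-≡ᵇ⁺ v≢r))
      from : k ∷ ints sel tree ⊆ pts
      from (here refl) = pts⁺ ≤-refl (<⇒≤ k<K) (<⇒≢ k<r)
      from {v} (there m) = let k<v , v<sK , e = ∈-ints⁻ sel tree m in pts⁺ (<⇒≤ k<v) (≤-pred v<sK) (not-≡ᵇ⁻ {v} {r} e)

  firstWith-spec : ∀ (g : ℕ → Bool) {xs y} → AllPairs _<_ xs → y ∈ xs → g y ≡ true →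
                   firstWith g xs ∈ xs × g (firstWith g xs) ≡ true × firstWith g xs ≤ y
  firstWith-spec g {x ∷ xs} (lt ∷ s) y∈ gy with g x in e
  firstWith-spec g {x ∷ xs} (lt ∷ s) (here refl) gy | true = here refl , e , ≤-refl
  firstWith-spec g {x ∷ xs} (lt ∷ s) (there y∈)  gy | true = here refl , e , <⇒≤ (All.lookup lt y∈)
  firstWith-spec g {x ∷ xs} (lt ∷ s) (here refl) gy | false with trans (sym gy) e
  ... | ()
  firstWith-spec g {x ∷ xs} (lt ∷ s) (there y∈)  gy | false =
    let m , gm , le = firstWith-spec g s y∈ gy in there m , gm , le

  -- The translates of `k₀` that enclose the lift of i are at distances `t` < N to the left and
  -- `N ∸ t` to the right; they guarantee that both searches for a central arc succeed.
  central-value : ∀ i → + mCentral i ≡ proj₂ (V (toℕ i + N))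
  central-value i = go ((t₁ ≡ᵇ 0) ∧ (t₂ ≡ᵇ N)) refl
    where
    x = toℕ i + N
    k₀≤x : k₀ ≤ x
    k₀≤x = ≤-trans (<⇒≤ k₀<N) (m≤n+m N (toℕ i))
    n = (x ∸ k₀) / N
    t = (x ∸ k₀) % N
    t<N : t < N
    t<N = m%n<n (x ∸ k₀) N
    x≡ : x ≡ k₀ + n * N + t
    x≡ = trans (sym (m+[n∸m]≡n k₀≤x)) (trans (cong (λ v → k₀ + v) (trans (m≡m%n+[m/n]*n (x ∸ k₀) N) (+-comm t (n * N))))
           (sym (+-assoc k₀ (n * N) t)))
    x∸t≡ : x ∸ t ≡ k₀ + n * N
    x∸t≡ = trans (cong (_∸ t) x≡) (m+n∸n≡m (k₀ + n * N) t)
    x+≡ : x + (N ∸ t) ≡ k₀ + n * N + N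
    x+≡ = trans (cong (_+ (N ∸ t)) x≡) (trans (+-assoc (k₀ + n * N) t (N ∸ t)) (cong (λ v → k₀ + n * N + v) (m+[n∸m]≡n (<⇒≤ t<N))))
    t₁ = firstWith (λ t → inT (C ⟦ x ∸ t ⟧)) (upTo N)
    t₂ = firstWith (λ t → inT (C ⟦ x + t ⟧)) (map suc (upTo N))
    sorted : AllPairs _<_ (upTo N)
    sorted = AllPairs.applyUpTo⁺₁ id N (λ i<j _ → i<j)
    spec₁ : t₁ ∈ upTo N × Cr (x ∸ t₁) × t₁ ≤ t
    spec₁ = firstWith-spec (λ t → inT (C ⟦ x ∸ t ⟧)) sorted (∈-upTo⁺ t<N) (subst Cr (sym x∸t≡) (Cr-k₀+ n))
    suc-∈ : ∀ {v} → 0 < v → v ≤ N → v ∈ map suc (upTo N)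
    suc-∈ {suc v} _ v≤N = ∈-map⁺ suc (∈-upTo⁺ v≤N)
    spec₂ : t₂ ∈ map suc (upTo N) × Cr (x + t₂) × t₂ ≤ N ∸ t
    spec₂ = firstWith-spec (λ t → inT (C ⟦ x + t ⟧)) (AllPairs.map⁺ (AllPairs.applyUpTo⁺₁ id N (λ i<j _ → s≤s i<j)))
              (suc-∈ (m<n⇒0<n∸m t<N) (m∸n≤m N t)) (subst Cr (sym x+≡) (Cr-+N (Cr-k₀+ n)))
    0<t₂ : 0 < t₂
    0<t₂ with ∈-map⁻ suc (proj₁ spec₂)
    ... | v , _ , e = subst (0 <_) (sym e) (s≤s z≤n)
    t₂≤N : t₂ ≤ N
    t₂≤N = ≤-trans (proj₂ (proj₂ spec₂)) (m∸n≤m N t)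
    k₀≤k : k₀ ≤ x ∸ t₁
    k₀≤k = ≤-trans (subst (k₀ ≤_) (sym x∸t≡) (m≤m+n k₀ (n * N))) (∸-monoʳ-≤ x (proj₂ (proj₂ spec₁)))
    k≤x : x ∸ t₁ ≤ x
    k≤x = m∸n≤m x t₁
    K≤3N : x + t₂ ≤ 3 * N
    K≤3N = subst (x + t₂ ≤_) (sum3 N) (+-mono-≤ (+-monoˡ-≤ N (<⇒≤ (toℕ<n i))) t₂≤N)
      where
      sum3 : ∀ n → n + n + n ≡ 3 * n
      sum3 = solve-∀
    value : ∀ {r} → x ∸ t₁ ≤ r → r ≤ x + t₂ → + centralMatchings (x ∸ t₁) (x + t₂) r ≡ proj₂ (V r)
    value = centralMatchings-value k₀≤k (≤-<-trans k≤x (m<m+n x 0<t₂)) K≤3N (proj₁ (proj₂ spec₁)) (proj₁ (proj₂ spec₂))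
    go : ∀ b → (t₁ ≡ᵇ 0) ∧ (t₂ ≡ᵇ N) ≡ b → + centralMatchings (x ∸ t₁) (x + t₂) (if b then x + t₂ else x) ≡ proj₂ (V x)
    go false e = value k≤x (m≤m+n x t₂)
    -- For a single central arc at i itself the omitted copy lies one turn later; the shear does not
    -- change the second coordinate.
    go true  e = trans (value (≤-trans k≤x (m≤m+n x t₂)) ≤-refl)
      (trans (cong (λ s → proj₂ (V (x + s))) (≡ᵇ⇒≡ t₂ N (Equivalence.from T-≡ (∧-conicalʳ (t₁ ≡ᵇ 0) _ e))))
             (cong proj₂ (V-shift k₀≤x)))

  -- The loops around the puncture.

  vertex-bounds : ∀ {k K v} t → IsTri t → Between k K t → v ∈ finVerts N t → k ≤ v × v ≤ K
  vertex-bounds (fT x y z) (_ , _ , exz)     (k≤x , z≤K) (here refl)                 = k≤x , ≤-trans (<⇒≤ (E.lt exz)) z≤K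
  vertex-bounds (fT x y z) (exy , eyz , _)   (k≤x , z≤K) (there (here refl))         = ≤-trans k≤x (<⇒≤ (E.lt exy)) , ≤-trans (<⇒≤ (E.lt eyz)) z≤K
  vertex-bounds (fT x y z) (_ , _ , exz)     (k≤x , z≤K) (there (there (here refl))) = ≤-trans k≤x (<⇒≤ (E.lt exz)) , z≤K
  vertex-bounds (iT x y)   (_ , _ , e)       (k≤x , y≤K) (here refl)                 = k≤x , ≤-trans (<⇒≤ (E.lt e)) y≤K
  vertex-bounds (iT x y)   (_ , _ , e)       (k≤x , y≤K) (there (here refl))         = ≤-trans k≤x (<⇒≤ (E.lt e)) , y≤K

  occ-cornersS : ∀ v t → occ (fin v) (cornersS N t) ≡ mult v (map (_% N) (finVerts N t))
  occ-cornersS v (fT x y z) = occ-map-fin v (x % N ∷ y % N ∷ z % N ∷ [])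
  occ-cornersS v (iT x y)   = trans (occ-∷ (fin v) (fin (x % N)) _) (cong (λ n → δ v (x % N) + n) (occ-∷ (fin v) (fin (y % N)) _))

  occ-∞-cornersS : ∀ t → occ ∞ (cornersS N t) ≡ inf t
  occ-∞-cornersS (fT x y z) = refl
  occ-∞-cornersS (iT x y)   = refl

  cornersS-shift : ∀ k t → cornersS N (shiftT N k t) ≡ cornersS N t
  cornersS-shift k (fT x y z) rewrite ≋-+kN x k | ≋-+kN y k | ≋-+kN z k = refl
  cornersS-shift k (iT x y)   rewrite ≋-+kN x k | ≋-+kN y k = refl

  K₁ : ℕ
  K₁ = k₀ + N

  open Count k₀ K₁ ≤-refl (m≤m+n k₀ N) Cr-k₀ (Cr-+N Cr-k₀)

  -- The listed triangles start in 0, ..., N - 1, those of the polygon in k₀, ..., k₀ + N - 1; the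
  -- ones starting before `k₀` move up by one turn.
  lift : Tri N → Tri N
  lift t with start t <? k₀
  ... | yes _ = shiftT N 1 t
  ... | no  _ = t

  cornersS-lift : ∀ t → cornersS N (lift t) ≡ cornersS N t
  cornersS-lift t with start t <? k₀
  ... | yes _ = cornersS-shift 1 t
  ... | no  _ = refl

  private
    1*N : 1 * N ≡ N
    1*N = +-identityʳ N

    start-shift₁ : ∀ t → start (shiftT N 1 t) ≡ start t + N
    start-shift₁ t = trans (start-shift 1 t) (cong (λ n → start t + n) 1*N)

    ≋-injective : ∀ {u v} → k₀ < u → u < K₁ → k₀ ≤ v → v ≤ K₁ → u ≋ v → u ≡ v
    ≋-injective {u} {v} k<u u<K k≤v v≤K e with ≤-total u v
    ... | inj₁ u≤v = ≋-unique e u≤v (≤-<-trans v≤K (+-monoˡ-< N k<u))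
    ... | inj₂ v≤u = sym (≋-unique (sym e) v≤u (<-≤-trans u<K (+-monoˡ-≤ N k≤v)))

    from-start : ∀ t → IsTri t → k₀ ≤ start t → start t < K₁ → Between k₀ K₁ t
    from-start t h k≤ <K = go t h k≤ <K
      where
      end : ∀ {x y} → E x y → x < K₁ → y ≤ K₁
      end {x} {y} e x<K with <-≤-connex K₁ y
      ... | inj₂ y≤K = y≤K
      ... | inj₁ K<y = ⊥-elim (C-noncrossing x<K K<y e (Cr-+N Cr-k₀))
      go : ∀ t → IsTri t → k₀ ≤ start t → start t < K₁ → Between k₀ K₁ t
      go (fT x y z) (_ , _ , e) k≤ <K = k≤ , end e <K
      go (iT x y)   (_ , _ , e) k≤ <K = k≤ , end e <K

    to-start : ∀ t → IsTri t → Between k₀ K₁ t → k₀ ≤ start t × start t < K₁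
    to-start (fT x y z) (_ , _ , e) (k≤ , ≤K) = k≤ , <-≤-trans (E.lt e) ≤K
    to-start (iT x y)   (_ , _ , e) (k≤ , ≤K) = k≤ , <-≤-trans (E.lt e) ≤K

    lift-injective : ∀ {t t′} → t ∈ triangles → t′ ∈ triangles → lift t ≡ lift t′ → t ≡ t′
    lift-injective {t} {t′} m m′ e with start t <? k₀ | start t′ <? k₀
    ... | yes _ | yes _ = shift-injective 1 t t′ e
    ... | no  _ | no  _ = e
    ... | yes _ | no  _ = ⊥-elim (<-irrefl refl (<-≤-trans (proj₁ (∈-triangles⁻ m′))
                            (subst (N ≤_) (trans (sym (start-shift₁ t)) (cong start e)) (m≤n+m N (start t)))))
    ... | no  _ | yes _ = ⊥-elim (<-irrefl refl (<-≤-trans (proj₁ (∈-triangles⁻ m))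
                            (subst (N ≤_) (trans (sym (start-shift₁ t′)) (cong start (sym e))) (m≤n+m N (start t′)))))

    lift-⊆ : map lift triangles ⊆ window
    lift-⊆ m with ∈-map⁻ lift m
    ... | t , t∈ , refl with ∈-triangles⁻ t∈ | start t <? k₀
    ...   | s<N , h | yes s<k = ∈-window⁺ _ (IsTri-shift 1 t h) (from-start _ (IsTri-shift 1 t h)
              (subst (k₀ ≤_) (sym (start-shift₁ t)) (≤-trans (<⇒≤ k₀<N) (m≤n+m N (start t))))
              (subst (_< K₁) (sym (start-shift₁ t)) (+-monoˡ-< N s<k)))
    ...   | s<N , h | no s≮k = ∈-window⁺ t h (from-start t h (≮⇒≥ s≮k) (<-≤-trans s<N (m≤n+m N k₀)))

    lift-⊇ : window ⊆ map lift triangles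
    lift-⊇ {t} m with ∈-window⁻ m
    ... | h , b with to-start t h b
    ... | k≤s , s<K with <-≤-connex (start t) N
    ...   | inj₁ s<N = subst (_∈ map lift triangles) same (∈-map⁺ lift (∈-triangles⁺ t s<N h))
      where
      same : lift t ≡ t
      same with start t <? k₀
      ... | yes s<k = ⊥-elim (<-irrefl refl (<-≤-trans s<k k≤s))
      ... | no  _   = refl
    ...   | inj₂ N≤s with unshift 1 t (subst (_≤ start t) (sym 1*N) N≤s) h
    ...     | t′ , refl , h′ = subst (_∈ map lift triangles) same (∈-map⁺ lift (∈-triangles⁺ t′ (<-trans s′<k k₀<N) h′))
      where
      s′<k : start t′ < k₀
      s′<k = +-cancelʳ-< N (start t′) k₀ (subst (_< K₁) (start-shift₁ t′) s<K)
      same : lift t′ ≡ shiftT N 1 t′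
      same with start t′ <? k₀
      ... | yes _   = refl
      ... | no  s≮k = ⊥-elim (s≮k s′<k)

  -- A triangle that starts in the sheet stays in it, because its sides do not cross the central ray
  -- at `K₁`. So each triangle of the disc appears exactly once in the polygon.
  lift-↭ : map lift triangles ↭ window
  lift-↭ = unique-↭ (unique-map lift triangles unique-triangles lift-injective) unique-window lift-⊆ lift-⊇

  perm-cornersS : (fs : List (List Pt → ℕ)) →
                  perm fs (map (cornersS N) triangles) ≡ perm (map (_∘ (cornersS N ∘ decode K₁)) fs) (regs tree)
  perm-cornersS fs = begin
    perm fs (map (cornersS N) triangles)
      ≡⟨ cong (perm fs) (map-cong cornersS-lift triangles) ⟨
    perm fs (map (cornersS N ∘ lift) triangles)
      ≡⟨ cong (perm fs) (map-∘ triangles) ⟩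
    perm fs (map (cornersS N) (map lift triangles))
      ≡⟨ perm-↭ fs (Perm.map⁺ (cornersS N) lift-↭) ⟩
    perm fs (map (cornersS N) window)
      ≡⟨ cong (perm fs) (map-∘ (regs tree)) ⟨
    perm fs (map (cornersS N ∘ decode K₁) (regs tree))
      ≡⟨ perm-map (cornersS N ∘ decode K₁) fs (regs tree) ⟩
    perm (map (_∘ (cornersS N ∘ decode K₁)) fs) (regs tree) ∎
    where open ≡-Reasoning

  residueRow : ℕ → Triple → ℕ
  residueRow v τ = occ (fin v) (cornersS N (decode K₁ τ))

  punctureRow : Triple → ℕ
  punctureRow τ = occ ∞ (cornersS N (decode K₁ τ))

  punctureRow-wt : ∀ τ → τ ∈ regs tree → punctureRow τ ≡ wt (suc K₁) τ
  punctureRow-wt τ m = trans (occ-∞-cornersS (decode K₁ τ)) (wt-decode-∞ m)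

  private
    mult-map : ∀ {u} xs (g : ℕ → ℕ) → (∀ {a} → a ∈ xs → δ u (a % N) ≡ g a) →
               mult u (map (_% N) xs) ≡ sum (map g xs)
    mult-map []       g e = refl
    mult-map (x ∷ xs) g e = cong₂ _+_ (e (here refl)) (mult-map xs g (λ m → e (there m)))

    mult-sum : ∀ u xs → mult u xs ≡ sum (map (δ u) xs)
    mult-sum u []       = refl
    mult-sum u (x ∷ xs) = cong (λ n → δ u x + n) (mult-sum u xs)

    mult-sum₂ : ∀ u v xs → mult u xs + mult v xs ≡ sum (map (λ a → δ u a + δ v a) xs)
    mult-sum₂ u v []       = refl
    mult-sum₂ u v (x ∷ xs) = trans (rearrange (δ u x) (mult u xs) (δ v x) (mult v xs)) (cong (λ n → δ u x + δ v x + n) (mult-sum₂ u v xs))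
      where
      rearrange : ∀ a b c d → a + b + (c + d) ≡ a + c + (b + d)
      rearrange = solve-∀

    verts : ∀ {τ a} → τ ∈ regs tree → a ∈ finVerts N (decode K₁ τ) → k₀ ≤ a × a ≤ K₁
    verts {τ} m = let h , b = decode-tri m in vertex-bounds (decode K₁ τ) h b

  -- A vertex other than `k₀` has a single lift in the window, so its incidences in the disc and in
  -- the polygon are the same.
  residueRow-wt : ∀ {u} → k₀ < u → u < K₁ → ∀ {τ} → τ ∈ regs tree → residueRow (u % N) τ ≡ wt u τ
  residueRow-wt {u} k<u u<K {τ} m = begin
    residueRow (u % N) τ                                ≡⟨ occ-cornersS (u % N) (decode K₁ τ) ⟩
    mult (u % N) (map (_% N) (finVerts N (decode K₁ τ))) ≡⟨ mult-map (finVerts N (decode K₁ τ)) (δ u) (λ a∈ → let k≤a , a≤K = verts m a∈ in same k≤a a≤K) ⟩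
    sum (map (δ u) (finVerts N (decode K₁ τ)))          ≡⟨ mult-sum u (finVerts N (decode K₁ τ)) ⟨
    mult u (finVerts N (decode K₁ τ))                   ≡⟨ wt-decode τ (<⇒≤ u<K) ⟩
    wt u τ                                              ∎
    where
    open ≡-Reasoning
    same : ∀ {a} → k₀ ≤ a → a ≤ K₁ → δ (u % N) (a % N) ≡ δ u a
    same {a} k≤a a≤K with u ≟ a
    ... | yes refl = trans (δ-refl (u % N)) (sym (δ-refl u))
    ... | no  u≢a  = trans (δ-≢ (λ e → u≢a (≋-injective k<u u<K k≤a a≤K e))) (sym (δ-≢ u≢a))

  -- The vertex k₀ of the disc has the two lifts k₀ and k₀ + N in the window.
  residueRow-k₀ : ∀ τ → τ ∈ regs tree → residueRow k₀ τ ≡ wt k₀ τ + wt K₁ τ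
  residueRow-k₀ τ m = begin
    residueRow k₀ τ                                     ≡⟨ occ-cornersS k₀ (decode K₁ τ) ⟩
    mult k₀ (map (_% N) (finVerts N (decode K₁ τ)))     ≡⟨ mult-map (finVerts N (decode K₁ τ)) (λ a → δ k₀ a + δ K₁ a) (λ a∈ → let k≤a , a≤K = verts m a∈ in same k≤a a≤K) ⟩
    sum (map (λ a → δ k₀ a + δ K₁ a) (finVerts N (decode K₁ τ))) ≡⟨ mult-sum₂ k₀ K₁ (finVerts N (decode K₁ τ)) ⟨
    mult k₀ (finVerts N (decode K₁ τ)) + mult K₁ (finVerts N (decode K₁ τ)) ≡⟨ cong₂ _+_ (wt-decode τ (m≤m+n k₀ N)) (wt-decode τ ≤-refl) ⟩
    wt k₀ τ + wt K₁ τ                                   ∎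
    where
    open ≡-Reasoning
    k₀%N : k₀ % N ≡ k₀
    k₀%N = m<n⇒m%n≡m k₀<N
    same : ∀ {a} → k₀ ≤ a → a ≤ K₁ → δ k₀ (a % N) ≡ δ k₀ a + δ K₁ a
    same {a} k≤a a≤K with m≤n⇒m<n∨m≡n k≤a | m≤n⇒m<n∨m≡n a≤K
    ... | inj₂ refl | _ = trans (cong (δ k₀) k₀%N) (trans (δ-refl k₀) (sym (cong₂ _+_ (δ-refl k₀) (δ-≢ (>⇒≢ (m<m+n k₀ 0<N))))))
    ... | inj₁ k<a | inj₂ refl = trans (cong (δ k₀) (trans (≋-+N k₀) k₀%N)) (trans (δ-refl k₀) (sym (cong₂ _+_ (δ-≢ (<⇒≢ k<a)) (δ-refl K₁))))
    ... | inj₁ k<a | inj₁ a<K = trans (δ-≢ (λ e → <⇒≢ k<a (sym (≋-injective k<a a<K ≤-refl (m≤m+n k₀ N) (trans (sym e) (sym k₀%N))))))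
                                      (sym (cong₂ _+_ (δ-≢ (<⇒≢ k<a)) (δ-≢ (>⇒≢ a<K))))

  residues : Fin N → List ℕ
  residues i = filterᵇ (λ v → not (v ≡ᵇ toℕ i)) (upTo N)

  unique-residues : ∀ i → Unique (residues i)
  unique-residues i = Unique.filter⁺ (T? ∘ (λ v → not (v ≡ᵇ toℕ i))) (Unique.upTo⁺ N)

  residues⁻ : ∀ i {v} → v ∈ residues i → v < N × v ≢ toℕ i
  residues⁻ i {v} m = let v∈ , e = ∈-filterᵇ⁻ (λ v → not (v ≡ᵇ toℕ i)) {upTo N} m in ∈-upTo⁻ v∈ , not-≡ᵇ⁻ {v} {toℕ i} e

  residues⁺ : ∀ i {v} → v < N → v ≢ toℕ i → v ∈ residues i
  residues⁺ i v<N ne = ∈-filterᵇ⁺ (λ v → not (v ≡ᵇ toℕ i)) (∈-upTo⁺ v<N) (not-≡ᵇ⁺ ne)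

  mLoop-perm : ∀ i {vs} → residues i ↭ vs → mLoop i ≡ perm (punctureRow ∷ map residueRow vs) (regs tree)
  mLoop-perm i {vs} p = begin
    mLoop i
      ≡⟨ matchings-perm (map fin (residues i) ++ ∞ ∷ []) (map (cornersS N) triangles) ⟩
    perm (map occ (map fin (residues i) ++ ∞ ∷ [])) (map (cornersS N) triangles)
      ≡⟨ perm-rows-↭ (Perm.map⁺ occ (↭-trans (Perm.++-comm (map fin (residues i)) (∞ ∷ [])) (prep ∞ (Perm.map⁺ fin p)))) (map (cornersS N) triangles) ⟩
    perm (map occ (∞ ∷ map fin vs)) (map (cornersS N) triangles)
      ≡⟨ perm-cornersS (map occ (∞ ∷ map fin vs)) ⟩
    perm (punctureRow ∷ map (_∘ (cornersS N ∘ decode K₁)) (map occ (map fin vs))) (regs tree)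
      ≡⟨ cong (λ fs → perm (punctureRow ∷ fs) (regs tree)) (trans (map-∘ vs) (map-∘ (map fin vs))) ⟨
    perm (punctureRow ∷ map residueRow vs) (regs tree) ∎
    where open ≡-Reasoning

  position : ∀ {v} → v < N → v ≢ k₀ → ∃ λ u → k₀ < u × u < K₁ × u % N ≡ v × (u ≡ v ⊎ u ≡ v + N)
  position {v} v<N ne with <-≤-connex v k₀
  ... | inj₁ v<k = v + N , <-≤-trans k₀<N (m≤n+m N v) , +-monoˡ-< N v<k , trans (≋-+N v) (m<n⇒m%n≡m v<N) , inj₂ refl
  ... | inj₂ k≤v = v , ≤∧≢⇒< k≤v (λ e → ne (sym e)) , <-≤-trans v<N (m≤n+m N k₀) , m<n⇒m%n≡m v<N , inj₁ refl

  private
    V-k₀ : V k₀ ≡ e₀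
    V-k₀ = trans (cong V (sym (+-identityʳ k₀))) (trans (V-at 0 ≤-refl (m≤m+n k₀ N)) (trans (cong (shear (ρ ℤ.* 0ℤ)) base-k₀) (cong (_, 1ℤ) (zero-shear ρ))))
      where
      zero-shear : ∀ r → 0ℤ ℤ.+ r ℤ.* 0ℤ ℤ.* 1ℤ ≡ 0ℤ
      zero-shear = ℤ-Solver.solve-∀

    V-K₁ : V K₁ ≡ (ρ , 1ℤ)
    V-K₁ = trans (V-shift ≤-refl) (trans (cong (shear ρ) V-k₀) (cong (_, 1ℤ) (shear-1 ρ)))
      where
      shear-1 : ∀ r → 0ℤ ℤ.+ r ℤ.* 1ℤ ≡ r
      shear-1 = ℤ-Solver.solve-∀

    residue-unique : ∀ sel → (∀ {v} → v ∈ ints sel tree → v < K₁) → Unique (map (_% N) (ints sel tree))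
    residue-unique sel b = unique-map (_% N) (ints sel tree) (Unique-ints sel tree)
      (λ m m′ e → ≋-injective (proj₁ (∈-ints⁻ sel tree m)) (b m) (<⇒≤ (proj₁ (∈-ints⁻ sel tree m′))) (<⇒≤ (b m′)) e)

    rows-agree : ∀ sel → (∀ {v} → v ∈ ints sel tree → v < K₁) →
                 Pointwise (λ f f′ → ∀ τ → τ ∈ regs tree → f τ ≡ f′ τ)
                   (map residueRow (map (_% N) (ints sel tree))) (map wt (ints sel tree))
    rows-agree sel b = subst (λ fs → Pointwise _ fs (map wt (ints sel tree))) (map-∘ (ints sel tree))
      (map-agree (λ v → residueRow (v % N)) wt (ints sel tree) (λ m τ∈ → residueRow-wt (proj₁ (∈-ints⁻ sel tree m)) (b m) τ∈))

  -- Both copies of the doubled vertex are left out and the puncture is matched. The omitted vectors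
  -- are `e₀` and (ρ , 1), with determinant `ρ`; the remaining factor is 1 at a central position.
  loop-value-central : ∀ i → toℕ i ≡ k₀ → + mLoop i ≡ ρ ℤ.* proj₂ (V (toℕ i + N))
  loop-value-central i i≡ = begin
    + mLoop i
      ≡⟨ cong +_ (trans (mLoop-perm i vs↭) (perm-cong (regs tree) {punctureRow ∷ map residueRow (map (_% N) (ints sel tree))} {map wt (suc K₁ ∷ ints sel tree)}
             (punctureRow-wt ∷ rows-agree sel <K))) ⟩
    + perm (map wt (points sel tree false true)) (regs tree)
      ≡⟨ perm-points sel tree false true ⟩
    W sel tree false true
      ≡⟨ Missing.ft (W-missing sel (U K₁) tree additive unimodular (m<m+n k₀ 0<N) ≤-refl
           (λ v _ v<K → not-≡ᵇ⁺ (<⇒≢ v<K)) (not-≡ᵇ-refl K₁) (λ v K<v v<sK → ⊥-elim (<-irrefl refl (<-≤-trans K<v (≤-pred v<sK))))) ⟩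
    det (U K₁ k₀) (U K₁ K₁)
      ≡⟨ cong₂ det (trans (U-≤ (m≤m+n k₀ N)) V-k₀) (trans (U-≤ ≤-refl) V-K₁) ⟩
    det e₀ (ρ , 1ℤ)
      ≡⟨ identity ρ ⟩
    ρ ℤ.* 1ℤ
      ≡⟨ cong (ρ ℤ.*_) (trans (cong (λ v → proj₂ (V (v + N))) i≡) (cong proj₂ V-K₁)) ⟨
    ρ ℤ.* proj₂ (V (toℕ i + N)) ∎
    where
    open ≡-Reasoning
    identity : ∀ r → r ℤ.* 1ℤ ℤ.- 0ℤ ℤ.* 1ℤ ≡ r ℤ.* 1ℤ
    identity = ℤ-Solver.solve-∀
    sel : ℕ → Bool
    sel v = not (v ≡ᵇ K₁)
    <K : ∀ {v} → v ∈ ints sel tree → v < K₁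
    <K {v} m = let _ , v<sK , e = ∈-ints⁻ sel tree m in ≤∧≢⇒< (≤-pred v<sK) (not-≡ᵇ⁻ {v} {K₁} e)
    vs↭ : residues i ↭ map (_% N) (ints sel tree)
    vs↭ = unique-↭ (unique-residues i) (residue-unique sel <K) to from
      where
      to : residues i ⊆ map (_% N) (ints sel tree)
      to m with residues⁻ i m
      ... | v<N , v≢i with position v<N (λ e → v≢i (trans e (sym i≡)))
      ... | u , k<u , u<K , refl , _ = ∈-map⁺ (_% N) (∈-ints⁺ sel tree k<u (<-trans u<K ≤-refl) (not-≡ᵇ⁺ (<⇒≢ u<K)))
      from : map (_% N) (ints sel tree) ⊆ residues i
      from m with ∈-map⁻ (_% N) m
      ... | u , u∈ , refl = residues⁺ i (m%n<n u N) (λ e → <⇒≢ k<u (sym (≋-injective k<u (<K u∈) ≤-refl (m≤m+n k₀ N)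
                              (trans e (trans i≡ (sym (m<n⇒m%n≡m k₀<N)))))))
        where k<u = proj₁ (∈-ints⁻ sel tree u∈)

  -- The row of `k₀` is split into the rows of its two copies. Matching the copy `k₀` leaves out x
  -- and `K₁`, matching the copy `K₁` leaves out `k₀` and x. The two determinants add up to det (V x
  -- , V K₁ - V k₀), and V K₁ - V k₀ is ρ times `e∞`.
  loop-value-other : ∀ i → toℕ i ≢ k₀ → + mLoop i ≡ ρ ℤ.* proj₂ (V (toℕ i + N))
  loop-value-other i i≢ = begin
    + mLoop i
      ≡⟨ cong +_ (trans (mLoop-perm i vs↭)
           (trans (perm-rows-↭ {fs = punctureRow ∷ residueRow k₀ ∷ rs} (swap punctureRow (residueRow k₀) ↭-refl) (regs tree))
                  (perm-row-+ (residueRow k₀) (wt k₀) (wt K₁) (punctureRow ∷ rs) (regs tree) residueRow-k₀))) ⟩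
    + (perm (wt k₀ ∷ punctureRow ∷ rs) (regs tree) + perm (wt K₁ ∷ punctureRow ∷ rs) (regs tree))
      ≡⟨ cong +_ (cong₂ _+_ (lifted k₀) (trans (lifted K₁) (perm-rows-↭ (Perm.map⁺ wt second↭) (regs tree)))) ⟩
    + (perm (map wt (points sel tree true true)) (regs tree) + perm (map wt (points sel′ tree false true)) (regs tree))
      ≡⟨ ℤ.pos-+ (perm (map wt (points sel tree true true)) (regs tree)) _ ⟩
    + perm (map wt (points sel tree true true)) (regs tree) ℤ.+ + perm (map wt (points sel′ tree false true)) (regs tree)
      ≡⟨ cong₂ ℤ._+_ (perm-points sel tree true true) (perm-points sel′ tree false true) ⟩
    W sel tree true true ℤ.+ W sel′ tree false true
      ≡⟨ cong₂ ℤ._+_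
           (W-missing₂ sel (U K₁) tree additive unimodular k<x x<K ≤-refl
             (λ v _ v<x → sel⁺ (<⇒≢ v<x) (<⇒≢ (<-trans v<x x<K))) sel-x (λ v x<v v<K → sel⁺ (>⇒≢ x<v) (<⇒≢ v<K)) sel-K
             (λ v K<v v<sK → ⊥-elim (<-irrefl refl (<-≤-trans K<v (≤-pred v<sK)))))
           (Missing.ft (W-missing sel′ (U K₁) tree additive unimodular k<x (<-trans x<K ≤-refl)
             (λ v _ v<x → not-≡ᵇ⁺ (<⇒≢ v<x)) (not-≡ᵇ-refl x) (λ v x<v _ → not-≡ᵇ⁺ (>⇒≢ x<v)))) ⟩
    det (U K₁ x) (U K₁ K₁) ℤ.+ det (U K₁ k₀) (U K₁ x)
      ≡⟨ cong₂ ℤ._+_ (cong₂ det (U-≤ (<⇒≤ x<K)) (trans (U-≤ ≤-refl) V-K₁)) (cong₂ det (trans (U-≤ (m≤m+n k₀ N)) V-k₀) (U-≤ (<⇒≤ x<K))) ⟩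
    det (V x) (ρ , 1ℤ) ℤ.+ det e₀ (V x)
      ≡⟨ identity ρ (proj₁ (V x)) (proj₂ (V x)) ⟩
    ρ ℤ.* proj₂ (V x)
      ≡⟨ cong (ρ ℤ.*_) same ⟩
    ρ ℤ.* proj₂ (V (toℕ i + N)) ∎
    where
    open ≡-Reasoning
    identity : ∀ r a b → (r ℤ.* b ℤ.- a ℤ.* 1ℤ) ℤ.+ (a ℤ.* 1ℤ ℤ.- 0ℤ ℤ.* b) ≡ r ℤ.* b
    identity = ℤ-Solver.solve-∀
    pos : ∃ λ u → k₀ < u × u < K₁ × u % N ≡ toℕ i × (u ≡ toℕ i ⊎ u ≡ toℕ i + N)
    pos = position (toℕ<n i) i≢
    x = proj₁ pos
    k<x : k₀ < x
    k<x = proj₁ (proj₂ pos)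
    x<K : x < K₁
    x<K = proj₁ (proj₂ (proj₂ pos))
    x%N : x % N ≡ toℕ i
    x%N = proj₁ (proj₂ (proj₂ (proj₂ pos)))
    same : proj₂ (V x) ≡ proj₂ (V (toℕ i + N))
    same with proj₂ (proj₂ (proj₂ (proj₂ pos)))
    ... | inj₂ e = cong (λ v → proj₂ (V v)) e
    ... | inj₁ e = trans (cong proj₂ (sym (V-shift (<⇒≤ k<x)))) (cong (λ v → proj₂ (V (v + N))) e)
    sel sel′ : ℕ → Bool
    sel v = not (v ≡ᵇ x) ∧ not (v ≡ᵇ K₁)
    sel′ v = not (v ≡ᵇ x)
    sel⁺ : ∀ {v} → v ≢ x → v ≢ K₁ → sel v ≡ true
    sel⁺ a b = cong₂ _∧_ (not-≡ᵇ⁺ a) (not-≡ᵇ⁺ b)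
    sel⁻ : ∀ {v} → sel v ≡ true → v ≢ x × v ≢ K₁
    sel⁻ {v} e = not-≡ᵇ⁻ {v} {x} (∧-conicalˡ _ _ e) , not-≡ᵇ⁻ {v} {K₁} (∧-conicalʳ (not (v ≡ᵇ x)) _ e)
    sel-x : sel x ≡ false
    sel-x rewrite not-≡ᵇ-refl x = refl
    sel-K : sel K₁ ≡ false
    sel-K rewrite not-≡ᵇ-refl K₁ = ∧-zeroʳ (not (K₁ ≡ᵇ x))
    <K : ∀ {v} → v ∈ ints sel tree → v < K₁
    <K {v} m = let _ , v<sK , e = ∈-ints⁻ sel tree m in ≤∧≢⇒< (≤-pred v<sK) (proj₂ (sel⁻ {v} e))
    vs↭ : residues i ↭ k₀ ∷ map (_% N) (ints sel tree)
    vs↭ = unique-↭ (unique-residues i) (All.tabulate apart ∷ residue-unique sel <K) to from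
      where
      apart : ∀ {v} → v ∈ map (_% N) (ints sel tree) → k₀ ≢ v
      apart m e with ∈-map⁻ (_% N) m
      ... | u , u∈ , refl = let k<u = proj₁ (∈-ints⁻ sel tree u∈) in
        <⇒≢ k<u (sym (≋-injective k<u (<K u∈) ≤-refl (m≤m+n k₀ N) (trans (sym e) (sym (m<n⇒m%n≡m k₀<N)))))
      to : residues i ⊆ k₀ ∷ map (_% N) (ints sel tree)
      to {v} m with residues⁻ i m | v ≟ k₀
      ... | v<N , v≢i | yes refl = here refl
      ... | v<N , v≢i | no v≢k with position v<N v≢k
      ...   | u , k<u , u<K , refl , _ = there (∈-map⁺ (_% N) (∈-ints⁺ sel tree k<u (<-trans u<K ≤-refl)
                (sel⁺ (λ e → v≢i (trans (cong (_% N) e) x%N)) (<⇒≢ u<K))))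
      from : k₀ ∷ map (_% N) (ints sel tree) ⊆ residues i
      from (here refl) = residues⁺ i k₀<N (λ e → i≢ (sym e))
      from (there m) with ∈-map⁻ (_% N) m
      ... | u , u∈ , refl = let k<u , _ , e = ∈-ints⁻ sel tree u∈ in
        residues⁺ i (m%n<n u N) (λ eq → proj₁ (sel⁻ {u} e) (≋-injective k<u (<K u∈) (<⇒≤ k<x) (<⇒≤ x<K) (trans eq (sym x%N))))
    rs : List (Triple → ℕ)
    rs = map residueRow (map (_% N) (ints sel tree))
    lifted : ∀ v → perm (wt v ∷ punctureRow ∷ rs) (regs tree) ≡ perm (map wt (v ∷ suc K₁ ∷ ints sel tree)) (regs tree)
    lifted v = perm-cong (regs tree) {wt v ∷ punctureRow ∷ rs} {map wt (v ∷ suc K₁ ∷ ints sel tree)}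
                 ((λ _ _ → refl) ∷ punctureRow-wt ∷ rows-agree sel <K)
    second↭ : K₁ ∷ suc K₁ ∷ ints sel tree ↭ points sel′ tree false true
    second↭ = ↭-trans (swap K₁ (suc K₁) ↭-refl) (prep (suc K₁) (unique-↭
      (All.tabulate (λ m → >⇒≢ (<K m)) ∷ Unique-ints sel tree) (Unique-ints sel′ tree) to from))
      where
      to : K₁ ∷ ints sel tree ⊆ ints sel′ tree
      to (here refl) = ∈-ints⁺ sel′ tree (m<m+n k₀ 0<N) ≤-refl (not-≡ᵇ⁺ (>⇒≢ x<K))
      to {v} (there m) = let k<v , v<sK , e = ∈-ints⁻ sel tree m in ∈-ints⁺ sel′ tree k<v v<sK (not-≡ᵇ⁺ (proj₁ (sel⁻ {v} e)))
      from : ints sel′ tree ⊆ K₁ ∷ ints sel tree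
      from {v} m with ∈-ints⁻ sel′ tree m | v ≟ K₁
      ... | _ | yes refl = here refl
      ... | k<v , v<sK , e | no v≢K = there (∈-ints⁺ sel tree k<v v<sK (sel⁺ (not-≡ᵇ⁻ {v} {x} e) v≢K))

  loop-value : ∀ i → + mLoop i ≡ ρ ℤ.* proj₂ (V (toℕ i + N))
  loop-value i with toℕ i ≟ k₀
  ... | yes e = loop-value-central i e
  ... | no ne = loop-value-other i ne

  -- Positivity and translation invariance of the determinants.

  k₀≤ : ∀ {x} → N ≤ x → k₀ ≤ x
  k₀≤ N≤x = ≤-trans (<⇒≤ k₀<N) N≤x

  E-suc : ∀ x → E x (suc x)
  E-suc x = mkE ≤-refl (subst (_≤ x + N) (+-comm x 1) (+-monoʳ-≤ x 0<N)) (inj₁ refl)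

  -- Induction on the length by the Plücker relation for x, y, y + 1 and the puncture. The three
  -- pairings with `e∞` are positive second coordinates and the boundary edge from y to y + 1
  -- contributes 1, so positivity passes from y to y + 1.
  det-positive : ∀ {x} n → k₀ ≤ x → 0ℤ ℤ.< det (V x) (V (x + suc n))
  det-positive {x} zero k₀≤x = subst (0ℤ ℤ.<_)
    (sym (trans (cong (λ y → det (V x) (V y)) (+-comm x 1)) (V-edge k₀≤x (E-suc x)))) (ℤ.+<+ (s≤s z≤n))
  det-positive {x} (suc n) k₀≤x = *-positive⁻ˡ (V-positive k₀≤y)
    (subst (0ℤ ℤ.<_) (sym expand) (ℤ.+-mono-< (*-positive (det-positive n k₀≤x) (V-positive (≤-trans k₀≤y (n≤1+n y)))) (V-positive k₀≤x)))
    where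
    y = x + suc n
    k₀≤y : k₀ ≤ y
    k₀≤y = ≤-trans k₀≤x (m≤m+n x (suc n))
    expand : det (V x) (V (x + suc (suc n))) ℤ.* proj₂ (V y) ≡ det (V x) (V y) ℤ.* proj₂ (V (suc y)) ℤ.+ proj₂ (V x)
    expand = begin
      det (V x) (V (x + suc (suc n))) ℤ.* proj₂ (V y)
        ≡⟨ cong₂ ℤ._*_ (cong (λ z → det (V x) (V z)) (+-suc x (suc n))) (sym (det-e∞ (V y))) ⟩
      det (V x) (V (suc y)) ℤ.* det (V y) e∞
        ≡⟨ plücker (V x) (V y) (V (suc y)) e∞ ⟩
      det (V x) (V y) ℤ.* det (V (suc y)) e∞ ℤ.+ det (V x) e∞ ℤ.* det (V y) (V (suc y))
        ≡⟨ cong₂ (λ a b → det (V x) (V y) ℤ.* a ℤ.+ b) (det-e∞ (V (suc y)))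
             (trans (cong₂ ℤ._*_ (det-e∞ (V x)) (V-edge k₀≤y (E-suc y))) (ℤ.*-identityʳ _)) ⟩
      det (V x) (V y) ℤ.* proj₂ (V (suc y)) ℤ.+ proj₂ (V x) ∎
      where open ≡-Reasoning

  V-shift* : ∀ n {x} → k₀ ≤ x → V (x + n * N) ≡ shear (ρ ℤ.* + n) (V x)
  V-shift* zero {x} k₀≤x = trans (cong V (+-identityʳ x)) (cong (_, proj₂ (V x)) (unit ρ (proj₁ (V x)) (proj₂ (V x))))
    where
    unit : ∀ r a b → a ≡ a ℤ.+ r ℤ.* 0ℤ ℤ.* b
    unit = ℤ-Solver.solve-∀
  V-shift* (suc n) {x} k₀≤x = trans (cong V (trans (cong (λ y → x + y) (+-comm N (n * N))) (sym (+-assoc x (n * N) N))))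
    (trans (V-shift (≤-trans k₀≤x (m≤m+n x (n * N)))) (trans (cong (shear ρ) (V-shift* n k₀≤x)) (sym (shear-suc ρ n (V x)))))

  -- toℕ i + N is the lift of i used by mTrunc and mCentral.
  normalise : ∀ {x} → N ≤ x → ∃ λ n → x ≡ toℕ ⟦ x ⟧ + N + n * N
  normalise {x} N≤x with x / N in e
  ... | zero  = ⊥-elim (<-irrefl refl (<-≤-trans (m/n≡0⇒m<n e) N≤x))
  ... | suc n = n , trans (m≡m%n+[m/n]*n x N) (trans (cong₂ _+_ (sym (toℕ⌊⌋ x)) (cong (_* N) e)) (sym (+-assoc (toℕ ⟦ x ⟧) N (n * N))))

  V₂-periodic : ∀ {x} → N ≤ x → proj₂ (V (toℕ ⟦ x ⟧ + N)) ≡ proj₂ (V x)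
  V₂-periodic {x} N≤x = let n , e = normalise N≤x in
    trans (sym (cong proj₂ (V-shift* n (k₀≤ (m≤n+m N (toℕ ⟦ x ⟧)))))) (cong (λ y → proj₂ (V y)) (sym e))

  m₀-value : ∀ {x} → N ≤ x → + mCentral ⟦ x ⟧ ≡ proj₂ (V x)
  m₀-value {x} N≤x = trans (central-value ⟦ x ⟧) (V₂-periodic N≤x)

  private
    ≡ᵇ-yes : ∀ {a b} → a ≡ b → (a ≡ᵇ b) ≡ true
    ≡ᵇ-yes {a} refl = Equivalence.to T-≡ (≡⇒≡ᵇ a a refl)

    ≡ᵇ-no : ∀ {a b} → a ≢ b → (a ≡ᵇ b) ≡ false
    ≡ᵇ-no {a} {b} ne with a ≡ᵇ b in e
    ... | false = refl
    ... | true  = ⊥-elim (ne (≡ᵇ⇒≡ a b (Equivalence.from T-≡ e)))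

    residue-≢ : ∀ {x y} → x < y → y < x + N → toℕ ⟦ y ⟧ ≢ toℕ ⟦ x ⟧
    residue-≢ {x} {y} x<y y<x+N e = <⇒≢ x<y (≋-unique (⌊⌋-inj (toℕ-injective (sym e))) (<⇒≤ x<y) y<x+N)

    ⊕1 : ∀ x → _⊕_ N ⟦ x ⟧ 1 ≡ ⟦ suc x ⟧
    ⊕1 x = trans (⌊⌋-⊕ x 1) (cong ⟦_⟧ (+-comm x 1))

    suc< : ∀ x → suc x < x + N
    suc< x = subst (_< x + N) (+-comm x 1) (+-monoʳ-< x (≤-trans (s≤s (s≤s z≤n)) 3≤N))

  loop-m-value : ∀ {x} → N ≤ x → + mNum ⟦ x ⟧ ⟦ x ⟧ ≡ ρ ℤ.* proj₂ (V x)
  loop-m-value {x} N≤x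
    rewrite ⊕1 x | ≡ᵇ-no {toℕ ⟦ x ⟧} {toℕ ⟦ suc x ⟧} (λ e → residue-≢ (n<1+n x) (suc< x) (sym e)) | ≡ᵇ-yes {toℕ ⟦ x ⟧} refl =
    trans (loop-value ⟦ x ⟧) (cong (ρ ℤ.*_) (V₂-periodic N≤x))

  -- The definition uses one fixed lift of the first vertex. Moving both ends by the same number of
  -- turns applies one shear to both vectors and keeps the determinant.
  m-value : ∀ {x y} → N ≤ x → x < y → y < x + N → + mNum ⟦ x ⟧ ⟦ y ⟧ ≡ det (V x) (V y)
  m-value {x} {y} N≤x x<y y<x+N with m≤n⇒m<n∨m≡n x<y
  ... | inj₂ refl rewrite ⊕1 x | ≡ᵇ-yes {toℕ ⟦ suc x ⟧} refl = sym (V-edge (k₀≤ N≤x) (E-suc x))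
  ... | inj₁ 1+x<y
    rewrite ⊕1 x | ≡ᵇ-no (residue-≢ 1+x<y (<-trans y<x+N ≤-refl)) | ≡ᵇ-no (residue-≢ x<y y<x+N) = begin
    + mTrunc ⟦ x ⟧ ⟦ y ⟧
      ≡⟨ truncation ⟦ x ⟧ ⟦ y ⟧ (subst (0 <_) (sym d≡) (m<n⇒0<n∸m x<y)) ⟩
    det (V x′) (V (x′ + dist N ⟦ x ⟧ ⟦ y ⟧))
      ≡⟨ cong (λ d → det (V x′) (V (x′ + d))) d≡ ⟩
    det (V x′) (V (x′ + (y ∸ x)))
      ≡⟨ det-shear (ρ ℤ.* + n) (V x′) (V (x′ + (y ∸ x))) ⟨
    det (shear (ρ ℤ.* + n) (V x′)) (shear (ρ ℤ.* + n) (V (x′ + (y ∸ x))))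
      ≡⟨ cong₂ det (V-shift* n k₀≤x′) (V-shift* n (≤-trans k₀≤x′ (m≤m+n x′ _))) ⟨
    det (V (x′ + n * N)) (V (x′ + (y ∸ x) + n * N))
      ≡⟨ cong₂ (λ a b → det (V a) (V b)) (sym x≡) y≡ ⟩
    det (V x) (V y) ∎
    where
    open ≡-Reasoning
    x′ = toℕ ⟦ x ⟧ + N
    n = proj₁ (normalise N≤x)
    x≡ : x ≡ x′ + n * N
    x≡ = proj₂ (normalise N≤x)
    k₀≤x′ = k₀≤ (m≤n+m N (toℕ ⟦ x ⟧))
    at : x + (y ∸ x) ≡ y
    at = m+[n∸m]≡n (<⇒≤ x<y)
    rearrange : ∀ a b c → a + b + c ≡ a + c + b
    rearrange = solve-∀
    y≡ : x′ + (y ∸ x) + n * N ≡ y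
    y≡ = trans (rearrange x′ (y ∸ x) (n * N)) (trans (cong (_+ (y ∸ x)) (sym x≡)) at)
    d≡ : dist N ⟦ x ⟧ ⟦ y ⟧ ≡ y ∸ x
    d≡ = trans (cong (λ v → dist N ⟦ x ⟧ ⟦ v ⟧) (sym at)) (dist-lift x (y ∸ x) (+-cancelˡ-< x (y ∸ x) N (subst (_< x + N) (sym at) y<x+N)))

  position-of : Fin N → ℕ
  position-of i = toℕ i + N

  ⟦position⟧ : ∀ i → ⟦ position-of i ⟧ ≡ i
  ⟦position⟧ i = trans (⌊⌋-cong (≋-+N (toℕ i))) (⌊toℕ⌋ i)

  ⟦+dist⟧ : ∀ x j → ⟦ x + dist N ⟦ x ⟧ j ⟧ ≡ j
  ⟦+dist⟧ x j = ⌊+⌋ x j (dist-spec ⟦ x ⟧ j)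

  ⟦+N⟧ : ∀ x → ⟦ x + N ⟧ ≡ ⟦ x ⟧
  ⟦+N⟧ x = ⌊⌋-cong (≋-+N x)

  -- The frieze relations at a position of the cover.

  module At (x : ℕ) (N≤x : N ≤ x) where

    open ≡-Reasoning

    k₀≤x : k₀ ≤ x
    k₀≤x = k₀≤ N≤x

    N≤1+x : N ≤ suc x
    N≤1+x = ≤-trans N≤x (n≤1+n x)

    -- The arc from vertex i + 1 clockwise to i goes almost once round, so its lift starting at x +
    -- 1 ends at x + N and not at x.
    around : + mNum ⟦ suc x ⟧ ⟦ x ⟧ ≡ det (V (suc x)) (V (x + N))
    around = trans (cong (λ i → + mNum ⟦ suc x ⟧ i) (sym (⟦+N⟧ x))) (m-value N≤1+x (suc< x) (n<1+n (x + N)))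

    -- The Plücker relation for x, x + 1, y, y + 1, in which the two boundary edges have determinant
    -- 1.
    det-frieze : ∀ {y} → x ≤ y →
                 det (V x) (V y) ℤ.* det (V (suc x)) (V (suc y)) ≡ det (V (suc x)) (V y) ℤ.* det (V x) (V (suc y)) ℤ.+ 1ℤ
    det-frieze {y} x≤y = begin
      det (V x) (V y) ℤ.* det (V (suc x)) (V (suc y))
        ≡⟨ plücker (V x) (V (suc x)) (V y) (V (suc y)) ⟩
      det (V x) (V (suc x)) ℤ.* det (V y) (V (suc y)) ℤ.+ det (V x) (V (suc y)) ℤ.* det (V (suc x)) (V y)
        ≡⟨ cong₂ (λ a b → a ℤ.* b ℤ.+ det (V x) (V (suc y)) ℤ.* det (V (suc x)) (V y))
             (V-edge k₀≤x (E-suc x)) (V-edge (≤-trans k₀≤x x≤y) (E-suc y)) ⟩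
      1ℤ ℤ.* 1ℤ ℤ.+ det (V x) (V (suc y)) ℤ.* det (V (suc x)) (V y)
        ≡⟨ identity (det (V x) (V (suc y))) (det (V (suc x)) (V y)) ⟩
      det (V (suc x)) (V y) ℤ.* det (V x) (V (suc y)) ℤ.+ 1ℤ ∎
      where
      identity : ∀ a b → 1ℤ ℤ.* 1ℤ ℤ.+ a ℤ.* b ≡ b ℤ.* a ℤ.+ 1ℤ
      identity = ℤ-Solver.solve-∀

    rule₁ : ∀ {y} → suc x < y → suc y < x + N →
            mNum ⟦ x ⟧ ⟦ y ⟧ * mNum ⟦ suc x ⟧ ⟦ suc y ⟧ ≡ mNum ⟦ suc x ⟧ ⟦ y ⟧ * mNum ⟦ x ⟧ ⟦ suc y ⟧ + 1
    rule₁ {y} 1+x<y 1+y<x+N = ℤ.+-injective (begin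
      + (mNum ⟦ x ⟧ ⟦ y ⟧ * mNum ⟦ suc x ⟧ ⟦ suc y ⟧)
        ≡⟨ ℤ.pos-* (mNum ⟦ x ⟧ ⟦ y ⟧) _ ⟩
      + mNum ⟦ x ⟧ ⟦ y ⟧ ℤ.* + mNum ⟦ suc x ⟧ ⟦ suc y ⟧
        ≡⟨ cong₂ ℤ._*_ (m-value N≤x x<y y<x+N) (m-value N≤1+x (s≤s x<y) (s≤s y<x+N)) ⟩
      det (V x) (V y) ℤ.* det (V (suc x)) (V (suc y))
        ≡⟨ det-frieze (<⇒≤ x<y) ⟩
      det (V (suc x)) (V y) ℤ.* det (V x) (V (suc y)) ℤ.+ 1ℤ
        ≡⟨ cong (ℤ._+ 1ℤ) (cong₂ ℤ._*_ (m-value N≤1+x 1+x<y (<-trans y<x+N ≤-refl)) (m-value N≤x (<-trans x<y ≤-refl) 1+y<x+N)) ⟨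
      + mNum ⟦ suc x ⟧ ⟦ y ⟧ ℤ.* + mNum ⟦ x ⟧ ⟦ suc y ⟧ ℤ.+ 1ℤ
        ≡⟨ cong (ℤ._+ 1ℤ) (ℤ.pos-* (mNum ⟦ suc x ⟧ ⟦ y ⟧) _) ⟨
      + (mNum ⟦ suc x ⟧ ⟦ y ⟧ * mNum ⟦ x ⟧ ⟦ suc y ⟧) ℤ.+ 1ℤ
        ≡⟨ ℤ.pos-+ (mNum ⟦ suc x ⟧ ⟦ y ⟧ * mNum ⟦ x ⟧ ⟦ suc y ⟧) 1 ⟨
      + (mNum ⟦ suc x ⟧ ⟦ y ⟧ * mNum ⟦ x ⟧ ⟦ suc y ⟧ + 1) ∎)
      where
      x<y : x < y
      x<y = <-trans (n<1+n x) 1+x<y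
      y<x+N : y < x + N
      y<x+N = <-trans (n<1+n y) 1+y<x+N

    -- With b the second coordinate of V x, a full turn adds ρ b to the first coordinate, so the
    -- determinant is ρ b b: one factor is read as m_ii = ρ b, the other as m_i0 = b. Thus (R2) is
    -- `det-frieze` with y + 1 = x + N.
    det-loop : det (V x) (V (x + N)) ≡ + (mNum ⟦ x ⟧ ⟦ x ⟧ * mCentral ⟦ x ⟧)
    det-loop = begin
      det (V x) (V (x + N))                      ≡⟨ cong (det (V x)) (V-shift k₀≤x) ⟩
      det (V x) (shear ρ (V x))                  ≡⟨ identity ρ (proj₁ (V x)) (proj₂ (V x)) ⟩
      ρ ℤ.* proj₂ (V x) ℤ.* proj₂ (V x)          ≡⟨ cong₂ ℤ._*_ (loop-m-value N≤x) (m₀-value N≤x) ⟨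
      + mNum ⟦ x ⟧ ⟦ x ⟧ ℤ.* + mCentral ⟦ x ⟧    ≡⟨ ℤ.pos-* (mNum ⟦ x ⟧ ⟦ x ⟧) _ ⟨
      + (mNum ⟦ x ⟧ ⟦ x ⟧ * mCentral ⟦ x ⟧)      ∎
      where
      identity : ∀ r a b → (a ℤ.+ r ℤ.* b) ℤ.* b ℤ.- a ℤ.* b ≡ r ℤ.* b ℤ.* b
      identity = ℤ-Solver.solve-∀

    rule₂ : ∀ {y} → suc y ≡ x + N → suc x < y →
            mNum ⟦ x ⟧ ⟦ y ⟧ * mNum ⟦ suc x ⟧ ⟦ x ⟧ ≡ mNum ⟦ suc x ⟧ ⟦ y ⟧ * mNum ⟦ x ⟧ ⟦ x ⟧ * mCentral ⟦ x ⟧ + 1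
    rule₂ {y} 1+y≡ 1+x<y = ℤ.+-injective (begin
      + (mNum ⟦ x ⟧ ⟦ y ⟧ * mNum ⟦ suc x ⟧ ⟦ x ⟧)
        ≡⟨ ℤ.pos-* (mNum ⟦ x ⟧ ⟦ y ⟧) _ ⟩
      + mNum ⟦ x ⟧ ⟦ y ⟧ ℤ.* + mNum ⟦ suc x ⟧ ⟦ x ⟧
        ≡⟨ cong₂ ℤ._*_ (m-value N≤x x<y y<x+N) (trans around (cong (λ z → det (V (suc x)) (V z)) (sym 1+y≡))) ⟩
      det (V x) (V y) ℤ.* det (V (suc x)) (V (suc y))
        ≡⟨ det-frieze (<⇒≤ x<y) ⟩
      det (V (suc x)) (V y) ℤ.* det (V x) (V (suc y)) ℤ.+ 1ℤ
        ≡⟨ cong (ℤ._+ 1ℤ) (cong₂ ℤ._*_ (m-value N≤1+x 1+x<y (<-trans y<x+N ≤-refl)) (trans (sym det-loop) (cong (λ z → det (V x) (V z)) (sym 1+y≡)))) ⟨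
      + mNum ⟦ suc x ⟧ ⟦ y ⟧ ℤ.* + (mNum ⟦ x ⟧ ⟦ x ⟧ * mCentral ⟦ x ⟧) ℤ.+ 1ℤ
        ≡⟨ cong (ℤ._+ 1ℤ) (ℤ.pos-* (mNum ⟦ suc x ⟧ ⟦ y ⟧) _) ⟨
      + (mNum ⟦ suc x ⟧ ⟦ y ⟧ * (mNum ⟦ x ⟧ ⟦ x ⟧ * mCentral ⟦ x ⟧)) ℤ.+ 1ℤ
        ≡⟨ cong (λ a → + a ℤ.+ 1ℤ) (*-assoc (mNum ⟦ suc x ⟧ ⟦ y ⟧) (mNum ⟦ x ⟧ ⟦ x ⟧) (mCentral ⟦ x ⟧)) ⟨
      + (mNum ⟦ suc x ⟧ ⟦ y ⟧ * mNum ⟦ x ⟧ ⟦ x ⟧ * mCentral ⟦ x ⟧) ℤ.+ 1ℤ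
        ≡⟨ ℤ.pos-+ (mNum ⟦ suc x ⟧ ⟦ y ⟧ * mNum ⟦ x ⟧ ⟦ x ⟧ * mCentral ⟦ x ⟧) 1 ⟨
      + (mNum ⟦ suc x ⟧ ⟦ y ⟧ * mNum ⟦ x ⟧ ⟦ x ⟧ * mCentral ⟦ x ⟧ + 1) ∎)
      where
      x<y : x < y
      x<y = <-trans (n<1+n x) 1+x<y
      y<x+N : y < x + N
      y<x+N = subst (y <_) 1+y≡ (n<1+n y)

    -- The common value of the left sides of (R3) and (R4): each is `ρ` times the second coordinates
    -- at x and x + 1. The added 1 on the right is the determinant of the boundary edge from x to x
    -- + 1.
    exchange-value : ρ ℤ.* proj₂ (V x) ℤ.* proj₂ (V (suc x)) ≡ + (mNum ⟦ suc x ⟧ ⟦ x ⟧ + 1)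
    exchange-value = begin
      ρ ℤ.* proj₂ (V x) ℤ.* proj₂ (V (suc x))
        ≡⟨ identity ρ (proj₁ (V x)) (proj₂ (V x)) (proj₁ (V (suc x))) (proj₂ (V (suc x))) ⟩
      det (V (suc x)) (shear ρ (V x)) ℤ.+ det (V x) (V (suc x))
        ≡⟨ cong₂ ℤ._+_ (trans around (cong (det (V (suc x))) (V-shift k₀≤x))) (sym (V-edge k₀≤x (E-suc x))) ⟨
      + mNum ⟦ suc x ⟧ ⟦ x ⟧ ℤ.+ 1ℤ
        ≡⟨ ℤ.pos-+ (mNum ⟦ suc x ⟧ ⟦ x ⟧) 1 ⟨
      + (mNum ⟦ suc x ⟧ ⟦ x ⟧ + 1) ∎
      where
      identity : ∀ r a b c d → r ℤ.* b ℤ.* d ≡ ((a ℤ.+ r ℤ.* b) ℤ.* d ℤ.- c ℤ.* b) ℤ.+ (c ℤ.* b ℤ.- a ℤ.* d)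
      identity = ℤ-Solver.solve-∀

    rule₃ : mNum ⟦ x ⟧ ⟦ x ⟧ * mCentral ⟦ suc x ⟧ ≡ mNum ⟦ suc x ⟧ ⟦ x ⟧ + 1
    rule₃ = ℤ.+-injective (trans (ℤ.pos-* (mNum ⟦ x ⟧ ⟦ x ⟧) _)
      (trans (cong₂ ℤ._*_ (loop-m-value N≤x) (m₀-value N≤1+x)) exchange-value))

    rule₄ : mCentral ⟦ x ⟧ * mNum ⟦ suc x ⟧ ⟦ suc x ⟧ ≡ mNum ⟦ suc x ⟧ ⟦ x ⟧ + 1
    rule₄ = ℤ.+-injective (trans (ℤ.pos-* (mCentral ⟦ x ⟧) _)
      (trans (cong₂ ℤ._*_ (m₀-value N≤x) (loop-m-value N≤1+x)) (trans (identity ρ (proj₂ (V x)) (proj₂ (V (suc x)))) exchange-value)))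
      where
      identity : ∀ r b d → b ℤ.* (r ℤ.* d) ≡ r ℤ.* b ℤ.* d
      identity = ℤ-Solver.solve-∀

    central-positive : 0 < mCentral ⟦ x ⟧
    central-positive = ℤ.drop‿+<+ (subst (0ℤ ℤ.<_) (sym (m₀-value N≤x)) (V-positive k₀≤x))

    arc-positive : ∀ {y} → x < y → y < x + N → 0 < mNum ⟦ x ⟧ ⟦ y ⟧
    arc-positive x<y y<x+N with gap x<y
    ... | d , refl = ℤ.drop‿+<+ (subst (0ℤ ℤ.<_) (sym (m-value N≤x x<y y<x+N)) (det-positive d k₀≤x))

    -- The determinant over a full turn is positive and factors by `det-loop`, where the factor m_i0
    -- is already known to be positive.
    loop-positive : 0 < mNum ⟦ x ⟧ ⟦ x ⟧
    loop-positive = ℤ.drop‿+<+ (*-positive⁻ˡ (ℤ.+<+ central-positive) (subst (0ℤ ℤ.<_)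
      (trans det-loop (ℤ.pos-* (mNum ⟦ x ⟧ ⟦ x ⟧) _)) (subst (λ n → 0ℤ ℤ.< det (V x) (V (x + n))) (suc-pred N) (det-positive (pred N) k₀≤x))))

  arc-lift : ∀ i j → ∃₂ λ x d → N ≤ x × d < N × ⟦ x ⟧ ≡ i × ⟦ x + d ⟧ ≡ j
  arc-lift i j = position-of i , dist N ⟦ position-of i ⟧ j , m≤n+m N (toℕ i) , dist<N ⟦ position-of i ⟧ j , ⟦position⟧ i , ⟦+dist⟧ (position-of i) j

  vertex-lift : ∀ i → ∃ λ x → N ≤ x × ⟦ x ⟧ ≡ i
  vertex-lift i = position-of i , m≤n+m N (toℕ i) , ⟦position⟧ i

  isFriezeD : IsFriezeD N (m N 𝒯) (m₀ N 𝒯)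
  isFriezeD = record { pos = positive ; pos₀ = positive₀ ; conv = convention ; R1 = r₁ ; R2 = r₂ ; R3 = r₃ ; R4 = r₄ }
    where
    μ = mNum
    N∸1 : ∀ x → suc (x + (N ∸ 1)) ≡ x + N
    N∸1 x = trans (sym (+-suc x (N ∸ 1))) (cong (λ n → x + n) (m+[n∸m]≡n 0<N))
    positive : ∀ i j → 0 < μ i j
    positive i j with arc-lift i j
    ... | x , zero , N≤x , _ , refl , refl = subst (λ y → 0 < μ ⟦ x ⟧ ⟦ y ⟧) (sym (+-identityʳ x)) (At.loop-positive x N≤x)
    ... | x , suc d , N≤x , d<N , refl , refl = At.arc-positive x N≤x (m<m+n x (s≤s z≤n)) (+-monoʳ-< x d<N)
    positive₀ : ∀ i → 0 < mCentral i
    positive₀ i with vertex-lift i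
    ... | x , N≤x , refl = At.central-positive x N≤x
    convention : ∀ i → μ i (_⊕_ N i 1) ≡ 1
    convention i rewrite ≡ᵇ-yes {toℕ (_⊕_ N i 1)} refl = refl
    r₁ : ∀ i j → j ≢ _⊕_ N i (N ∸ 1) → j ≢ i → j ≢ _⊕_ N i 1 →
         μ i j * μ (_⊕_ N i 1) (_⊕_ N j 1) ≡ μ (_⊕_ N i 1) j * μ i (_⊕_ N j 1) + 1
    r₁ i j a b c with arc-lift i j
    ... | x , zero , N≤x , _ , refl , refl = ⊥-elim (b (cong ⟦_⟧ (+-identityʳ x)))
    ... | x , suc zero , N≤x , _ , refl , refl = ⊥-elim (c (sym (⌊⌋-⊕ x 1)))
    ... | x , d@(suc (suc e)) , N≤x , d<N , refl , refl =
      -- The excluded value j = i - 1 is d = N - 1; without it the end y + 1 stays less than one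
      -- turn from x, so all four entries are values of `m-value`.
      subst₂ (λ i′ j′ → μ ⟦ x ⟧ ⟦ x + d ⟧ * μ i′ j′ ≡ μ i′ ⟦ x + d ⟧ * μ ⟦ x ⟧ j′ + 1) (sym (⊕1 x)) (sym (⊕1 (x + d)))
      (At.rule₁ x N≤x (subst (_< x + d) (+-comm x 1) (+-monoʳ-< x (s≤s (s≤s z≤n)))) 1+y<)
      where
      1+y< : suc (x + d) < x + N
      1+y< = subst (_< x + N) (+-suc x d) (+-monoʳ-< x (≤∧≢⇒< d<N (λ eq → a (trans (cong (λ n → ⟦ x + n ⟧) (cong (_∸ 1) eq)) (sym (⌊⌋-⊕ x (N ∸ 1)))))))
    r₂ : ∀ i → μ i (_⊕_ N i (N ∸ 1)) * μ (_⊕_ N i 1) i ≡ μ (_⊕_ N i 1) (_⊕_ N i (N ∸ 1)) * μ i i * mCentral i + 1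
    r₂ i with vertex-lift i
    ... | x , N≤x , refl =
      subst₂ (λ i′ j′ → μ ⟦ x ⟧ j′ * μ i′ ⟦ x ⟧ ≡ μ i′ j′ * μ ⟦ x ⟧ ⟦ x ⟧ * mCentral ⟦ x ⟧ + 1) (sym (⊕1 x)) (sym (⌊⌋-⊕ x (N ∸ 1)))
      (At.rule₂ x N≤x (N∸1 x) (subst (_< x + (N ∸ 1)) (+-comm x 1) (+-monoʳ-< x (m+n≤o⇒m≤o∸n 2 3≤N))))
    r₃ : ∀ i → μ i i * mCentral (_⊕_ N i 1) ≡ μ (_⊕_ N i 1) i + 1
    r₃ i with vertex-lift i
    ... | x , N≤x , refl = subst (λ i′ → μ ⟦ x ⟧ ⟦ x ⟧ * mCentral i′ ≡ μ i′ ⟦ x ⟧ + 1) (sym (⊕1 x)) (At.rule₃ x N≤x)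
    r₄ : ∀ i → mCentral i * μ (_⊕_ N i 1) (_⊕_ N i 1) ≡ μ (_⊕_ N i 1) i + 1
    r₄ i with vertex-lift i
    ... | x , N≤x , refl = subst (λ i′ → mCentral ⟦ x ⟧ * μ i′ i′ ≡ μ i′ ⟦ x ⟧ + 1) (sym (⊕1 x)) (At.rule₄ x N≤x)

theorem4p9 : (N : ℕ) .{{_ : NonZero N}} → 3 ≤ N → (𝒯 : Triangulation N) →
    IsFriezeD N (m N 𝒯) (m₀ N 𝒯)
theorem4p9 N 3≤N 𝒯 = Lift.isFriezeD N 3≤N 𝒯
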